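{- Let $q=p^s$ with $p$ an odd prime and $s\ge1$, let $k\geq1$ be an integer, and let $$\widetilde N^*(k,0)=\#\{(x_1,\dots,x_k)\in(\mathbb{F}_q^*)^k\mid x_1^2+\cdots+x_k^2=0,\ x_i\ne x_j\text{ for all }i\neq j\}.$$ (1) If either $p\equiv1\pmod4$, or $p\equiv3\pmod4$ and $s$ is even, then $$\widetilde N^*(k,0)=\frac{(q-1)_k}{q}+(-1)^k\frac{q-1}{2q}\Big\{A_{k,1}(1-\sqrt q,1+\sqrt q,1-q)+A_{k,1}(1+\sqrt q,1-\sqrt q,1-q)\Big\}.$$ (2) If $p\equiv3\pmod4$ and $s$ is odd, then $$\widetilde N^*(k,0)=\frac{(q-1)_k}{q}+(-1)^k\frac{q-1}{2q}\Big\{A_{k,1}(1-\sqrt q i,1+\sqrt q i,1-q)+A_{k,1}(1+\sqrt q i,1-\sqrt q i,1-q)\Big\},$$ where $i=\sqrt{ -1}$.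
   Context: $(x)_k=x(x-1)\cdots(x-k+1)$. $\chi$ denotes the quadratic character of $\mathbb{F}_q^*$, and for an integer $j$, $\chi(j)$ means $\chi$ evaluated at the image of $j$ in $\mathbb{F}_q$. For integers $c_1,\dots,c_k\geq 0$ with $\sum_j jc_j=k$, let $N(c_1,\dots,c_k)=\frac{k!}{1^{c_1}c_1!\,2^{c_2}c_2!\cdots k^{c_k}c_k!}$. For $b\in\mathbb{F}_q^*$ and complex $u,v,w$, define $$A_{k,b}(u,v,w)=\sum_{c_1,\dots,c_k\ge 0,\ \sum_j jc_j=k}N(c_1,\dots,c_k)\,t_1^{c_1}\cdots t_k^{c_k},$$ where $t_j=u$ if $p\nmid j$ and $\chi(j)=\chi(b)$; $t_j=v$ if $p\nmid j$ and $\chi(j)=-\chi(b)$; $t_j=w$ if $p\mid j$. (So $A_{k,1}$ uses $\chi(b)=1$.) -}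

module Defs where

open import Data.Bool using (Bool; true; false; if_then_else_)
open import Data.Nat as ℕ using (ℕ; zero; suc; _!; NonZero)
open import Data.Nat.Properties using (m*n≢0; m^n≢0; _!≢0)
open import Data.Nat.Divisibility using (_∣?_)
open import Data.Integer as ℤ using (ℤ; +_)
open import Data.Rational as ℚ using (ℚ)
open import Data.Fin as Fin using (Fin; toℕ)
open import Data.Vec as Vec using (Vec; []; _∷_)
open import Data.List as List using (List; []; _∷_; length; filter; map; concatMap; upTo)
open import Data.List.Membership.Propositional using (_∈_)
open import Data.List.Relation.Unary.Unique.Propositional using (Unique)
open import Data.List.Relation.Unary.Any using (any?)
open import Data.Product using (Σ; _×_; _,_)
open import Relation.Nullary using (¬_; Dec; yes; no)
open import Relation.Nullary.Decidable using (⌊_⌋; ¬?; _×-dec_)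
open import Relation.Binary.PropositionalEquality using (_≡_; _≢_)
open import Relation.Binary.Definitions using (DecidableEquality)
open import Algebra.Structures using (IsCommutativeRing)
import Data.List.Relation.Unary.Unique.DecPropositional as UniqueDec
open import Data.Bool.Properties using () renaming (_≟_ to _Bool≟_)

record FiniteField : Set₁ where
  infixl 6 _+_
  infixl 7 _*_
  field
    Carrier : Set
    _+_ _*_ : Carrier → Carrier → Carrier
    -_      : Carrier → Carrier
    0# 1#   : Carrier
    isCommutativeRing : IsCommutativeRing _≡_ _+_ _*_ -_ 0# 1#
    _≟_     : DecidableEquality Carrier
    0≢1     : 0# ≢ 1#
    inverse : ∀ x → x ≢ 0# → Σ Carrier (λ y → x * y ≡ 1#)
    elems   : List Carrier
    elems-complete : ∀ x → x ∈ elems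
    elems-unique   : Unique elems

  size : ℕ
  size = length elems

  fromℕ : ℕ → Carrier
  fromℕ zero    = 0#
  fromℕ (suc n) = 1# + fromℕ n

  isSquare : Carrier → Bool
  isSquare a = ⌊ any? (λ y → (y * y) ≟ a) elems ⌋

  nonzeros : List Carrier
  nonzeros = filter (λ x → ¬? (x ≟ 0#)) elems

  tuples : (k : ℕ) → List (Vec Carrier k)
  tuples zero    = [] ∷ []
  tuples (suc k) = concatMap (λ x → map (x ∷_) (tuples k)) nonzeros

  sumSq : ∀ {k} → Vec Carrier k → Carrier
  sumSq []       = 0#
  sumSq (x ∷ xs) = x * x + sumSq xs

  Nstar0 : ℕ → ℕ
  Nstar0 k = length (filter
    (λ v → (sumSq v ≟ 0#) ×-dec UniqueDec.unique? _≟_ (Vec.toList v))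
    (tuples k))

-- The ring ℚ(√d) = ℚ[X]/(X² - d): a + b√d is represented by (a , b).

record Qrt (d : ℚ) : Set where
  constructor _+√_
  field re im : ℚ

module QrtOps (d : ℚ) where
  infixl 6 _⊕_
  infixl 7 _⊗_
  _⊕_ : Qrt d → Qrt d → Qrt d
  (a +√ b) ⊕ (c +√ e) = (a ℚ.+ c) +√ (b ℚ.+ e)
  _⊗_ : Qrt d → Qrt d → Qrt d
  (a +√ b) ⊗ (c +√ e) = (a ℚ.* c ℚ.+ d ℚ.* (b ℚ.* e)) +√ (a ℚ.* e ℚ.+ b ℚ.* c)
  ι : ℚ → Qrt d
  ι a = a +√ ℚ.0ℚ
  𝟘 𝟙 : Qrt d
  𝟘 = ι ℚ.0ℚ
  𝟙 = ι ℚ.1ℚ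
  √d : Qrt d
  √d = ℚ.0ℚ +√ ℚ.1ℚ
  _^_ : Qrt d → ℕ → Qrt d
  x ^ zero  = 𝟙
  x ^ suc n = x ⊗ (x ^ n)
  Σ-list : List (Qrt d) → Qrt d
  Σ-list = List.foldr _⊕_ 𝟘

fall : ℤ → ℕ → ℤ
fall x zero    = + 1
fall x (suc k) = fall x k ℤ.* (x ℤ.- + k)

-- Tuples (c₁,…,c_k) with Σ j c_j = k.  A tuple is a Vec ℕ k whose entry
-- at position i : Fin k is c_j with j = toℕ i + 1.

vecsUpTo : (n bound : ℕ) → List (Vec ℕ n)
vecsUpTo zero    b = [] ∷ []
vecsUpTo (suc n) b = concatMap (λ c → map (c ∷_) (vecsUpTo n b)) (upTo (suc b))

weight : ∀ {n} → ℕ → Vec ℕ n → ℕ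
weight start []       = 0
weight start (c ∷ cs) = start ℕ.* c ℕ.+ weight (suc start) cs

cycleTypes : (k : ℕ) → List (Vec ℕ k)
cycleTypes k = filter (λ c → weight 1 c ℕ.≟ k) (vecsUpTo k k)

denom : ∀ {n} → (start : ℕ) → Vec ℕ n → Σ ℕ NonZero
denom start []       = 1 , _
denom start (c ∷ cs) with denom (suc start) cs
... | (m , nz) = (suc start ℕ.^ c ℕ.* c ! ℕ.* m) ,
   m*n≢0 _ _ {{m*n≢0 _ _ {{m^n≢0 (suc start) c}} {{c !≢0}}}} {{nz}}

Ncoef : (k : ℕ) → Vec ℕ k → ℚ
Ncoef k c with denom 0 c
... | (m , nz) = ℚ._/_ (+ (k !)) m {{nz}}

module _ (F : FiniteField) (p : ℕ) (d : ℚ) where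
  open FiniteField F
  open QrtOps d

  -- t_j for j = toℕ-index: u if p ∤ j and χ(j) = χ(b); v if p ∤ j and
  -- χ(j) = -χ(b); w if p ∣ j.
  tval : Carrier → Qrt d → Qrt d → Qrt d → ℕ → Qrt d
  tval b u v w j with p ∣? j
  ... | yes _ = w
  ... | no  _ = if ⌊ isSquare (fromℕ j) Bool≟ isSquare b ⌋ then u else v

  monomial : ∀ {n} → Carrier → Qrt d → Qrt d → Qrt d → ℕ → Vec ℕ n → Qrt d
  monomial b u v w start []       = 𝟙
  monomial b u v w start (c ∷ cs) = (tval b u v w start ^ c) ⊗ monomial b u v w (suc start) cs

  A : (k : ℕ) → Carrier → Qrt d → Qrt d → Qrt d → Qrt d
  A k b u v w = Σ-list (map (λ c → ι (Ncoef k c) ⊗ monomial b u v w 1 c) (cycleTypes k))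

-- Right-hand side of Theorem 4.6, with d = q (part 1) or d = -q (part 2),
-- √(-q) being √q·i:
-- (q-1)_k / q + (-1)^k (q-1)/(2q) { A_{k,1}(1-√d, 1+√d, 1-q) + A_{k,1}(1+√d, 1-√d, 1-q) }

rhs : (F : FiniteField) (p : ℕ) (d : ℚ) (k : ℕ) → Qrt d
rhs F p d k =
  ι (ℚ._/_ (fall (+ q ℤ.- + 1) k) q {{qnz}})
  ⊕ ι (sign ℚ.* ℚ._/_ (+ q ℤ.- + 1) (2 ℕ.* q) {{m*n≢0 2 q {{_}} {{qnz}}}})
    ⊗ (A F p d k 1# (𝟙 ⊕ neg √d) (𝟙 ⊕ √d) w
       ⊕ A F p d k 1# (𝟙 ⊕ √d) (𝟙 ⊕ neg √d) w)
  where
  open FiniteField F using (size; 1#)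
  open QrtOps d
  q = size
  qnz : NonZero q
  qnz = nonempty (FiniteField.elems-complete F (FiniteField.0# F))
    where
    open import Data.List.Relation.Unary.Any using (here; there)
    nonempty : ∀ {A : Set} {x : A} {xs : List A} → x ∈ xs → NonZero (length xs)
    nonempty (here _)  = _
    nonempty (there _) = _
  sign : ℚ
  sign = ℚ._/_ (ℤ.-1ℤ ℤ.^ k) 1
  neg : Qrt d → Qrt d
  neg (a +√ b) = (ℚ.- a) +√ (ℚ.- b)
  w = ι (ℚ._/_ (+ 1 ℤ.- + q) 1)

{-# OPTIONS --safe #-}
-- In the group ring of (F , +) put J = Σ [x] and G = Σ χ(x) [x].  Then J² = qJ, JG = 0 and
-- G² = χ(-1)(q - J), so the span of 1, J, G is ℚ × ℚ(√d) with d = χ(-1) q: one factor sends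
-- (J , G) to (q , 0), the other to (0 , √d).  For a ≠ 0 the element Σ_{y ≠ 0} [a y²] is
-- J - 1 + χ(a) G.  Newton's recursion expresses the sum of [x₁² + ⋯ + x_k²] over k-tuples of
-- distinct nonzero xᵢ through the power sums Σ_{y ≠ 0} [j y²], and the cycle index A_k obeys
-- the same recursion; the first factor yields (q - 1)_k, the second (-1)^k A_k(1 ∓ √d, …).
-- The coefficient of [0] is then read off, and χ(-1) is determined by q mod 4.
module Submission where

open import Defs
open import Algebra.Core using (Op₁; Op₂)
open import Algebra.Structures using (IsCommutativeRing)
open import Algebra.Bundles using (CommutativeRing)
open import Level using (0ℓ)
open import Data.Nat as ℕ using (ℕ; zero; suc; z≤n; s≤s; _!)
import Data.Nat.Properties as ℕ
open import Data.Integer as ℤ using (ℤ; +_)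
import Data.Integer.Properties as ℤ
open import Data.List as List using (List; []; _∷_; _++_; map; concatMap; filter; applyUpTo; upTo; length)
open import Data.List.Membership.Propositional using (_∈_)
open import Data.List.Relation.Unary.Any using (here; there; any?)
import Data.List.Relation.Unary.Any as Any
open import Data.List.Relation.Unary.All as All using (All; []; _∷_; all?)
open import Data.List.Relation.Unary.AllPairs using ([]; _∷_)
open import Data.List.Relation.Unary.Unique.Propositional using (Unique)
open import Data.Vec as Vec using (Vec; []; _∷_)
open import Data.Product using (_×_; _,_; proj₁; proj₂; ∃)
open import Data.Sum using (_⊎_; inj₁; inj₂; [_,_]′)
open import Function using (_∘_; id)
open import Relation.Nullary using (¬_; Dec; yes; no; contradiction)
open import Relation.Nullary.Decidable using (¬?; _×-dec_)
open import Relation.Unary using (Pred; Decidable)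
open import Relation.Binary.Definitions using (DecidableEquality)
open import Relation.Binary.PropositionalEquality
import Data.Nat.Tactic.RingSolver as ℕSolver
import Data.Integer.Tactic.RingSolver as ℤSolver
open import Data.Rational as ℚ using (ℚ)
import Data.Rational.Properties as ℚ
open import Data.Rational.Unnormalised as ℚᵘ using (ℚᵘ; mkℚᵘ; *≡*)
import Data.Rational.Unnormalised.Properties as ℚᵘ
open import Data.Nat.Divisibility using (_∣_; _∣?_; divides)
open import Data.Nat.Primality using (Prime; irreducible[2]; prime⇒irreducible; ¬prime[1])
open import Data.Nat.Coprimality using (coprime-Bézout)
open import Data.Nat.GCD using (module Bézout)
open import Data.Nat.DivMod using (m≡m%n+[m/n]*n)
open import Data.Rational.Solver using (module +-*-Solver)
open import Data.Bool using (true; false)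
import Data.List.Relation.Unary.Unique.DecPropositional as UniqueDec

-- The count gets a second index j, the multiplier of the first square. Dropping the requirement
-- that the other entries avoid the first one overcounts by the tuples in which one of them equals
-- it, and merging the two turns the multiplier j into j + 1. This gives a recursion with two terms,
-- of which only the values at j = 1 are wanted. The cycle index satisfies it once the power sums
-- change sign, which is where (-1)^k and the arguments 1 - √d, 1 + √d, 1 - q come from: they are
-- the negatives of the images of Σ_{y ≠ 0} [j y²]. The two summands of the formula belong to the
-- two choices of the square root of d; adding them cancels the √d part and doubles the rational
-- one, hence the 2 in the denominator. Coefficients in the group ring stay integers. Denominators
-- come from the cycle index and the final formula, so division is confined to ℚ and the ring
-- ℚ[X]/(X² - d) never needs to be a field.

module Sums {R : Set} {_+_ _*_ : Op₂ R} { -_ : Op₁ R} {0# 1# : R}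
            (isCR : IsCommutativeRing _≡_ _+_ _*_ -_ 0# 1#) where

  private
    infixl 6 _⊞_
    infixl 7 _⊠_
    _⊞_ _⊠_ : R → R → R
    _⊞_ = _+_
    _⊠_ = _*_

  open IsCommutativeRing isCR
    using (+-assoc; +-comm; +-identityˡ; +-identityʳ; *-assoc; *-comm; *-identityˡ; distribˡ; zeroˡ; zeroʳ)
  open ≡-Reasoning

  +-interchange : ∀ a b c d → (a ⊞ b) ⊞ (c ⊞ d) ≡ (a ⊞ c) ⊞ (b ⊞ d)
  +-interchange a b c d = begin
    (a ⊞ b) ⊞ (c ⊞ d)  ≡⟨ +-assoc a b _ ⟩
    a ⊞ (b ⊞ (c ⊞ d))  ≡⟨ cong (a ⊞_) (+-assoc b c d) ⟨
    a ⊞ ((b ⊞ c) ⊞ d)  ≡⟨ cong (λ x → a ⊞ (x ⊞ d)) (+-comm b c) ⟩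
    a ⊞ ((c ⊞ b) ⊞ d)  ≡⟨ cong (a ⊞_) (+-assoc c b d) ⟩
    a ⊞ (c ⊞ (b ⊞ d))  ≡⟨ +-assoc a c _ ⟨
    (a ⊞ c) ⊞ (b ⊞ d)  ∎

  *-exchange : ∀ a b c → a ⊠ (b ⊠ c) ≡ b ⊠ (a ⊠ c)
  *-exchange a b c = begin
    a ⊠ (b ⊠ c)  ≡⟨ *-assoc a b c ⟨
    (a ⊠ b) ⊠ c  ≡⟨ cong (_⊠ c) (*-comm a b) ⟩
    (b ⊠ a) ⊠ c  ≡⟨ *-assoc b a c ⟩
    b ⊠ (a ⊠ c)  ∎

  ∑ : {X : Set} → List X → (X → R) → R
  ∑ []       f = 0#
  ∑ (x ∷ xs) f = f x ⊞ ∑ xs f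

  ⟦_⟧ : {P : Set} → Dec P → R
  ⟦ yes _ ⟧ = 1#
  ⟦ no  _ ⟧ = 0#

  ⟦⟧-yes : {P : Set} (P? : Dec P) → P → ⟦ P? ⟧ ≡ 1#
  ⟦⟧-yes (yes _) _ = refl
  ⟦⟧-yes (no ¬p) p = contradiction p ¬p

  ⟦⟧-no : {P : Set} (P? : Dec P) → ¬ P → ⟦ P? ⟧ ≡ 0#
  ⟦⟧-no (no _)  _  = refl
  ⟦⟧-no (yes p) ¬p = contradiction p ¬p

  ⟦⟧-cong : {P Q : Set} (P? : Dec P) (Q? : Dec Q) → (P → Q) → (Q → P) → ⟦ P? ⟧ ≡ ⟦ Q? ⟧
  ⟦⟧-cong (yes p) Q? f g = sym (⟦⟧-yes Q? (f p))
  ⟦⟧-cong (no ¬p) Q? f g = sym (⟦⟧-no Q? (¬p ∘ g))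

  ⟦⟧-× : {P Q : Set} (P? : Dec P) (Q? : Dec Q) → ⟦ P? ×-dec Q? ⟧ ≡ ⟦ P? ⟧ ⊠ ⟦ Q? ⟧
  ⟦⟧-× (yes p) (yes q) = sym (*-identityˡ 1#)
  ⟦⟧-× (yes p) (no ¬q) = sym (*-identityˡ 0#)
  ⟦⟧-× (no ¬p) Q?      = sym (zeroˡ _)

  ⟦⟧-guard : {P : Set} (P? : Dec P) {a b : R} → (P → a ≡ b) → ⟦ P? ⟧ ⊠ a ≡ ⟦ P? ⟧ ⊠ b
  ⟦⟧-guard (yes p) eq = cong (1# ⊠_) (eq p)
  ⟦⟧-guard (no ¬p) eq = trans (zeroˡ _) (sym (zeroˡ _))

  module _ {X : Set} where

    ∑-cong : ∀ (xs : List X) {f g : X → R} → (∀ x → f x ≡ g x) → ∑ xs f ≡ ∑ xs g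
    ∑-cong []       eq = refl
    ∑-cong (x ∷ xs) eq = cong₂ _⊞_ (eq x) (∑-cong xs eq)

    ∑-zero : ∀ (xs : List X) {f : X → R} → (∀ x → f x ≡ 0#) → ∑ xs f ≡ 0#
    ∑-zero []       eq = refl
    ∑-zero (x ∷ xs) eq = trans (cong₂ _⊞_ (eq x) (∑-zero xs eq)) (+-identityˡ 0#)

    ∑-+ : ∀ (xs : List X) (f g : X → R) → ∑ xs (λ x → f x ⊞ g x) ≡ ∑ xs f ⊞ ∑ xs g
    ∑-+ []       f g = sym (+-identityˡ 0#)
    ∑-+ (x ∷ xs) f g = trans (cong ((f x ⊞ g x) ⊞_) (∑-+ xs f g)) (+-interchange _ _ _ _)

    ∑-*ˡ : ∀ (xs : List X) a (f : X → R) → ∑ xs (λ x → a ⊠ f x) ≡ a ⊠ ∑ xs f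
    ∑-*ˡ []       a f = sym (zeroʳ a)
    ∑-*ˡ (x ∷ xs) a f = trans (cong (a ⊠ f x ⊞_) (∑-*ˡ xs a f)) (sym (distribˡ a _ _))

    ∑-*ʳ : ∀ (xs : List X) a (f : X → R) → ∑ xs (λ x → f x ⊠ a) ≡ ∑ xs f ⊠ a
    ∑-*ʳ xs a f = begin
      ∑ xs (λ x → f x ⊠ a)  ≡⟨ ∑-cong xs (λ x → *-comm (f x) a) ⟩
      ∑ xs (λ x → a ⊠ f x)  ≡⟨ ∑-*ˡ xs a f ⟩
      a ⊠ ∑ xs f            ≡⟨ *-comm a _ ⟩
      ∑ xs f ⊠ a            ∎

    ∑-++ : ∀ (xs ys : List X) f → ∑ (xs ++ ys) f ≡ ∑ xs f ⊞ ∑ ys f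
    ∑-++ []       ys f = sym (+-identityˡ _)
    ∑-++ (x ∷ xs) ys f = trans (cong (f x ⊞_) (∑-++ xs ys f)) (sym (+-assoc _ _ _))

    ∑-filter : ∀ {P : Pred X 0ℓ} (P? : Decidable P) xs (f : X → R) →
               ∑ (filter P? xs) f ≡ ∑ xs (λ x → ⟦ P? x ⟧ ⊠ f x)
    ∑-filter P? []       f = refl
    ∑-filter P? (x ∷ xs) f with P? x
    ... | yes _ = cong₂ _⊞_ (sym (*-identityˡ _)) (∑-filter P? xs f)
    ... | no  _ = trans (∑-filter P? xs f) (sym (trans (cong₂ _⊞_ (zeroˡ (f x)) refl) (+-identityˡ _)))

  ∑-swap : ∀ {X Y : Set} (xs : List X) (ys : List Y) (f : X → Y → R) →
           ∑ xs (λ x → ∑ ys (f x)) ≡ ∑ ys (λ y → ∑ xs (λ x → f x y))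
  ∑-swap []       ys f = sym (∑-zero ys (λ _ → refl))
  ∑-swap (x ∷ xs) ys f = trans (cong (∑ ys (f x) ⊞_) (∑-swap xs ys f)) (sym (∑-+ ys _ _))

  ∑-map : ∀ {X Y : Set} (g : X → Y) xs (f : Y → R) → ∑ (map g xs) f ≡ ∑ xs (f ∘ g)
  ∑-map g []       f = refl
  ∑-map g (x ∷ xs) f = cong (f (g x) ⊞_) (∑-map g xs f)

  ∑-concatMap : ∀ {X Y : Set} (g : X → List Y) xs (f : Y → R) →
                ∑ (concatMap g xs) f ≡ ∑ xs (λ x → ∑ (g x) f)
  ∑-concatMap g []       f = refl
  ∑-concatMap g (x ∷ xs) f =
    trans (∑-++ (g x) (concatMap g xs) f) (cong (∑ (g x) f ⊞_) (∑-concatMap g xs f))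

  -- Opaque so that unification never unfolds ∑< (suc n).
  opaque
    ∑< : ℕ → (ℕ → R) → R
    ∑< zero    f = 0#
    ∑< (suc n) f = f 0 ⊞ ∑< n (f ∘ suc)

    ∑<-empty : ∀ f → ∑< 0 f ≡ 0#
    ∑<-empty f = refl

    ∑<-first : ∀ n f → ∑< (suc n) f ≡ f 0 ⊞ ∑< n (f ∘ suc)
    ∑<-first n f = refl

    ∑-applyUpTo : ∀ {X : Set} n (g : ℕ → X) (f : X → R) → ∑ (applyUpTo g n) f ≡ ∑< n (f ∘ g)
    ∑-applyUpTo zero    g f = refl
    ∑-applyUpTo (suc n) g f = cong (f (g 0) ⊞_) (∑-applyUpTo n (g ∘ suc) f)

    ∑<-cong : ∀ n {f g : ℕ → R} → (∀ i → f i ≡ g i) → ∑< n f ≡ ∑< n g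
    ∑<-cong zero    eq = refl
    ∑<-cong (suc n) eq = cong₂ _⊞_ (eq 0) (∑<-cong n (eq ∘ suc))

    ∑<-zero : ∀ n {f : ℕ → R} → (∀ i → f i ≡ 0#) → ∑< n f ≡ 0#
    ∑<-zero zero    eq = refl
    ∑<-zero (suc n) eq = trans (cong₂ _⊞_ (eq 0) (∑<-zero n (eq ∘ suc))) (+-identityˡ 0#)

    ∑<-+ : ∀ n (f g : ℕ → R) → ∑< n (λ i → f i ⊞ g i) ≡ ∑< n f ⊞ ∑< n g
    ∑<-+ zero    f g = sym (+-identityˡ 0#)
    ∑<-+ (suc n) f g = trans (cong ((f 0 ⊞ g 0) ⊞_) (∑<-+ n (f ∘ suc) (g ∘ suc))) (+-interchange _ _ _ _)

    ∑<-*ˡ : ∀ n a (f : ℕ → R) → ∑< n (λ i → a ⊠ f i) ≡ a ⊠ ∑< n f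
    ∑<-*ˡ zero    a f = sym (zeroʳ a)
    ∑<-*ˡ (suc n) a f = trans (cong (a ⊠ f 0 ⊞_) (∑<-*ˡ n a (f ∘ suc))) (sym (distribˡ a _ _))

    ∑<-swap : ∀ m n (f : ℕ → ℕ → R) →
              ∑< m (λ i → ∑< n (f i)) ≡ ∑< n (λ j → ∑< m (λ i → f i j))
    ∑<-swap zero    n f = sym (∑<-zero n (λ _ → refl))
    ∑<-swap (suc m) n f = trans (cong (∑< n (f 0) ⊞_) (∑<-swap m n (f ∘ suc))) (sym (∑<-+ n _ _))

    ∑<-last : ∀ n (f : ℕ → R) → ∑< (suc n) f ≡ ∑< n f ⊞ f n
    ∑<-last zero    f = trans (+-identityʳ _) (sym (+-identityˡ _))
    ∑<-last (suc n) f = trans (cong (f 0 ⊞_) (∑<-last n (f ∘ suc))) (sym (+-assoc _ _ _))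

  nat : ℕ → R
  nat zero    = 0#
  nat (suc n) = 1# ⊞ nat n

  nat-+ : ∀ m n → nat (m ℕ.+ n) ≡ nat m ⊞ nat n
  nat-+ zero    n = sym (+-identityˡ _)
  nat-+ (suc m) n = trans (cong (1# ⊞_) (nat-+ m n)) (sym (+-assoc _ _ _))

  nat-* : ∀ m n → nat (m ℕ.* n) ≡ nat m ⊠ nat n
  nat-* zero    n = sym (zeroˡ _)
  nat-* (suc m) n = begin
    nat (n ℕ.+ m ℕ.* n)           ≡⟨ nat-+ n _ ⟩
    nat n ⊞ nat (m ℕ.* n)         ≡⟨ cong₂ _⊞_ (sym (*-identityˡ _)) (nat-* m n) ⟩
    1# ⊠ nat n ⊞ nat m ⊠ nat n    ≡⟨ IsCommutativeRing.distribʳ isCR (nat n) 1# (nat m) ⟨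
    (1# ⊞ nat m) ⊠ nat n          ∎

  ∑-one : ∀ {X : Set} (xs : List X) → ∑ xs (λ _ → 1#) ≡ nat (length xs)
  ∑-one []       = refl
  ∑-one (x ∷ xs) = cong (1# ⊞_) (∑-one xs)

-- The cycle index as a generating function coefficient, and its recursion.

module CycleIndex {R : Set} {_+_ _*_ : Op₂ R} { -_ : Op₁ R} {0# 1# : R}
            (isCR : IsCommutativeRing _≡_ _+_ _*_ -_ 0# 1#) where

  private
    infixl 6 _⊞_
    infixl 7 _⊠_
    infix 8 ⊟_
    _⊞_ _⊠_ : R → R → R
    _⊞_ = _+_
    _⊠_ = _*_
    ⊟_ : R → R
    ⊟_ = -_

  open IsCommutativeRing isCR
    using (+-identityˡ; +-identityʳ; *-assoc; *-identityˡ; *-identityʳ; distribˡ; distribʳ; zeroˡ; zeroʳ)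
  private
    commutativeRing : CommutativeRing 0ℓ 0ℓ
    commutativeRing = record { isCommutativeRing = isCR }

  open import Algebra.Properties.Ring (CommutativeRing.ring commutativeRing)
    using (-‿distribˡ-*; -0#≈0#)
  open Sums isCR
  open ≡-Reasoning

  sgn : ℕ → R
  sgn zero    = 1#
  sgn (suc k) = ⊟ sgn k

  -- γ j c is the contribution t_j^c / (j^c c!) of c cycles of length j.
  module _ (t : ℕ → R) (γ : ℕ → ℕ → R)
           (γ-zero : ∀ j → γ (suc j) 0 ≡ 1#)
           (γ-suc : ∀ j c → nat (suc j ℕ.* suc c) ⊠ γ (suc j) (suc c) ≡ t (suc j) ⊠ γ (suc j) c) where

    term : ∀ {n} → ℕ → Vec ℕ n → R
    term i []       = 1#
    term i (c ∷ cs) = γ i c ⊠ term (suc i) cs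

    -- The sum of the terms of weight m - r, without subtraction.
    coeff : (n b i r m : ℕ) → R
    coeff n b i r m = ∑ (vecsUpTo n b) (λ c → ⟦ r ℕ.+ weight i c ℕ.≟ m ⟧ ⊠ term i c)

    -- The counterpart of `coeff` for the operator x d/dx, which multiplies a term by its weight;
    -- the shift `r` does not enter that factor.
    wcoeff : (n b i r m : ℕ) → R
    wcoeff n b i r m =
      ∑ (vecsUpTo n b) (λ c → ⟦ r ℕ.+ weight i c ℕ.≟ m ⟧ ⊠ (nat (weight i c) ⊠ term i c))

    ∑-vecsUpTo : ∀ n b (f : Vec ℕ (suc n) → R) →
      ∑ (vecsUpTo (suc n) b) f ≡ ∑< (suc b) (λ c → ∑ (vecsUpTo n b) (λ cs → f (c ∷ cs)))
    ∑-vecsUpTo n b f = begin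
      ∑ (vecsUpTo (suc n) b) f
        ≡⟨ ∑-concatMap (λ c → map (c ∷_) (vecsUpTo n b)) (upTo (suc b)) f ⟩
      ∑ (upTo (suc b)) (λ c → ∑ (map (c ∷_) (vecsUpTo n b)) f)
        ≡⟨ ∑-cong (upTo (suc b)) (λ c → ∑-map (c ∷_) (vecsUpTo n b) f) ⟩
      ∑ (upTo (suc b)) (λ c → ∑ (vecsUpTo n b) (λ cs → f (c ∷ cs)))
        ≡⟨ ∑-applyUpTo (suc b) id _ ⟩
      ∑< (suc b) (λ c → ∑ (vecsUpTo n b) (λ cs → f (c ∷ cs))) ∎

    ⟦⟧-≟ : ∀ {x y} m → x ≡ y → ⟦ x ℕ.≟ m ⟧ ≡ ⟦ y ℕ.≟ m ⟧
    ⟦⟧-≟ m eq = cong (λ x → ⟦ x ℕ.≟ m ⟧) eq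

    coeff-suc : ∀ n b i r m →
      coeff (suc n) b i r m ≡ ∑< (suc b) (λ c → γ i c ⊠ coeff n b (suc i) (r ℕ.+ i ℕ.* c) m)
    coeff-suc n b i r m = trans (∑-vecsUpTo n b _) (∑<-cong (suc b) λ c →
      trans (∑-cong (vecsUpTo n b) λ cs →
        trans (cong₂ _⊠_ (⟦⟧-≟ m (sym (ℕ.+-assoc r (i ℕ.* c) (weight (suc i) cs)))) refl) (*-exchange _ _ _))
        (∑-*ˡ (vecsUpTo n b) (γ i c) _))

    coeff-vanish : ∀ n b i {r m} → m ℕ.< r → coeff n b i r m ≡ 0#
    coeff-vanish n b i {r} {m} m<r = ∑-zero (vecsUpTo n b) λ c →
      trans (cong₂ _⊠_ (⟦⟧-no (r ℕ.+ weight i c ℕ.≟ m)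
        λ eq → ℕ.<⇒≢ (ℕ.<-≤-trans m<r (ℕ.m≤m+n r _)) (sym eq)) refl)
        (zeroˡ _)

    coeff-shift : ∀ n b i r m → coeff n b i (suc r) (suc m) ≡ coeff n b i r m
    coeff-shift n b i r m = ∑-cong (vecsUpTo n b) λ c →
      cong₂ _⊠_ (⟦⟧-cong (suc r ℕ.+ weight i c ℕ.≟ suc m) (r ℕ.+ weight i c ℕ.≟ m)
        ℕ.suc-injective (cong suc)) refl

    -- No weight is left over, and positions start at `suc i`, so every nonzero entry would cost
    -- something: only the zero vector contributes.
    coeff-refl : ∀ n b i m → coeff n b (suc i) m m ≡ 1#
    coeff-refl zero    b i m = begin
      ⟦ m ℕ.+ 0 ℕ.≟ m ⟧ ⊠ 1# ⊞ 0#  ≡⟨ +-identityʳ _ ⟩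
      ⟦ m ℕ.+ 0 ℕ.≟ m ⟧ ⊠ 1#       ≡⟨ *-identityʳ _ ⟩
      ⟦ m ℕ.+ 0 ℕ.≟ m ⟧            ≡⟨ ⟦⟧-yes (m ℕ.+ 0 ℕ.≟ m) (ℕ.+-identityʳ m) ⟩
      1#                           ∎
    coeff-refl (suc n) b i m = begin
      coeff (suc n) b (suc i) m m
        ≡⟨ trans (coeff-suc n b (suc i) m m) (∑<-first b _) ⟩
      γ (suc i) 0 ⊠ coeff n b (suc (suc i)) (m ℕ.+ suc i ℕ.* 0) m
        ⊞ ∑< b (λ c → γ (suc i) (suc c) ⊠ coeff n b (suc (suc i)) (m ℕ.+ suc i ℕ.* suc c) m)
        ≡⟨ cong₂ _⊞_ (cong₂ _⊠_ (γ-zero i)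
             (trans (cong (λ r → coeff n b (suc (suc i)) r m)
                      (trans (cong (m ℕ.+_) (ℕ.*-zeroʳ (suc i))) (ℕ.+-identityʳ m)))
               (coeff-refl n b (suc i) m)))
             (∑<-zero b λ c → trans (cong (γ (suc i) (suc c) ⊠_)
               (coeff-vanish n b (suc (suc i)) (ℕ.m<m+n m (s≤s z≤n)))) (zeroʳ _)) ⟩
      1# ⊠ 1# ⊞ 0#
        ≡⟨ trans (+-identityʳ _) (*-identityˡ _) ⟩
      1# ∎

    -- Logarithmic differentiation of the generating function ∏ exp(t_j xʲ / j), one factor at a time.
    wcoeff≡ : ∀ n b i r {m} → m ℕ.≤ b →
      wcoeff n b (suc i) r m ≡ ∑< n (λ j → t (suc i ℕ.+ j) ⊠ coeff n b (suc i) (r ℕ.+ (suc i ℕ.+ j)) m)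
    wcoeff≡ zero    b i r {m} m≤b =
      trans (+-identityʳ _) (trans (cong (⟦ r ℕ.+ 0 ℕ.≟ m ⟧ ⊠_) (zeroˡ 1#)) (trans (zeroʳ _) (sym (∑<-empty _))))
    wcoeff≡ (suc n) b i r {m} m≤b = begin
      wcoeff (suc n) b (suc i) r m
        ≡⟨ ∑-vecsUpTo n b _ ⟩
      ∑< (suc b) (λ c → ∑ (vecsUpTo n b) (λ cs → ⟦ r ℕ.+ (suc i ℕ.* c ℕ.+ weight i′ cs) ℕ.≟ m ⟧
                          ⊠ (nat (suc i ℕ.* c ℕ.+ weight i′ cs) ⊠ (γ (suc i) c ⊠ term i′ cs))))
        ≡⟨ ∑<-cong (suc b) (λ c → trans (∑-cong (vecsUpTo n b) (λ cs → split c cs))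
             (trans (∑-+ (vecsUpTo n b) _ _) (cong₂ _⊞_ (∑-*ˡ (vecsUpTo n b) _ _) (∑-*ˡ (vecsUpTo n b) _ _)))) ⟩
      ∑< (suc b) (λ c → (nat (suc i ℕ.* c) ⊠ γ (suc i) c) ⊠ coeff n b i′ (r ℕ.+ suc i ℕ.* c) m
                        ⊞ γ (suc i) c ⊠ wcoeff n b i′ (r ℕ.+ suc i ℕ.* c) m)
        ≡⟨ ∑<-+ (suc b) _ _ ⟩
      ∑< (suc b) (λ c → (nat (suc i ℕ.* c) ⊠ γ (suc i) c) ⊠ coeff n b i′ (r ℕ.+ suc i ℕ.* c) m)
        ⊞ ∑< (suc b) (λ c → γ (suc i) c ⊠ wcoeff n b i′ (r ℕ.+ suc i ℕ.* c) m)
        ≡⟨ trans (cong₂ _⊞_ head tail) (sym (∑<-first n _)) ⟩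
      ∑< (suc n) (λ j → t (suc i ℕ.+ j) ⊠ coeff (suc n) b (suc i) (r ℕ.+ (suc i ℕ.+ j)) m) ∎
      where
      i′ : ℕ
      i′ = suc (suc i)

      -- The product rule: the weight is that of the first entry plus that of the remaining ones.
      -- The first summand becomes `head`, the second `tail`.
      split : ∀ c (cs : Vec ℕ n) →
        ⟦ r ℕ.+ (suc i ℕ.* c ℕ.+ weight i′ cs) ℕ.≟ m ⟧
          ⊠ (nat (suc i ℕ.* c ℕ.+ weight i′ cs) ⊠ (γ (suc i) c ⊠ term i′ cs))
        ≡ (nat (suc i ℕ.* c) ⊠ γ (suc i) c) ⊠ (⟦ r ℕ.+ suc i ℕ.* c ℕ.+ weight i′ cs ℕ.≟ m ⟧ ⊠ term i′ cs)
          ⊞ γ (suc i) c ⊠ (⟦ r ℕ.+ suc i ℕ.* c ℕ.+ weight i′ cs ℕ.≟ m ⟧ ⊠ (nat (weight i′ cs) ⊠ term i′ cs))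
      split c cs = begin
        ⟦ r ℕ.+ (suc i ℕ.* c ℕ.+ w) ℕ.≟ m ⟧ ⊠ (nat (suc i ℕ.* c ℕ.+ w) ⊠ (g ⊠ u))
          ≡⟨ cong₂ (λ x y → x ⊠ (y ⊠ (g ⊠ u))) (⟦⟧-≟ m (sym (ℕ.+-assoc r (suc i ℕ.* c) w))) (nat-+ (suc i ℕ.* c) w) ⟩
        e ⊠ ((N ⊞ nat w) ⊠ (g ⊠ u))
          ≡⟨ cong (e ⊠_) (distribʳ (g ⊠ u) N (nat w)) ⟩
        e ⊠ (N ⊠ (g ⊠ u) ⊞ nat w ⊠ (g ⊠ u))
          ≡⟨ distribˡ e _ _ ⟩
        e ⊠ (N ⊠ (g ⊠ u)) ⊞ e ⊠ (nat w ⊠ (g ⊠ u))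
          ≡⟨ cong₂ _⊞_ (trans (cong (e ⊠_) (sym (*-assoc N g u))) (*-exchange e (N ⊠ g) u))
                       (trans (cong (e ⊠_) (*-exchange (nat w) g u)) (*-exchange e g _)) ⟩
        (N ⊠ g) ⊠ (e ⊠ u) ⊞ g ⊠ (e ⊠ (nat w ⊠ u)) ∎
        where
        w = weight i′ cs
        g = γ (suc i) c
        u = term i′ cs
        N = nat (suc i ℕ.* c)
        e = ⟦ r ℕ.+ suc i ℕ.* c ℕ.+ w ℕ.≟ m ⟧

      r+i : ℕ
      r+i = r ℕ.+ (suc i ℕ.+ 0)

      -- The summand c = b that appears here is zero because m ≤ b.
      head : ∑< (suc b) (λ c → (nat (suc i ℕ.* c) ⊠ γ (suc i) c) ⊠ coeff n b i′ (r ℕ.+ suc i ℕ.* c) m)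
             ≡ t (suc i ℕ.+ 0) ⊠ coeff (suc n) b (suc i) r+i m
      head = begin
        ∑< (suc b) (λ c → (nat (suc i ℕ.* c) ⊠ γ (suc i) c) ⊠ coeff n b i′ (r ℕ.+ suc i ℕ.* c) m)
          ≡⟨ ∑<-first b _ ⟩
        (nat (suc i ℕ.* 0) ⊠ γ (suc i) 0) ⊠ coeff n b i′ (r ℕ.+ suc i ℕ.* 0) m
          ⊞ ∑< b (λ c → (nat (suc i ℕ.* suc c) ⊠ γ (suc i) (suc c)) ⊠ coeff n b i′ (r ℕ.+ suc i ℕ.* suc c) m)
          ≡⟨ cong₂ _⊞_
               (trans (cong₂ _⊠_ (trans (cong (λ x → nat x ⊠ γ (suc i) 0) (ℕ.*-zeroʳ (suc i))) (zeroˡ _)) refl) (zeroˡ _))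
               (∑<-cong b λ c → trans (cong₂ _⊠_
                   -- `γ-suc` removes one cycle of length `suc i` from the term; the weight of that
                   -- cycle moves into the shift.
                   (trans (γ-suc i c) (cong (λ x → t x ⊠ γ (suc i) c) (sym (ℕ.+-identityʳ (suc i)))))
                   (cong (λ x → coeff n b i′ x m) (shift c)))
                 (*-assoc _ _ _)) ⟩
        0# ⊞ ∑< b (λ c → t (suc i ℕ.+ 0) ⊠ (γ (suc i) c ⊠ coeff n b i′ (r+i ℕ.+ suc i ℕ.* c) m))
          ≡⟨ trans (+-identityˡ _) (∑<-*ˡ b _ _) ⟩
        t (suc i ℕ.+ 0) ⊠ ∑< b (λ c → γ (suc i) c ⊠ coeff n b i′ (r+i ℕ.+ suc i ℕ.* c) m)
          ≡⟨ cong (t (suc i ℕ.+ 0) ⊠_) (trans (sym (+-identityʳ _)) (cong₂ _⊞_ refl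
               (trans (sym (zeroʳ _)) (cong (γ (suc i) b ⊠_) (sym (coeff-vanish n b i′ large)))))) ⟩
        t (suc i ℕ.+ 0) ⊠ (∑< b (λ c → γ (suc i) c ⊠ coeff n b i′ (r+i ℕ.+ suc i ℕ.* c) m)
                            ⊞ γ (suc i) b ⊠ coeff n b i′ (r+i ℕ.+ suc i ℕ.* b) m)
          ≡⟨ cong (t (suc i ℕ.+ 0) ⊠_) (sym (trans (coeff-suc n b (suc i) r+i m) (∑<-last b _))) ⟩
        t (suc i ℕ.+ 0) ⊠ coeff (suc n) b (suc i) r+i m ∎
        where
        shift : ∀ c → r ℕ.+ suc i ℕ.* suc c ≡ r+i ℕ.+ suc i ℕ.* c
        shift c = lemma r (suc i) c
          where
          lemma : ∀ r i c → r ℕ.+ i ℕ.* suc c ≡ r ℕ.+ (i ℕ.+ 0) ℕ.+ i ℕ.* c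
          lemma = ℕSolver.solve-∀
        large : m ℕ.< r+i ℕ.+ suc i ℕ.* b
        large = ℕ.+-mono-≤ {1} {r+i} {m}
          (ℕ.≤-trans (s≤s z≤n) (ℕ.m≤n+m (suc i ℕ.+ 0) r)) (ℕ.≤-trans m≤b (ℕ.m≤m+n b _))

      tail : ∑< (suc b) (λ c → γ (suc i) c ⊠ wcoeff n b i′ (r ℕ.+ suc i ℕ.* c) m)
             ≡ ∑< n (λ j → t (suc i ℕ.+ suc j) ⊠ coeff (suc n) b (suc i) (r ℕ.+ (suc i ℕ.+ suc j)) m)
      tail = begin
        ∑< (suc b) (λ c → γ (suc i) c ⊠ wcoeff n b i′ (r ℕ.+ suc i ℕ.* c) m)
          ≡⟨ ∑<-cong (suc b) (λ c → trans (cong (γ (suc i) c ⊠_) (wcoeff≡ n b (suc i) _ m≤b)) (sym (∑<-*ˡ n _ _))) ⟩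
        ∑< (suc b) (λ c → ∑< n (λ j → γ (suc i) c ⊠
          (t (i′ ℕ.+ j) ⊠ coeff n b i′ (r ℕ.+ suc i ℕ.* c ℕ.+ (i′ ℕ.+ j)) m)))
          ≡⟨ ∑<-swap (suc b) n _ ⟩
        ∑< n (λ j → ∑< (suc b) (λ c → γ (suc i) c ⊠
          (t (i′ ℕ.+ j) ⊠ coeff n b i′ (r ℕ.+ suc i ℕ.* c ℕ.+ (i′ ℕ.+ j)) m)))
          ≡⟨ ∑<-cong n (λ j → begin
               ∑< (suc b) (λ c → γ (suc i) c ⊠ (t (i′ ℕ.+ j) ⊠ coeff n b i′ (r ℕ.+ suc i ℕ.* c ℕ.+ (i′ ℕ.+ j)) m))
                 ≡⟨ ∑<-cong (suc b) (λ c → trans (*-exchange _ _ _) (cong₂ (λ x y → t x ⊠ (γ (suc i) c ⊠ coeff n b i′ y m))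
                      (sym (ℕ.+-suc (suc i) j)) (shift r (suc i) c j))) ⟩
               ∑< (suc b) (λ c → t (suc i ℕ.+ suc j) ⊠ (γ (suc i) c ⊠ coeff n b i′ (r ℕ.+ (suc i ℕ.+ suc j) ℕ.+ suc i ℕ.* c) m))
                 ≡⟨ ∑<-*ˡ (suc b) _ _ ⟩
               t (suc i ℕ.+ suc j) ⊠ ∑< (suc b)
                    (λ c → γ (suc i) c ⊠ coeff n b i′ (r ℕ.+ (suc i ℕ.+ suc j) ℕ.+ suc i ℕ.* c) m)
                 ≡⟨ cong (t (suc i ℕ.+ suc j) ⊠_) (coeff-suc n b (suc i) _ m) ⟨
               t (suc i ℕ.+ suc j) ⊠ coeff (suc n) b (suc i) (r ℕ.+ (suc i ℕ.+ suc j)) m ∎) ⟩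
        ∑< n (λ j → t (suc i ℕ.+ suc j) ⊠ coeff (suc n) b (suc i) (r ℕ.+ (suc i ℕ.+ suc j)) m) ∎
        where
        shift : ∀ r i c j → r ℕ.+ i ℕ.* c ℕ.+ (suc i ℕ.+ j) ≡ r ℕ.+ (i ℕ.+ suc j) ℕ.+ i ℕ.* c
        shift = ℕSolver.solve-∀

    module _ (K : ℕ) where

      -- For m ≤ K this is the coefficient of x^m in the product over j of the series Σ_c `γ j c`
      -- x^(jc): no entry or position beyond K can occur in weight m.
      α : ℕ → R
      α m = coeff K K 1 0 m

      -- The sum of t_{j+i} α_{m-1-i} over i < m, that is, a convolution of `α` with the sequence
      -- `t` started at j; the recursive form avoids subtracting indices.
      V : ℕ → ℕ → R
      V zero    j = 0#
      V (suc m) j = t j ⊠ α m ⊞ V m (suc j)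

      V≡∑ : ∀ m N j → m ℕ.≤ N → ∑< N (λ i → t (j ℕ.+ i) ⊠ coeff K K 1 (suc i) m) ≡ V m j
      V≡∑ zero    N       j m≤N = ∑<-zero N λ i →
        trans (cong (t (j ℕ.+ i) ⊠_) (coeff-vanish K K 1 {suc i} (s≤s z≤n))) (zeroʳ _)
      V≡∑ (suc m) (suc N) j (s≤s m≤N) = trans (∑<-first N _) (cong₂ _⊞_
        (cong₂ _⊠_ (cong t (ℕ.+-identityʳ j)) (coeff-shift K K 1 0 m))
        (trans (∑<-cong N λ i → cong₂ _⊠_ (cong t (ℕ.+-suc j i)) (coeff-shift K K 1 (suc i) m))
               (V≡∑ m N (suc j) m≤N)))

      -- Comparison of coefficients in x f′ = (Σ t_j x^j) f, where f is the generating function of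
      -- `α`; m ≤ K makes the truncation harmless.
      V≡α : ∀ m → m ℕ.≤ K → V m 1 ≡ nat m ⊠ α m
      V≡α m m≤K = begin
        V m 1                                              ≡⟨ V≡∑ m K 1 m≤K ⟨
        ∑< K (λ i → t (1 ℕ.+ i) ⊠ coeff K K 1 (suc i) m)   ≡⟨ wcoeff≡ K K 0 0 m≤K ⟨
        wcoeff K K 1 0 m
          ≡⟨ ∑-cong (vecsUpTo K K) (λ c → trans
               (⟦⟧-guard (weight 1 c ℕ.≟ m) (λ eq → cong (λ x → nat x ⊠ term 1 c) eq)) (*-exchange _ _ _)) ⟩
        ∑ (vecsUpTo K K) (λ c → nat m ⊠ (⟦ weight 1 c ℕ.≟ m ⟧ ⊠ term 1 c))
          ≡⟨ ∑-*ˡ (vecsUpTo K K) (nat m) _ ⟩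
        nat m ⊠ α m ∎

      module _ (τ : ℕ → ℕ → R) (τ-zero : ∀ j → τ 0 j ≡ 1#)
               (τ-suc : ∀ k j → τ (suc k) j ≡ ⊟ (t j ⊠ τ k 1) ⊞ ⊟ (nat k ⊠ τ k (suc j))) where

        private
          pull : ∀ s x y → ⊟ (x ⊠ (s ⊠ y)) ≡ ⊟ s ⊠ (x ⊠ y)
          pull s x y = trans (cong ⊟_ (*-exchange x s y)) (-‿distribˡ-* s _)

        -- Proved together with `τ≡α`: in the recursion for `τ`, the term with t_j needs the value
        -- at 1, which is `τ≡α` one level down, and the other term extends `V` by one summand. At j
        -- = 1, `V≡α` supplies the factor that completes the factorial.
        τ≡V : ∀ k j → suc k ℕ.≤ K → τ (suc k) j ≡ sgn (suc k) ⊠ (nat (k !) ⊠ V (suc k) j)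
        τ≡α : ∀ k → k ℕ.≤ K → τ k 1 ≡ sgn k ⊠ (nat (k !) ⊠ α k)

        τ≡V zero j 0<K = begin
          τ 1 j
            ≡⟨ τ-suc 0 j ⟩
          ⊟ (t j ⊠ τ 0 1) ⊞ ⊟ (0# ⊠ τ 0 (suc j))
            ≡⟨ cong₂ _⊞_ (cong (λ x → ⊟ (t j ⊠ x)) (trans (τ-zero 1) (sym (coeff-refl K K 0 0))))
                         (trans (cong ⊟_ (zeroˡ _)) -0#≈0#) ⟩
          ⊟ (t j ⊠ α 0) ⊞ 0#
            ≡⟨ +-identityʳ _ ⟩
          ⊟ (t j ⊠ α 0)
            ≡⟨ cong ⊟_ (+-identityʳ _) ⟨
          ⊟ V 1 j
            ≡⟨ cong ⊟_ (*-identityˡ _) ⟨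
          ⊟ (1# ⊠ V 1 j)
            ≡⟨ -‿distribˡ-* 1# _ ⟩
          ⊟ 1# ⊠ V 1 j
            ≡⟨ cong (⊟ 1# ⊠_) (trans (cong (_⊠ V 1 j) (+-identityʳ 1#)) (*-identityˡ _)) ⟨
          ⊟ 1# ⊠ ((1# ⊞ 0#) ⊠ V 1 j) ∎
        τ≡V (suc k) j k<K = begin
          τ (2 ℕ.+ k) j
            ≡⟨ τ-suc (suc k) j ⟩
          ⊟ (t j ⊠ τ (suc k) 1) ⊞ ⊟ (nat (suc k) ⊠ τ (suc k) (suc j))
            ≡⟨ cong₂ (λ x y → ⊟ (t j ⊠ x) ⊞ ⊟ (nat (suc k) ⊠ y)) (τ≡α (suc k) k≤K) (τ≡V k (suc j) k≤K) ⟩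
          ⊟ (t j ⊠ (s ⊠ (f ⊠ α (suc k)))) ⊞ ⊟ (nat (suc k) ⊠ (s ⊠ (nat (k !) ⊠ V (suc k) (suc j))))
            ≡⟨ cong₂ _⊞_ (pull s (t j) _) (pull s (nat (suc k)) _) ⟩
          ⊟ s ⊠ (t j ⊠ (f ⊠ α (suc k))) ⊞ ⊟ s ⊠ (nat (suc k) ⊠ (nat (k !) ⊠ V (suc k) (suc j)))
            ≡⟨ distribˡ (⊟ s) _ _ ⟨
          ⊟ s ⊠ (t j ⊠ (f ⊠ α (suc k)) ⊞ nat (suc k) ⊠ (nat (k !) ⊠ V (suc k) (suc j)))
            ≡⟨ cong (⊟ s ⊠_) (cong₂ _⊞_ (*-exchange (t j) f _)
                 (trans (sym (*-assoc _ _ _)) (cong (_⊠ V (suc k) (suc j)) (sym (nat-* (suc k) (k !)))))) ⟩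
          ⊟ s ⊠ (f ⊠ (t j ⊠ α (suc k)) ⊞ f ⊠ V (suc k) (suc j))
            ≡⟨ cong (⊟ s ⊠_) (distribˡ f _ _) ⟨
          ⊟ s ⊠ (f ⊠ V (2 ℕ.+ k) j) ∎
          where
          s = sgn (suc k)
          f = nat (suc k !)
          k≤K : suc k ℕ.≤ K
          k≤K = ℕ.<⇒≤ k<K

        τ≡α zero    _   = begin
          τ 0 1                      ≡⟨ τ-zero 1 ⟩
          1#                         ≡⟨ coeff-refl K K 0 0 ⟨
          α 0                        ≡⟨ trans (cong (_⊠ α 0) (+-identityʳ 1#)) (*-identityˡ _) ⟨
          (1# ⊞ 0#) ⊠ α 0            ≡⟨ *-identityˡ _ ⟨
          1# ⊠ ((1# ⊞ 0#) ⊠ α 0)     ∎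
        τ≡α (suc k) k<K = begin
          τ (suc k) 1                                              ≡⟨ τ≡V k 1 k<K ⟩
          sgn (suc k) ⊠ (nat (k !) ⊠ V (suc k) 1)                  ≡⟨ cong
               (λ x → sgn (suc k) ⊠ (nat (k !) ⊠ x)) (V≡α (suc k) k<K) ⟩
          sgn (suc k) ⊠ (nat (k !) ⊠ (nat (suc k) ⊠ α (suc k)))
            ≡⟨ cong (sgn (suc k) ⊠_) (trans (*-exchange _ _ _)
                 (trans (sym (*-assoc _ _ _)) (cong (_⊠ α (suc k)) (sym (nat-* (suc k) (k !)))))) ⟩
          sgn (suc k) ⊠ (nat (suc k !) ⊠ α (suc k))                ∎

-- Sums over a complete enumeration without repetitions.

module Enumeration {X : Set} (_≟_ : DecidableEquality X) (xs : List X)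
                   (complete : ∀ x → x ∈ xs) (unique : Unique xs)
                   {R : Set} {_+_ _*_ : Op₂ R} { -_ : Op₁ R} {0# 1# : R}
                   (isCR : IsCommutativeRing _≡_ _+_ _*_ -_ 0# 1#) where

  open IsCommutativeRing isCR using (+-identityˡ; +-identityʳ; *-identityˡ; zeroˡ)
  open Sums isCR
  open ≡-Reasoning

  private
    ∑-⟦≟⟧-∉ : ∀ ys a (f : X → R) → All (a ≢_) ys → ∑ ys (λ x → ⟦ x ≟ a ⟧ * f x) ≡ 0#
    ∑-⟦≟⟧-∉ []       a f []          = refl
    ∑-⟦≟⟧-∉ (y ∷ ys) a f (a≢y ∷ a∉) = trans
      (cong₂ _+_ (trans (cong₂ _*_ (⟦⟧-no (y ≟ a) (a≢y ∘ sym)) refl) (zeroˡ _)) (∑-⟦≟⟧-∉ ys a f a∉))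
      (+-identityˡ 0#)

    ∑-⟦≟⟧-∈ : ∀ {ys a} (f : X → R) → Unique ys → a ∈ ys → ∑ ys (λ x → ⟦ x ≟ a ⟧ * f x) ≡ f a
    ∑-⟦≟⟧-∈ {y ∷ ys} f (y∉ ∷ _) (here refl) = trans
      (cong₂ _+_ (trans (cong₂ _*_ (⟦⟧-yes (y ≟ y) refl) refl) (*-identityˡ _)) (∑-⟦≟⟧-∉ ys y f y∉))
      (+-identityʳ _)
    ∑-⟦≟⟧-∈ {y ∷ ys} {a} f (y∉ ∷ u) (there a∈) = trans
      (cong₂ _+_ (trans (cong₂ _*_ (⟦⟧-no (y ≟ a) (All.lookup y∉ a∈)) refl) (zeroˡ _)) (∑-⟦≟⟧-∈ f u a∈))
      (+-identityˡ _)

  ∑-⟦≟⟧ : ∀ a (f : X → R) → ∑ xs (λ x → ⟦ x ≟ a ⟧ * f x) ≡ f a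
  ∑-⟦≟⟧ a f = ∑-⟦≟⟧-∈ f unique (complete a)

  -- Each summand is spread over all y by the bracket [y = π x] and the two sums are exchanged. With
  -- squaring for π, the fibre sizes are the numbers of square roots.
  ∑-fibres : ∀ (π : X → X) (f : X → R) → ∑ xs (f ∘ π) ≡ ∑ xs (λ y → ∑ xs (λ x → ⟦ π x ≟ y ⟧) * f y)
  ∑-fibres π f = begin
    ∑ xs (f ∘ π)
      ≡⟨ ∑-cong xs (λ x → ∑-⟦≟⟧ (π x) f) ⟨
    ∑ xs (λ x → ∑ xs (λ y → ⟦ y ≟ π x ⟧ * f y))
      ≡⟨ ∑-swap xs xs _ ⟩
    ∑ xs (λ y → ∑ xs (λ x → ⟦ y ≟ π x ⟧ * f y))
      ≡⟨ ∑-cong xs (λ y → trans (∑-*ʳ xs (f y) _)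
           (cong₂ _*_ (∑-cong xs (λ x → ⟦⟧-cong (y ≟ π x) (π x ≟ y) sym sym)) refl)) ⟩
    ∑ xs (λ y → ∑ xs (λ x → ⟦ π x ≟ y ⟧) * f y) ∎

  ∑-reindex : ∀ (π ρ : X → X) → (∀ x → ρ (π x) ≡ x) → (∀ x → π (ρ x) ≡ x) →
              ∀ (f : X → R) → ∑ xs (f ∘ π) ≡ ∑ xs f
  ∑-reindex π ρ ρπ πρ f = trans (∑-fibres π f) (∑-cong xs (λ y →
    trans (cong₂ _*_ (trans (∑-cong xs (λ x → trans
        (⟦⟧-cong (π x ≟ y) (x ≟ ρ y) (λ eq → trans (sym (ρπ x)) (cong ρ eq)) (λ eq → trans (cong π eq) (πρ y)))
        (sym (trans (IsCommutativeRing.*-comm isCR _ _) (*-identityˡ _)))))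
      (∑-⟦≟⟧ (ρ y) (λ _ → 1#))) refl) (*-identityˡ _)))

-- Positivity and parity of integer sums.

module _ {X : Set} where
  open Sums ℤ.+-*-isCommutativeRing
  open import Data.Integer.Base using (_+_; _*_; 0ℤ)
  open ≡-Reasoning

  ∑-nonneg : ∀ (xs : List X) (h : X → ℕ) → ∑ xs (λ x → + h x) ≡ 0ℤ → ∀ {x} → x ∈ xs → h x ≡ 0
  ∑-nonneg xs h eq x∈ = go xs (ℤ.+-injective (trans (sym (cast xs)) eq)) x∈
    where
    total : List X → ℕ
    total []       = 0
    total (x ∷ xs) = h x ℕ.+ total xs
    cast : ∀ xs → ∑ xs (λ x → + h x) ≡ + total xs
    cast []       = refl
    cast (x ∷ xs) = cong (λ n → + h x + n) (cast xs)
    go : ∀ xs → total xs ≡ 0 → ∀ {x} → x ∈ xs → h x ≡ 0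
    go (x ∷ xs) eq (here refl) = ℕ.m+n≡0⇒m≡0 (h x) eq
    go (x ∷ xs) eq (there x∈)  = go xs (ℕ.m+n≡0⇒n≡0 (h x) eq) x∈

  -- The entries off the diagonal come in equal pairs, so modulo 2 only the diagonal counts.
  ∑-symmetric : ∀ (xs : List X) (g : X → X → ℤ) → (∀ x y → g x y ≡ g y x) →
    ∃ λ e → ∑ xs (λ x → ∑ xs (g x)) ≡ ∑ xs (λ x → g x x) + + 2 * e
  ∑-symmetric []       g g-sym = 0ℤ , refl
  ∑-symmetric (x ∷ xs) g g-sym with ∑-symmetric xs g g-sym
  ... | e , eq = ∑ xs (g x) + e , (begin
    g x x + ∑ xs (g x) + ∑ xs (λ y → g y x + ∑ xs (g y))
      ≡⟨ cong (λ n → g x x + ∑ xs (g x) + n) (trans (∑-+ xs (λ y → g y x) (λ y → ∑ xs (g y)))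
           (cong₂ _+_ (∑-cong xs (λ y → g-sym y x)) eq)) ⟩
    g x x + ∑ xs (g x) + (∑ xs (g x) + (∑ xs (λ y → g y y) + + 2 * e))
      ≡⟨ regroup (g x x) (∑ xs (g x)) (∑ xs (λ y → g y y)) e ⟩
    g x x + ∑ xs (λ y → g y y) + + 2 * (∑ xs (g x) + e) ∎)
    where
    regroup : ∀ a b c e → a + b + (b + (c + + 2 * e)) ≡ a + c + + 2 * (b + e)
    regroup = ℤSolver.solve-∀

module Involution {X : Set} (_≟_ : DecidableEquality X) (xs : List X)
                  (complete : ∀ x → x ∈ xs) (unique : Unique xs) where
  open Sums ℤ.+-*-isCommutativeRing
  open Enumeration _≟_ xs complete unique ℤ.+-*-isCommutativeRing
  open import Data.Integer.Base using (_+_; _*_)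

  -- The matrix with entries [y = π x] f(x) is symmetric, because π is an involution that preserves
  -- f. Its row sums are the f(x), and its diagonal lives on the fixed points.
  ∑-fixedPoints : ∀ (π : X → X) → (∀ x → π (π x) ≡ x) → ∀ (f : X → ℤ) → (∀ x → f (π x) ≡ f x) →
    ∃ λ e → ∑ xs f ≡ ∑ xs (λ x → ⟦ x ≟ π x ⟧ * f x) + + 2 * e
  ∑-fixedPoints π ππ f fπ with ∑-symmetric xs (λ x y → ⟦ y ≟ π x ⟧ * f x) g-sym
    where
    g-sym : ∀ x y → ⟦ y ≟ π x ⟧ * f x ≡ ⟦ x ≟ π y ⟧ * f y
    g-sym x y = trans (⟦⟧-guard (y ≟ π x) (λ eq → trans (sym (fπ x)) (cong f (sym eq))))
      (cong (_* f y) (⟦⟧-cong (y ≟ π x) (x ≟ π y)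
        (λ eq → trans (sym (ππ x)) (cong π (sym eq))) (λ eq → trans (sym (ππ y)) (cong π (sym eq)))))
  ... | e , eq = e , trans (∑-cong xs (λ x → sym (∑-⟦≟⟧ (π x) (λ _ → f x)))) eq

-- Elementary arithmetic in a field.

module FieldArithmetic (F : FiniteField) where
  open FiniteField F renaming (_+_ to _+ᶠ_; _*_ to _*ᶠ_; -_ to infix 8 -ᶠ_; _≟_ to infix 4 _≟_)

  𝔽 : CommutativeRing 0ℓ 0ℓ
  𝔽 = record { isCommutativeRing = isCommutativeRing }

  module 𝔽 = CommutativeRing 𝔽
  open import Algebra.Properties.Ring 𝔽.ring
    using (-‿distribˡ-*; -‿distribʳ-*; -‿involutive; -‿+-comm)
  open import Algebra.Properties.Group 𝔽.+-group using (x≈y⇒x∙y⁻¹≈ε; x∙y⁻¹≈ε⇒x≈y)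
  open ≡-Reasoning

  infixl 6 _-ᶠ_
  _-ᶠ_ : Carrier → Carrier → Carrier
  x -ᶠ y = x +ᶠ (-ᶠ y)

  -- With 0⁻¹ = 0, inversion is an involution of the whole carrier and can be used as a substitution
  -- in sums over all elements.
  _⁻¹ : Carrier → Carrier
  x ⁻¹ with x ≟ 0#
  ... | yes _  = 0#
  ... | no x≢0 = proj₁ (inverse x x≢0)

  ⁻¹-inverse : ∀ {x} → x ≢ 0# → x *ᶠ x ⁻¹ ≡ 1#
  ⁻¹-inverse {x} x≢0 with x ≟ 0#
  ... | yes x≡0 = contradiction x≡0 x≢0
  ... | no x≢0′ = proj₂ (inverse x x≢0′)

  0⁻¹ : 0# ⁻¹ ≡ 0#
  0⁻¹ with 0# ≟ 0#
  ... | yes _  = refl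
  ... | no 0≢0 = contradiction refl 0≢0

  x⁻¹[xy] : ∀ {x} y → x ≢ 0# → x ⁻¹ *ᶠ (x *ᶠ y) ≡ y
  x⁻¹[xy] {x} y x≢0 = begin
    x ⁻¹ *ᶠ (x *ᶠ y)  ≡⟨ 𝔽.*-assoc _ _ _ ⟨
    x ⁻¹ *ᶠ x *ᶠ y    ≡⟨ cong (_*ᶠ y) (trans (𝔽.*-comm _ _) (⁻¹-inverse x≢0)) ⟩
    1# *ᶠ y           ≡⟨ 𝔽.*-identityˡ y ⟩
    y                 ∎

  x[x⁻¹y] : ∀ {x} y → x ≢ 0# → x *ᶠ (x ⁻¹ *ᶠ y) ≡ y
  x[x⁻¹y] {x} y x≢0 = begin
    x *ᶠ (x ⁻¹ *ᶠ y)  ≡⟨ 𝔽.*-assoc _ _ _ ⟨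
    x *ᶠ x ⁻¹ *ᶠ y    ≡⟨ cong (_*ᶠ y) (⁻¹-inverse x≢0) ⟩
    1# *ᶠ y           ≡⟨ 𝔽.*-identityˡ y ⟩
    y                 ∎

  xy≡0⇒y≡0 : ∀ {x y} → x ≢ 0# → x *ᶠ y ≡ 0# → y ≡ 0#
  xy≡0⇒y≡0 {x} {y} x≢0 eq = begin
    y                 ≡⟨ x⁻¹[xy] y x≢0 ⟨
    x ⁻¹ *ᶠ (x *ᶠ y)  ≡⟨ cong (x ⁻¹ *ᶠ_) eq ⟩
    x ⁻¹ *ᶠ 0#        ≡⟨ 𝔽.zeroʳ _ ⟩
    0#                ∎

  xy≢0 : ∀ {x y} → x ≢ 0# → y ≢ 0# → x *ᶠ y ≢ 0#
  xy≢0 x≢0 y≢0 eq = y≢0 (xy≡0⇒y≡0 x≢0 eq)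

  ⁻¹≢0 : ∀ {x} → x ≢ 0# → x ⁻¹ ≢ 0#
  ⁻¹≢0 {x} x≢0 eq = 0≢1 (trans (trans (sym (𝔽.zeroʳ x)) (cong (x *ᶠ_) (sym eq))) (⁻¹-inverse x≢0))

  ⁻¹-unique : ∀ {x y} → x *ᶠ y ≡ 1# → x ⁻¹ ≡ y
  ⁻¹-unique {x} {y} eq = begin
    x ⁻¹              ≡⟨ 𝔽.*-identityʳ _ ⟨
    x ⁻¹ *ᶠ 1#        ≡⟨ cong (x ⁻¹ *ᶠ_) eq ⟨
    x ⁻¹ *ᶠ (x *ᶠ y)  ≡⟨ x⁻¹[xy] y (λ x≡0 → 0≢1 (trans (sym (𝔽.zeroˡ y)) (trans (cong (_*ᶠ y) (sym x≡0)) eq))) ⟩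
    y                 ∎

  ⁻¹-involutive : ∀ x → (x ⁻¹) ⁻¹ ≡ x
  ⁻¹-involutive x with x ≟ 0#
  ... | yes x≡0 = trans 0⁻¹ (sym x≡0)
  ... | no x≢0  = ⁻¹-unique (trans (𝔽.*-comm _ _) (proj₂ (inverse x x≢0)))

  square≡0 : ∀ {x} → x *ᶠ x ≡ 0# → x ≡ 0#
  square≡0 {x} eq with x ≟ 0#
  ... | yes x≡0 = x≡0
  ... | no x≢0  = xy≡0⇒y≡0 x≢0 eq

  square-* : ∀ x y → (x *ᶠ y) *ᶠ (x *ᶠ y) ≡ (x *ᶠ x) *ᶠ (y *ᶠ y)
  square-* x y = begin
    (x *ᶠ y) *ᶠ (x *ᶠ y)  ≡⟨ 𝔽.*-assoc _ _ _ ⟩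
    x *ᶠ (y *ᶠ (x *ᶠ y))  ≡⟨ cong (x *ᶠ_) (trans (sym (𝔽.*-assoc _ _ _)) (trans
         (cong (_*ᶠ y) (𝔽.*-comm y x)) (𝔽.*-assoc _ _ _))) ⟩
    x *ᶠ (x *ᶠ (y *ᶠ y))  ≡⟨ 𝔽.*-assoc _ _ _ ⟨
    (x *ᶠ x) *ᶠ (y *ᶠ y)  ∎

  square-neg : ∀ x → (-ᶠ x) *ᶠ (-ᶠ x) ≡ x *ᶠ x
  square-neg x = begin
    (-ᶠ x) *ᶠ (-ᶠ x)  ≡⟨ -‿distribˡ-* x _ ⟨
    -ᶠ (x *ᶠ (-ᶠ x))  ≡⟨ cong -ᶠ_ (-‿distribʳ-* x x) ⟨
    -ᶠ (-ᶠ (x *ᶠ x))  ≡⟨ -‿involutive _ ⟩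
    x *ᶠ x            ∎

  x+y≡0⇒x≡-y : ∀ {x y} → x +ᶠ y ≡ 0# → x ≡ -ᶠ y
  x+y≡0⇒x≡-y {x} {y} eq = x∙y⁻¹≈ε⇒x≈y x (-ᶠ y) (trans (cong (x +ᶠ_) (-‿involutive y)) eq)

  -- The product (x - y)(x + y) = x² - y² is zero, and a field has no zero divisors.
  square-roots : ∀ {x y} → x *ᶠ x ≡ y *ᶠ y → x ≡ y ⊎ x ≡ -ᶠ y
  square-roots {x} {y} eq with x -ᶠ y ≟ 0#
  ... | yes x-y≡0 = inj₁ (x∙y⁻¹≈ε⇒x≈y x y x-y≡0)
  ... | no x-y≢0  = inj₂ (x+y≡0⇒x≡-y (xy≡0⇒y≡0 x-y≢0 (begin
    (x -ᶠ y) *ᶠ (x +ᶠ y)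
      ≡⟨ 𝔽.distribʳ _ x (-ᶠ y) ⟩
    x *ᶠ (x +ᶠ y) +ᶠ (-ᶠ y) *ᶠ (x +ᶠ y)
      ≡⟨ cong₂ _+ᶠ_ (𝔽.distribˡ x x y) (trans (sym (-‿distribˡ-* y _)) (cong -ᶠ_ (trans (𝔽.distribˡ y x y)
           (cong₂ _+ᶠ_ (𝔽.*-comm y x) (sym eq))))) ⟩
    (x *ᶠ x +ᶠ x *ᶠ y) +ᶠ (-ᶠ (x *ᶠ y +ᶠ x *ᶠ x))
      ≡⟨ cong (λ z → (x *ᶠ x +ᶠ x *ᶠ y) +ᶠ (-ᶠ z)) (𝔽.+-comm _ _) ⟩
    (x *ᶠ x +ᶠ x *ᶠ y) +ᶠ (-ᶠ (x *ᶠ x +ᶠ x *ᶠ y))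
      ≡⟨ 𝔽.-‿inverseʳ _ ⟩
    0# ∎)))

  [x-y]+y : ∀ x y → (x -ᶠ y) +ᶠ y ≡ x
  [x-y]+y x y = trans (𝔽.+-assoc _ _ _) (trans (cong (x +ᶠ_) (𝔽.-‿inverseˡ y)) (𝔽.+-identityʳ x))

  [x+y]-y : ∀ x y → (x +ᶠ y) -ᶠ y ≡ x
  [x+y]-y x y = trans (𝔽.+-assoc _ _ _) (trans (cong (x +ᶠ_) (𝔽.-‿inverseʳ y)) (𝔽.+-identityʳ x))

  x-[x-y] : ∀ x y → x -ᶠ (x -ᶠ y) ≡ y
  x-[x-y] x y = begin
    x +ᶠ (-ᶠ (x -ᶠ y))          ≡⟨ cong (x +ᶠ_) (-‿+-comm x (-ᶠ y)) ⟨
    x +ᶠ ((-ᶠ x) -ᶠ (-ᶠ y))     ≡⟨ 𝔽.+-assoc _ _ _ ⟨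
    (x -ᶠ x) -ᶠ (-ᶠ y)          ≡⟨ cong₂ _+ᶠ_ (𝔽.-‿inverseʳ x) (-‿involutive y) ⟩
    0# +ᶠ y                     ≡⟨ 𝔽.+-identityˡ y ⟩
    y                           ∎

  x-y-z : ∀ x y z → x -ᶠ y -ᶠ z ≡ x -ᶠ (y +ᶠ z)
  x-y-z x y z = trans (𝔽.+-assoc _ _ _) (cong (x +ᶠ_) (-‿+-comm y z))

  x-y≡0⇒x≡y : ∀ {x y} → x -ᶠ y ≡ 0# → x ≡ y
  x-y≡0⇒x≡y {x} {y} = x∙y⁻¹≈ε⇒x≈y x y

  x≡y⇒x-y≡0 : ∀ {x y} → x ≡ y → x -ᶠ y ≡ 0#
  x≡y⇒x-y≡0 {x} {y} = x≈y⇒x∙y⁻¹≈ε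

-- The quadratic character and its character sums.

module QuadraticCharacter (F : FiniteField) (2≢0 : FiniteField.fromℕ F 2 ≢ FiniteField.0# F) where
  open FiniteField F renaming (_+_ to _+ᶠ_; _*_ to _*ᶠ_; -_ to infix 8 -ᶠ_; _≟_ to infix 4 _≟_)
  open FieldArithmetic F
  open import Algebra.Properties.Ring 𝔽.ring
    using (-‿distribʳ-*; -‿involutive; -0#≈0#; -1*x≈-x)
  open Sums ℤ.+-*-isCommutativeRing
  open Enumeration _≟_ elems elems-complete elems-unique ℤ.+-*-isCommutativeRing
  open Involution _≟_ elems elems-complete elems-unique
  open import Data.Integer.Base using (_+_; _*_; -_; _-_; 0ℤ; 1ℤ; -1ℤ)
  open ≡-Reasoning

  q : ℤ
  q = + size

  δ₀ : Carrier → ℤ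
  δ₀ x = ⟦ x ≟ 0# ⟧

  roots : Carrier → ℤ
  roots x = ∑ elems (λ y → ⟦ y *ᶠ y ≟ x ⟧)

  -- Counting square roots instead of distinguishing cases makes χ(0) = 0 and the vanishing of Σ χ
  -- consequences of counting.
  χ : Carrier → ℤ
  χ x = roots x - 1ℤ

  IsSq : Carrier → Set
  IsSq x = ∃ λ y → y *ᶠ y ≡ x

  isSq? : ∀ x → Dec (IsSq x)
  isSq? x with any? (λ y → (y *ᶠ y) ≟ x) elems
  ... | yes a = yes (Any.satisfied a)
  ... | no ¬a = no λ (y , eq) → ¬a (Any.map (λ { refl → eq }) (elems-complete y))

  ∑-⟦≟⟧-1 : ∀ a → ∑ elems (λ y → ⟦ y ≟ a ⟧) ≡ 1ℤ
  ∑-⟦≟⟧-1 a = trans (∑-cong elems (λ y → sym (ℤ.*-identityʳ _))) (∑-⟦≟⟧ a (λ _ → 1ℤ))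

  χ-0 : χ 0# ≡ 0ℤ
  χ-0 = cong (_- 1ℤ) (trans (∑-cong elems (λ y → ⟦⟧-cong (y *ᶠ y ≟ 0#) (y ≟ 0#) square≡0
    (λ y≡0 → trans (cong (_*ᶠ y) y≡0) (𝔽.zeroˡ y)))) (∑-⟦≟⟧-1 0#))

  -- Odd characteristic enters here: it gives a nonzero square two distinct roots.
  x≢-x : ∀ {x} → x ≢ 0# → x ≢ -ᶠ x
  x≢-x {x} x≢0 x≡-x = x≢0 (xy≡0⇒y≡0 2≢0 (begin
    fromℕ 2 *ᶠ x          ≡⟨ cong (λ z → (1# +ᶠ z) *ᶠ x) (𝔽.+-identityʳ 1#) ⟩
    (1# +ᶠ 1#) *ᶠ x       ≡⟨ 𝔽.distribʳ x 1# 1# ⟩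
    1# *ᶠ x +ᶠ 1# *ᶠ x    ≡⟨ cong₂ _+ᶠ_ (𝔽.*-identityˡ x) (trans (𝔽.*-identityˡ x) x≡-x) ⟩
    x -ᶠ x                ≡⟨ 𝔽.-‿inverseʳ x ⟩
    0#                    ∎))

  χ-square : ∀ {x} → x ≢ 0# → IsSq x → χ x ≡ 1ℤ
  χ-square {x} x≢0 (t , refl) = cong (_- 1ℤ) (begin
    roots (t *ᶠ t)
      ≡⟨ ∑-cong elems two ⟩
    ∑ elems (λ y → ⟦ y ≟ t ⟧ + ⟦ y ≟ -ᶠ t ⟧)
      ≡⟨ ∑-+ elems _ _ ⟩
    ∑ elems (λ y → ⟦ y ≟ t ⟧) + ∑ elems (λ y → ⟦ y ≟ -ᶠ t ⟧)
      ≡⟨ cong₂ _+_ (∑-⟦≟⟧-1 t) (∑-⟦≟⟧-1 (-ᶠ t)) ⟩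
    + 2 ∎)
    where
    t≢0 : t ≢ 0#
    t≢0 t≡0 = x≢0 (trans (cong (_*ᶠ t) t≡0) (𝔽.zeroˡ t))
    two : ∀ y → ⟦ y *ᶠ y ≟ t *ᶠ t ⟧ ≡ ⟦ y ≟ t ⟧ + ⟦ y ≟ -ᶠ t ⟧
    two y with y ≟ t
    ... | yes refl = trans (⟦⟧-yes (y *ᶠ y ≟ y *ᶠ y) refl) (cong (λ z → 1ℤ + z) (sym (⟦⟧-no (y ≟ -ᶠ y) (x≢-x t≢0))))
    ... | no y≢t = trans (⟦⟧-cong (y *ᶠ y ≟ t *ᶠ t) (y ≟ -ᶠ t) to λ { refl → square-neg t }) (sym (ℤ.+-identityˡ _))
      where
      to : y *ᶠ y ≡ t *ᶠ t → y ≡ -ᶠ t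
      to eq with square-roots eq
      ... | inj₁ y≡t  = contradiction y≡t y≢t
      ... | inj₂ y≡-t = y≡-t

  χ-nonsquare : ∀ {x} → ¬ IsSq x → χ x ≡ -1ℤ
  χ-nonsquare {x} ¬sq = cong (_- 1ℤ) (∑-zero elems (λ y → ⟦⟧-no (y *ᶠ y ≟ x) (λ eq → ¬sq (y , eq))))

  data Class (x : Carrier) : Set where
    isZero      : x ≡ 0# → Class x
    isSquare≢0  : x ≢ 0# → IsSq x → Class x
    isNonsquare : ¬ IsSq x → Class x

  classify : ∀ x → Class x
  classify x with x ≟ 0# | isSq? x
  ... | yes x≡0 | _      = isZero x≡0
  ... | no x≢0  | yes sq = isSquare≢0 x≢0 sq
  ... | no x≢0  | no ¬sq = isNonsquare ¬sq

  IsSq-0 : IsSq 0#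
  IsSq-0 = 0# , 𝔽.zeroˡ 0#

  IsSq-1 : IsSq 1#
  IsSq-1 = 1# , 𝔽.*-identityˡ 1#

  nonsquare≢0 : ∀ {x} → ¬ IsSq x → x ≢ 0#
  nonsquare≢0 ¬sq refl = ¬sq IsSq-0

  IsSq-* : ∀ {x y} → IsSq x → IsSq y → IsSq (x *ᶠ y)
  IsSq-* (s , refl) (t , refl) = s *ᶠ t , square-* s t

  IsSq-⁻¹ : ∀ {x} → IsSq x → IsSq (x ⁻¹)
  IsSq-⁻¹ {x} (t , refl) = helper (x ≟ 0#)
    where
    helper : Dec (x ≡ 0#) → IsSq (x ⁻¹)
    helper (yes x≡0) = subst IsSq (sym (trans (cong _⁻¹ x≡0) 0⁻¹)) IsSq-0
    helper (no x≢0)  = t ⁻¹ , sym (⁻¹-unique (begin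
      (t *ᶠ t) *ᶠ (t ⁻¹ *ᶠ t ⁻¹)  ≡⟨ square-* t (t ⁻¹) ⟨
      (t *ᶠ t ⁻¹) *ᶠ (t *ᶠ t ⁻¹)  ≡⟨ cong₂ _*ᶠ_ tt⁻¹ tt⁻¹ ⟩
      1# *ᶠ 1#                    ≡⟨ 𝔽.*-identityˡ 1# ⟩
      1#                          ∎))
      where
      tt⁻¹ : t *ᶠ t ⁻¹ ≡ 1#
      tt⁻¹ = ⁻¹-inverse λ t≡0 → x≢0 (trans (cong (_*ᶠ t) t≡0) (𝔽.zeroˡ t))

  IsSq-cancelˡ : ∀ {x y} → x ≢ 0# → IsSq x → IsSq (x *ᶠ y) → IsSq y
  IsSq-cancelˡ {x} {y} x≢0 sx sxy = subst IsSq (x⁻¹[xy] y x≢0) (IsSq-* (IsSq-⁻¹ sx) sxy)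

  IsSq-cancelʳ : ∀ {x y} → y ≢ 0# → IsSq y → IsSq (x *ᶠ y) → IsSq x
  IsSq-cancelʳ y≢0 sy sxy = IsSq-cancelˡ y≢0 sy (subst IsSq (𝔽.*-comm _ _) sxy)

  ∑-1 : ∑ elems (λ _ → 1ℤ) ≡ q
  ∑-1 = trans (∑-one elems) (nat≡+ size)
    where
    nat≡+ : ∀ n → nat n ≡ + n
    nat≡+ zero    = refl
    nat≡+ (suc n) = cong (λ z → 1ℤ + z) (nat≡+ n)

  -- Every y is a square root of exactly one element, so the root counts add up to q.
  ∑-χ : ∑ elems χ ≡ 0ℤ
  ∑-χ = begin
    ∑ elems (λ x → roots x - 1ℤ)                   ≡⟨ ∑-+ elems roots (λ _ → -1ℤ) ⟩
    ∑ elems roots + ∑ elems (λ _ → -1ℤ * 1ℤ)       ≡⟨ cong₂ _+_ (∑-cong elems (λ x → sym (ℤ.*-identityʳ _)))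
         (∑-*ˡ elems -1ℤ (λ _ → 1ℤ)) ⟩
    ∑ elems (λ x → roots x * 1ℤ) + -1ℤ * ∑ elems (λ _ → 1ℤ)
      ≡⟨ cong (_+ -1ℤ * ∑ elems (λ _ → 1ℤ)) (∑-fibres (λ y → y *ᶠ y) (λ _ → 1ℤ)) ⟨
    ∑ elems (λ _ → 1ℤ) + -1ℤ * ∑ elems (λ _ → 1ℤ)  ≡⟨ cancel (∑ elems (λ _ → 1ℤ)) ⟩
    0ℤ                                             ∎
    where
    cancel : ∀ a → a + -1ℤ * a ≡ 0ℤ
    cancel = ℤSolver.solve-∀

  ∑-scale : ∀ {a} → a ≢ 0# → ∀ (f : Carrier → ℤ) → ∑ elems (λ x → f (a *ᶠ x)) ≡ ∑ elems f
  ∑-scale {a} a≢0 = ∑-reindex (a *ᶠ_) (a ⁻¹ *ᶠ_) (λ x → x⁻¹[xy] x a≢0) (λ x → x[x⁻¹y] x a≢0)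

  ∑-reflect : ∀ c (f : Carrier → ℤ) → ∑ elems (λ x → f (c -ᶠ x)) ≡ ∑ elems f
  ∑-reflect c = ∑-reindex (λ x → c -ᶠ x) (λ x → c -ᶠ x) (x-[x-y] c) (x-[x-y] c)

  ∑-translate : ∀ c (f : Carrier → ℤ) → ∑ elems (λ x → f (x -ᶠ c)) ≡ ∑ elems f
  ∑-translate c = ∑-reindex (_-ᶠ c) (_+ᶠ c) (λ x → [x-y]+y x c) (λ x → [x+y]-y x c)

  -- For a nonsquare n the values -χ(x) - χ(nx) are nonnegative and sum to zero.
  χ-*-nonsquare : ∀ {n} → ¬ IsSq n → ∀ x → - χ x - χ (n *ᶠ x) ≡ 0ℤ
  χ-*-nonsquare {n} ¬sq x = trans (proj₂ (nonneg x))
    (cong +_ (∑-nonneg elems (proj₁ ∘ nonneg) (trans (∑-cong elems (sym ∘ proj₂ ∘ nonneg)) sum≡0) (elems-complete x)))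
    where
    n≢0 : n ≢ 0#
    n≢0 = nonsquare≢0 ¬sq
    sum≡0 : ∑ elems (λ x → - χ x - χ (n *ᶠ x)) ≡ 0ℤ
    sum≡0 = begin
      ∑ elems (λ x → - χ x - χ (n *ᶠ x))
        ≡⟨ ∑-cong elems (λ x → neg-+ (χ x) (χ (n *ᶠ x))) ⟩
      ∑ elems (λ x → -1ℤ * (χ x + χ (n *ᶠ x)))
        ≡⟨ trans (∑-*ˡ elems -1ℤ _) (cong (-1ℤ *_) (∑-+ elems χ (λ x → χ (n *ᶠ x)))) ⟩
      -1ℤ * (∑ elems χ + ∑ elems (λ x → χ (n *ᶠ x)))
        ≡⟨ cong (-1ℤ *_) (cong₂ _+_ ∑-χ (trans (∑-scale n≢0 χ) ∑-χ)) ⟩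
      0ℤ ∎
      where
      neg-+ : ∀ a b → - a - b ≡ -1ℤ * (a + b)
      neg-+ = ℤSolver.solve-∀
    nonneg : ∀ x → ∃ λ h → - χ x - χ (n *ᶠ x) ≡ + h
    nonneg x with classify x
    ... | isZero refl = 0 , cong₂ (λ a b → - a - b) χ-0 (trans (cong χ (𝔽.zeroʳ n)) χ-0)
    ... | isSquare≢0 x≢0 sx = 0 , cong₂ (λ a b → - a - b) (χ-square x≢0 sx)
            (χ-nonsquare (λ snx → ¬sq (IsSq-cancelʳ x≢0 sx snx)))
    ... | isNonsquare ¬sx with classify (n *ᶠ x)
    -- Only nonnegativity is claimed at this point. The values 1 and 2 never occur, but that need
    -- not be refuted case by case: the vanishing of the whole sum excludes them.
    ...   | isZero nx≡0         = 1 , cong₂ (λ a b → - a - b) (χ-nonsquare ¬sx) (trans (cong χ nx≡0) χ-0)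
    ...   | isSquare≢0 nx≢0 snx = 0 , cong₂ (λ a b → - a - b) (χ-nonsquare ¬sx) (χ-square nx≢0 snx)
    ...   | isNonsquare ¬snx    = 2 , cong₂ (λ a b → - a - b) (χ-nonsquare ¬sx) (χ-nonsquare ¬snx)

  -- The hard case, a product of two nonsquares, is contained in `χ-*-nonsquare`. Multiplication by
  -- a nonzero square preserves and reflects being a square.
  χ-* : ∀ x y → χ (x *ᶠ y) ≡ χ x * χ y
  χ-* x y with classify x
  ... | isZero refl = trans (trans (cong χ (𝔽.zeroˡ y)) χ-0) (sym (cong (_* χ y) χ-0))
  ... | isNonsquare ¬sx = begin
    χ (x *ᶠ y)                           ≡⟨ rearrange (χ y) (χ (x *ᶠ y)) ⟩
    -1ℤ * χ y - (- χ y - χ (x *ᶠ y))     ≡⟨ cong₂ (λ a b → a * χ y - b) (sym (χ-nonsquare ¬sx)) (χ-*-nonsquare ¬sx y) ⟩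
    χ x * χ y - 0ℤ                       ≡⟨ ℤ.+-identityʳ _ ⟩
    χ x * χ y                            ∎
    where
    rearrange : ∀ a b → b ≡ -1ℤ * a - (- a - b)
    rearrange = ℤSolver.solve-∀
  ... | isSquare≢0 x≢0 sx = trans (helper (classify y)) (trans (sym (ℤ.*-identityˡ _)) (cong (_* χ y)
       (sym (χ-square x≢0 sx))))
    where
    helper : Class y → χ (x *ᶠ y) ≡ χ y
    helper (isZero refl)        = cong χ (𝔽.zeroʳ x)
    helper (isSquare≢0 y≢0 sy)  = trans (χ-square (xy≢0 x≢0 y≢0) (IsSq-* sx sy)) (sym (χ-square y≢0 sy))
    helper (isNonsquare ¬sy)    = trans (χ-nonsquare (¬sy ∘ IsSq-cancelˡ x≢0 sx)) (sym (χ-nonsquare ¬sy))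

  χ-1 : χ 1# ≡ 1ℤ
  χ-1 = χ-square (0≢1 ∘ sym) IsSq-1

  χ²-≢0 : ∀ {x} → x ≢ 0# → χ x * χ x ≡ 1ℤ
  χ²-≢0 {x} x≢0 with classify x
  ... | isZero x≡0       = contradiction x≡0 x≢0
  ... | isSquare≢0 _ sx  = cong₂ _*_ (χ-square x≢0 sx) (χ-square x≢0 sx)
  ... | isNonsquare ¬sx  = cong₂ _*_ (χ-nonsquare ¬sx) (χ-nonsquare ¬sx)

  χ² : ∀ x → χ x * χ x ≡ 1ℤ - δ₀ x
  χ² x with x ≟ 0#
  ... | yes refl = cong (λ a → a * a) χ-0
  ... | no x≢0   = χ²-≢0 x≢0

  χ-⁻¹ : ∀ {x} → x ≢ 0# → χ (x ⁻¹) ≡ χ x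
  χ-⁻¹ {x} x≢0 = begin
    χ (x ⁻¹)                  ≡⟨ ℤ.*-identityˡ _ ⟨
    1ℤ * χ (x ⁻¹)             ≡⟨ cong (_* χ (x ⁻¹)) (χ²-≢0 x≢0) ⟨
    χ x * χ x * χ (x ⁻¹)      ≡⟨ ℤ.*-assoc (χ x) _ _ ⟩
    χ x * (χ x * χ (x ⁻¹))    ≡⟨ cong (χ x *_) (trans (sym (χ-* x (x ⁻¹))) (trans (cong χ (⁻¹-inverse x≢0)) χ-1)) ⟩
    χ x * 1ℤ                  ≡⟨ ℤ.*-identityʳ _ ⟩
    χ x                       ∎

  ε : ℤ
  ε = χ (-ᶠ 1#)

  ∑-δ₀ : ∑ elems δ₀ ≡ 1ℤ
  ∑-δ₀ = ∑-⟦≟⟧-1 0#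

  -- This repairs substitutions that are valid only away from 0, such as division by the summation
  -- variable.
  ∑-minus-at-0 : ∀ (f g : Carrier → ℤ) → (∀ x → x ≢ 0# → f x ≡ g x) → f 0# ≡ 0ℤ →
                 ∑ elems f ≡ ∑ elems g - g 0#
  ∑-minus-at-0 f g f≡g f0 = begin
    ∑ elems f
      ≡⟨ ∑-cong elems pointwise ⟩
    ∑ elems (λ x → g x + δ₀ x * (-1ℤ * g x))
      ≡⟨ trans (∑-+ elems g _) (cong (λ z → ∑ elems g + z) (∑-⟦≟⟧ 0# (λ x → -1ℤ * g x))) ⟩
    ∑ elems g + -1ℤ * g 0#
      ≡⟨ cong (λ z → ∑ elems g + z) (ℤ.-1*i≡-i (g 0#)) ⟩
    ∑ elems g - g 0# ∎
    where
    cancel : ∀ a → a + 1ℤ * (-1ℤ * a) ≡ 0ℤ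
    cancel = ℤSolver.solve-∀
    pointwise : ∀ x → f x ≡ g x + δ₀ x * (-1ℤ * g x)
    pointwise x with x ≟ 0#
    ... | yes refl = trans f0 (sym (cancel (g x)))
    ... | no x≢0   = trans (f≡g x x≢0) (sym (ℤ.+-identityʳ _))

  -- For c ≠ 0 the substitution v ↦ c v⁻¹ turns χ(v)χ(c - v) into χ(c v⁻¹ - 1).
  ∑-χχ : ∀ c → ∑ elems (λ v → χ v * χ (c -ᶠ v)) ≡ ε * (q * δ₀ c - 1ℤ)
  ∑-χχ c with c ≟ 0#
  ... | yes refl = begin
    ∑ elems (λ v → χ v * χ (0# -ᶠ v))
      ≡⟨ ∑-cong elems (λ v → trans (cong (λ z → χ v * z) (trans (cong χ (-as-* v)) (χ-* _ v))) (regroup (χ v) ε)) ⟩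
    ∑ elems (λ v → ε * (χ v * χ v))
      ≡⟨ trans (∑-*ˡ elems ε _) (cong (ε *_) (∑-cong elems (λ v → trans (χ² v) (cong (λ z → 1ℤ + z) (sym
           (ℤ.-1*i≡-i (δ₀ v))))))) ⟩
    ε * ∑ elems (λ v → 1ℤ + -1ℤ * δ₀ v)
      ≡⟨ cong (ε *_) (trans (∑-+ elems (λ _ → 1ℤ) _) (cong₂ _+_ ∑-1 (trans (∑-*ˡ elems -1ℤ δ₀) (cong (-1ℤ *_) ∑-δ₀)))) ⟩
    ε * (q - 1ℤ)
      ≡⟨ cong (λ z → ε * (z - 1ℤ)) (ℤ.*-identityʳ q) ⟨
    ε * (q * 1ℤ - 1ℤ) ∎
    where
    regroup : ∀ a e → a * (e * a) ≡ e * (a * a)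
    regroup = ℤSolver.solve-∀
    -as-* : ∀ v → 0# -ᶠ v ≡ (-ᶠ 1#) *ᶠ v
    -as-* v = trans (𝔽.+-identityˡ _) (sym (-1*x≈-x v))
  ... | no c≢0 = begin
    ∑ elems (λ v → χ v * χ (c -ᶠ v))
      ≡⟨ ∑-minus-at-0 _ (λ v → χ (c *ᶠ v ⁻¹ -ᶠ 1#)) divide (cong (_* χ (c -ᶠ 0#)) χ-0) ⟩
    ∑ elems (λ v → χ (c *ᶠ v ⁻¹ -ᶠ 1#)) - χ (c *ᶠ 0# ⁻¹ -ᶠ 1#)
      -- The full sum vanishes because w ↦ c w - 1 is a bijection; the subtracted value at v = 0 is
      -- `ε` by the convention 0⁻¹ = 0.
      ≡⟨ cong₂ _-_ (trans (∑-reindex _⁻¹ _⁻¹ ⁻¹-involutive ⁻¹-involutive (λ w → χ (c *ᶠ w -ᶠ 1#)))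
           (trans (∑-scale c≢0 (λ w → χ (w -ᶠ 1#))) (trans (∑-translate 1# χ) ∑-χ)))
         (cong χ (trans (cong (_-ᶠ 1#) (trans (cong (c *ᶠ_) 0⁻¹) (𝔽.zeroʳ c))) (𝔽.+-identityˡ _))) ⟩
    0ℤ - ε
      ≡⟨ regroup ε q ⟩
    ε * (q * 0ℤ - 1ℤ) ∎
    where
    regroup : ∀ e q → 0ℤ - e ≡ e * (q * 0ℤ - 1ℤ)
    regroup = ℤSolver.solve-∀
    divide : ∀ v → v ≢ 0# → χ v * χ (c -ᶠ v) ≡ χ (c *ᶠ v ⁻¹ -ᶠ 1#)
    divide v v≢0 = begin
      χ v * χ (c -ᶠ v)                        ≡⟨ cong (λ z → χ v * χ z) factor ⟩
      χ v * χ (v *ᶠ (c *ᶠ v ⁻¹ -ᶠ 1#))        ≡⟨ cong (λ z → χ v * z) (χ-* v _) ⟩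
      χ v * (χ v * χ (c *ᶠ v ⁻¹ -ᶠ 1#))       ≡⟨ ℤ.*-assoc (χ v) (χ v) _ ⟨
      χ v * χ v * χ (c *ᶠ v ⁻¹ -ᶠ 1#)         ≡⟨ cong (_* χ (c *ᶠ v ⁻¹ -ᶠ 1#)) (χ²-≢0 v≢0) ⟩
      1ℤ * χ (c *ᶠ v ⁻¹ -ᶠ 1#)                ≡⟨ ℤ.*-identityˡ _ ⟩
      χ (c *ᶠ v ⁻¹ -ᶠ 1#)                     ∎
      where
      factor : c -ᶠ v ≡ v *ᶠ (c *ᶠ v ⁻¹ -ᶠ 1#)
      factor = sym (trans (𝔽.distribˡ v _ _) (cong₂ _+ᶠ_
        (trans (cong (v *ᶠ_) (𝔽.*-comm c _)) (x[x⁻¹y] c v≢0))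
        (trans (sym (-‿distribʳ-* v 1#)) (cong -ᶠ_ (𝔽.*-identityʳ v)))))

  -- The number of y with a y² = v is 1 + χ(a⁻¹ v) = 1 + χ(a) χ(v).
  ∑-squares : ∀ {a} → a ≢ 0# → ∀ (g : Carrier → ℤ) →
    ∑ elems (λ y → g (a *ᶠ (y *ᶠ y))) ≡ ∑ elems g + χ a * ∑ elems (λ v → χ v * g v)
  ∑-squares {a} a≢0 g = begin
    ∑ elems (λ y → g (a *ᶠ (y *ᶠ y)))
      ≡⟨ ∑-fibres (λ y → y *ᶠ y) (λ u → g (a *ᶠ u)) ⟩
    ∑ elems (λ u → roots u * g (a *ᶠ u))
      ≡⟨ ∑-cong elems (λ u → trans (cong (λ z → roots z * g (a *ᶠ u)) (sym (x⁻¹[xy] u a≢0)))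
           (split (roots (a ⁻¹ *ᶠ (a *ᶠ u))) (g (a *ᶠ u)))) ⟩
    ∑ elems (λ u → (1ℤ + χ (a ⁻¹ *ᶠ (a *ᶠ u))) * g (a *ᶠ u))
      ≡⟨ ∑-scale a≢0 (λ v → (1ℤ + χ (a ⁻¹ *ᶠ v)) * g v) ⟩
    ∑ elems (λ v → (1ℤ + χ (a ⁻¹ *ᶠ v)) * g v)
      ≡⟨ ∑-cong elems (λ v → trans (cong (λ z → (1ℤ + z) * g v) (trans (χ-* (a ⁻¹) v) (cong (_* χ v) (χ-⁻¹ a≢0))))
           (expand (χ a) (χ v) (g v))) ⟩
    ∑ elems (λ v → g v + χ a * (χ v * g v))
      ≡⟨ trans (∑-+ elems g _) (cong (λ z → ∑ elems g + z) (∑-*ˡ elems (χ a) _)) ⟩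
    ∑ elems g + χ a * ∑ elems (λ v → χ v * g v) ∎
    where
    split : ∀ r g → r * g ≡ (1ℤ + (r - 1ℤ)) * g
    split = ℤSolver.solve-∀
    expand : ∀ a x g → (1ℤ + a * x) * g ≡ g + a * (x * g)
    expand = ℤSolver.solve-∀

  -- The character of -1 and the residue of q modulo 4.

  private
    κ? : ∀ x → Dec (IsSq x × x ≢ 0#)
    κ? x = isSq? x ×-dec ¬? (x ≟ 0#)

    κ : Carrier → ℤ
    κ x = ⟦ κ? x ⟧

    2κ : ∀ x → + 2 * κ x ≡ χ x + (1ℤ - δ₀ x)
    2κ x with classify x
    ... | isZero refl       = trans (cong (λ z → + 2 * z) (⟦⟧-no (κ? 0#) λ (_ , 0≢0) → 0≢0 refl))
            (sym (cong₂ (λ a b → a + (1ℤ - b)) χ-0 (⟦⟧-yes (0# ≟ 0#) refl)))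
    ... | isSquare≢0 x≢0 sx = trans (cong (λ z → + 2 * z) (⟦⟧-yes (κ? x) (sx , x≢0)))
            (sym (cong₂ (λ a b → a + (1ℤ - b)) (χ-square x≢0 sx) (⟦⟧-no (x ≟ 0#) x≢0)))
    ... | isNonsquare ¬sx   = trans (cong (λ z → + 2 * z) (⟦⟧-no (κ? x) (¬sx ∘ proj₁)))
            (sym (cong₂ (λ a b → a + (1ℤ - b)) (χ-nonsquare ¬sx) (⟦⟧-no (x ≟ 0#) (nonsquare≢0 ¬sx))))

    ∑-1-δ₀ : ∑ elems (λ x → 1ℤ - δ₀ x) ≡ q - 1ℤ
    ∑-1-δ₀ = trans (∑-cong elems (λ x → cong (λ z → 1ℤ + z) (sym (ℤ.-1*i≡-i (δ₀ x)))))
      (trans (∑-+ elems (λ _ → 1ℤ) _) (cong₂ _+_ ∑-1 (trans (∑-*ˡ elems -1ℤ δ₀) (cong (-1ℤ *_) ∑-δ₀))))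

    2∑κ : + 2 * ∑ elems κ ≡ q - 1ℤ
    2∑κ = begin
      + 2 * ∑ elems κ                               ≡⟨ ∑-*ˡ elems (+ 2) κ ⟨
      ∑ elems (λ x → + 2 * κ x)                     ≡⟨ ∑-cong elems 2κ ⟩
      ∑ elems (λ x → χ x + (1ℤ - δ₀ x))             ≡⟨ ∑-+ elems χ _ ⟩
      ∑ elems χ + ∑ elems (λ x → 1ℤ - δ₀ x)         ≡⟨ cong₂ _+_ ∑-χ ∑-1-δ₀ ⟩
      0ℤ + (q - 1ℤ)                                 ≡⟨ ℤ.+-identityˡ _ ⟩
      q - 1ℤ                                        ∎

    -- There are (q - 1)/2 nonzero squares, so the parity of their number decides q modulo 4.
    q≡ : ∀ {n} e → ∑ elems κ ≡ n + + 2 * e → q ≡ 1ℤ + + 2 * n + + 4 * e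
    q≡ {n} e eq = begin
      q                               ≡⟨ [q-1]+1 q ⟩
      1ℤ + (q - 1ℤ)                   ≡⟨ cong (λ z → 1ℤ + z) 2∑κ ⟨
      1ℤ + + 2 * ∑ elems κ            ≡⟨ cong (λ z → 1ℤ + + 2 * z) eq ⟩
      1ℤ + + 2 * (n + + 2 * e)        ≡⟨ expand n e ⟩
      1ℤ + + 2 * n + + 4 * e          ∎
      where
      [q-1]+1 : ∀ q → q ≡ 1ℤ + (q - 1ℤ)
      [q-1]+1 = ℤSolver.solve-∀
      expand : ∀ n e → 1ℤ + + 2 * (n + + 2 * e) ≡ 1ℤ + + 2 * n + + 4 * e
      expand = ℤSolver.solve-∀

  -1≢0 : -ᶠ 1# ≢ 0#
  -1≢0 eq = 0≢1 (trans (sym -0#≈0#) (trans (cong -ᶠ_ (sym eq)) (-‿involutive 1#)))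

  -- The (q - 1)/2 nonzero squares are paired off by x ↦ -x if -1 is a square;
  -- otherwise x ↦ x⁻¹ pairs them off except for x = 1.
  ε-mod4 : (ε ≡ 1ℤ × ∃ λ e → q ≡ 1ℤ + + 4 * e) ⊎ (ε ≡ -1ℤ × ∃ λ e → q ≡ + 3 + + 4 * e)
  ε-mod4 with isSq? (-ᶠ 1#)
  ... | yes s-1 = inj₁ (χ-square -1≢0 s-1 , proj₁ even , q≡ {0ℤ} (proj₁ even) (trans (proj₂ even)
          (cong (λ z → z + + 2 * proj₁ even) (∑-zero elems fixed))))
    where
    IsSq-neg : ∀ {x} → IsSq x → IsSq (-ᶠ x)
    IsSq-neg {x} sx = subst IsSq (-1*x≈-x x) (IsSq-* s-1 sx)
    κ-neg : ∀ x → κ (-ᶠ x) ≡ κ x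
    κ-neg x = ⟦⟧-cong (κ? (-ᶠ x)) (κ? x)
      (λ (s , ≢0) → subst IsSq (-‿involutive x) (IsSq-neg s) , λ { refl → ≢0 -0#≈0# })
      (λ (s , ≢0) → IsSq-neg s , λ eq → ≢0 (trans (sym (-‿involutive x)) (trans (cong -ᶠ_ eq) -0#≈0#)))
    fixed : ∀ x → ⟦ x ≟ -ᶠ x ⟧ * κ x ≡ 0ℤ
    fixed x = trans (⟦⟧-guard (x ≟ -ᶠ x) (λ x≡-x → ⟦⟧-no (κ? x) λ (_ , x≢0) → x≢-x x≢0 x≡-x)) (ℤ.*-zeroʳ ⟦ x ≟ -ᶠ x ⟧)
    even : ∃ λ e → ∑ elems κ ≡ ∑ elems (λ x → ⟦ x ≟ -ᶠ x ⟧ * κ x) + + 2 * e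
    even = ∑-fixedPoints -ᶠ_ -‿involutive κ κ-neg
  ... | no ¬s-1 = inj₂ (χ-nonsquare ¬s-1 , proj₁ odd , q≡ {1ℤ} (proj₁ odd) (trans (proj₂ odd)
          (cong (λ z → z + + 2 * proj₁ odd) (trans (∑-cong elems fixed) (∑-⟦≟⟧-1 1#)))))
    where
    κ-⁻¹-≡ : ∀ {x} → IsSq x × x ≢ 0# → IsSq (x ⁻¹) × x ⁻¹ ≢ 0#
    κ-⁻¹-≡ (s , ≢0) = IsSq-⁻¹ s , ⁻¹≢0 ≢0
    κ-⁻¹ : ∀ x → κ (x ⁻¹) ≡ κ x
    κ-⁻¹ x = ⟦⟧-cong (κ? (x ⁻¹)) (κ? x)
      (λ s → subst (λ z → IsSq z × z ≢ 0#) (⁻¹-involutive x) (κ-⁻¹-≡ s)) κ-⁻¹-≡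
    -- A nonzero fixed point of inversion satisfies x² = 1, and the root -1 is not a square in this
    -- case.
    to : ∀ x → x ≡ x ⁻¹ × (IsSq x × x ≢ 0#) → x ≡ 1#
    to x (x≡x⁻¹ , sx , x≢0) with square-roots {x} {1#} (trans (cong (x *ᶠ_) x≡x⁻¹) (trans (⁻¹-inverse x≢0)
         (sym (𝔽.*-identityˡ 1#))))
    ... | inj₁ x≡1  = x≡1
    ... | inj₂ refl = contradiction sx ¬s-1
    from : ∀ x → x ≡ 1# → x ≡ x ⁻¹ × (IsSq x × x ≢ 0#)
    from x refl = sym (⁻¹-unique (𝔽.*-identityˡ 1#)) , IsSq-1 , 0≢1 ∘ sym
    fixed : ∀ x → ⟦ x ≟ x ⁻¹ ⟧ * κ x ≡ ⟦ x ≟ 1# ⟧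
    fixed x = trans (sym (⟦⟧-× (x ≟ x ⁻¹) (κ? x))) (⟦⟧-cong ((x ≟ x ⁻¹) ×-dec κ? x) (x ≟ 1#) (to x) (from x))
    odd : ∃ λ e → ∑ elems κ ≡ ∑ elems (λ x → ⟦ x ≟ x ⁻¹ ⟧ * κ x) + + 2 * e
    odd = ∑-fixedPoints _⁻¹ ⁻¹-involutive κ κ-⁻¹

  -- Counting tuples of distinct elements by the sum of their squares.

  infixl 5 _∖_
  -- Elements are removed by setting a weight to zero, not by shortening a list: every sum still
  -- runs over `elems`, and inductions can vary the weight freely.
  _∖_ : (Carrier → ℤ) → Carrier → Carrier → ℤ
  (w ∖ y) z = w z * (1ℤ - ⟦ z ≟ y ⟧)

  -- The weighted number of k-tuples of distinct elements whose squares add up to c.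
  E : ℕ → (Carrier → ℤ) → Carrier → ℤ
  E zero    w c = δ₀ c
  E (suc k) w c = ∑ elems (λ y → w y * E k (w ∖ y) (c -ᶠ y *ᶠ y))

  E-cong : ∀ k {w w′} → (∀ z → w z ≡ w′ z) → ∀ c → E k w c ≡ E k w′ c
  E-cong zero    eq c = refl
  E-cong (suc k) eq c = ∑-cong elems (λ y → cong₂ _*_ (eq y)
    (E-cong k (λ z → cong (_* (1ℤ - ⟦ z ≟ y ⟧)) (eq z)) _))

  ∖-comm : ∀ w x y z → (w ∖ x ∖ y) z ≡ (w ∖ y ∖ x) z
  ∖-comm w x y z = swap (w z) (1ℤ - ⟦ z ≟ x ⟧) (1ℤ - ⟦ z ≟ y ⟧)
    where
    swap : ∀ a b c → a * b * c ≡ a * c * b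
    swap = ℤSolver.solve-∀

  -- Both sides vanish for z = y; otherwise removing z leaves the weight of y alone.
  ∖-exchange : ∀ w y z → (w ∖ y) z * (w ∖ z) y ≡ (w ∖ y) z * w y
  ∖-exchange w y z with z ≟ y
  ... | yes refl = trans (vanish (w z) _) (sym (vanish (w z) _))
    where
    vanish : ∀ a b → a * (1ℤ - 1ℤ) * b ≡ 0ℤ
    vanish = ℤSolver.solve-∀
  ... | no z≢y   = cong (λ d → w z * (1ℤ - 0ℤ) * d)
    (trans (cong (λ d → w y * (1ℤ - d)) (⟦⟧-no (y ≟ z) (z≢y ∘ sym))) (ℤ.*-identityʳ (w y)))

  -- A tuple of distinct elements either avoids y or contains it in exactly one of its m + 1
  -- positions, and by symmetry each position contributes the same amount.
  E-remove : ∀ m w y c →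
    E (suc m) w c ≡ E (suc m) (w ∖ y) c + + suc m * (w y * E m (w ∖ y) (c -ᶠ y *ᶠ y))
  E-remove m w y c = begin
    ∑ elems (λ z → w z * G z)
      ≡⟨ ∑-cong elems (λ z → split (w z) ⟦ z ≟ y ⟧ (G z)) ⟩
    ∑ elems (λ z → (w ∖ y) z * G z + ⟦ z ≟ y ⟧ * (w z * G z))
      ≡⟨ trans (∑-+ elems _ _) (cong (λ a → ∑ elems (λ z → (w ∖ y) z * G z) + a) (∑-⟦≟⟧ y (λ z → w z * G z))) ⟩
    ∑ elems (λ z → (w ∖ y) z * G z) + w y * G y
      ≡⟨ rest m ⟩
    E (suc m) (w ∖ y) c + + suc m * (w y * G y) ∎
    where
    G : Carrier → ℤ
    G z = E m (w ∖ z) (c -ᶠ z *ᶠ z)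
    split : ∀ a d g → a * g ≡ a * (1ℤ - d) * g + d * (a * g)
    split = ℤSolver.solve-∀
    rest : ∀ m → ∑ elems (λ z → (w ∖ y) z * E m (w ∖ z) (c -ᶠ z *ᶠ z)) + w y * E m (w ∖ y) (c -ᶠ y *ᶠ y)
               ≡ E (suc m) (w ∖ y) c + + suc m * (w y * E m (w ∖ y) (c -ᶠ y *ᶠ y))
    rest zero    = cong (λ a → E 1 (w ∖ y) c + a) (sym (ℤ.*-identityˡ _))
    -- If the first entry z differs from y, the induction hypothesis finds y in one of the remaining
    -- m + 1 positions; the isolated summand is y in first position, which makes m + 2 in all.
    rest (suc m) = begin
      ∑ elems (λ z → (w ∖ y) z * E (suc m) (w ∖ z) (c -ᶠ z *ᶠ z)) + w y * Y
        ≡⟨ cong (_+ w y * Y) (∑-cong elems step) ⟩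
      ∑ elems (λ z → (w ∖ y) z * E (suc m) (w ∖ y ∖ z) (c -ᶠ z *ᶠ z)
                   + + suc m * w y * ((w ∖ y) z * E m (w ∖ y ∖ z) (c -ᶠ y *ᶠ y -ᶠ z *ᶠ z))) + w y * Y
        ≡⟨ cong (_+ w y * Y) (trans (∑-+ elems _ _) (cong (λ a → E (2 ℕ.+ m) (w ∖ y) c + a)
             (∑-*ˡ elems (+ suc m * w y) _))) ⟩
      E (2 ℕ.+ m) (w ∖ y) c + + suc m * w y * Y + w y * Y
        ≡⟨ collect (E (2 ℕ.+ m) (w ∖ y) c) (+ suc m) (w y) Y ⟩
      E (2 ℕ.+ m) (w ∖ y) c + + suc (suc m) * (w y * Y) ∎
      where
      Y : ℤ
      Y = E (suc m) (w ∖ y) (c -ᶠ y *ᶠ y)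
      collect : ∀ e n a b → e + n * a * b + a * b ≡ e + (1ℤ + n) * (a * b)
      collect = ℤSolver.solve-∀
      expand : ∀ p e n u h → p * (e + n * (u * h)) ≡ p * e + n * h * (p * u)
      expand = ℤSolver.solve-∀
      regroup : ∀ n h p u → n * h * (p * u) ≡ n * u * (p * h)
      regroup = ℤSolver.solve-∀
      step : ∀ z → (w ∖ y) z * E (suc m) (w ∖ z) (c -ᶠ z *ᶠ z)
        ≡ (w ∖ y) z * E (suc m) (w ∖ y ∖ z) (c -ᶠ z *ᶠ z)
          + + suc m * w y * ((w ∖ y) z * E m (w ∖ y ∖ z) (c -ᶠ y *ᶠ y -ᶠ z *ᶠ z))
      step z = begin
        P * E (suc m) (w ∖ z) (c -ᶠ z *ᶠ z)
          ≡⟨ cong (P *_) (E-remove m (w ∖ z) y (c -ᶠ z *ᶠ z)) ⟩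
        P * (E (suc m) (w ∖ z ∖ y) (c -ᶠ z *ᶠ z)
             + + suc m * ((w ∖ z) y * E m (w ∖ z ∖ y) (c -ᶠ z *ᶠ z -ᶠ y *ᶠ y)))
          ≡⟨ cong₂ (λ a b → P * (a + + suc m * ((w ∖ z) y * b)))
               (E-cong (suc m) (∖-comm w z y) _)
               (trans (E-cong m (∖-comm w z y) _) (cong (E m (w ∖ y ∖ z)) commute)) ⟩
        P * (E (suc m) (w ∖ y ∖ z) (c -ᶠ z *ᶠ z) + + suc m * ((w ∖ z) y * H))
          ≡⟨ expand P (E (suc m) (w ∖ y ∖ z) (c -ᶠ z *ᶠ z)) (+ suc m) ((w ∖ z) y) H ⟩
        P * E (suc m) (w ∖ y ∖ z) (c -ᶠ z *ᶠ z) + + suc m * H * (P * (w ∖ z) y)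
          ≡⟨ cong (λ a → P * E (suc m) (w ∖ y ∖ z) (c -ᶠ z *ᶠ z) + + suc m * H * a) (∖-exchange w y z) ⟩
        P * E (suc m) (w ∖ y ∖ z) (c -ᶠ z *ᶠ z) + + suc m * H * (P * w y)
          ≡⟨ cong (λ a → P * E (suc m) (w ∖ y ∖ z) (c -ᶠ z *ᶠ z) + a) (regroup (+ suc m) H P (w y)) ⟩
        P * E (suc m) (w ∖ y ∖ z) (c -ᶠ z *ᶠ z) + + suc m * w y * (P * H) ∎
        where
        P = (w ∖ y) z
        H = E m (w ∖ y ∖ z) (c -ᶠ y *ᶠ y -ᶠ z *ᶠ z)
        commute : c -ᶠ z *ᶠ z -ᶠ y *ᶠ y ≡ c -ᶠ y *ᶠ y -ᶠ z *ᶠ z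
        commute = trans (x-y-z c _ _) (trans (cong (λ z → c -ᶠ z) (𝔽.+-comm _ _)) (sym (x-y-z c _ _)))

  w₀ : Carrier → ℤ
  w₀ z = 1ℤ - δ₀ z

  ∏ : ∀ {k} → (Carrier → ℤ) → Vec Carrier k → ℤ
  ∏ w []      = 1ℤ
  ∏ w (x ∷ v) = w x * ∏ w v

  ∏-1 : ∀ {k} (v : Vec Carrier k) → ∏ (λ _ → 1ℤ) v ≡ 1ℤ
  ∏-1 []      = refl
  ∏-1 (x ∷ v) = trans (ℤ.*-identityˡ _) (∏-1 v)

  private
    unique? : ∀ {k} (v : Vec Carrier k) → Dec (Unique (Vec.toList v))
    unique? v = UniqueDec.unique? _≟_ (Vec.toList v)

    fresh? : ∀ {k} y (v : Vec Carrier k) → Dec (All (y ≢_) (Vec.toList v))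
    fresh? y v = all? (λ z → ¬? (y ≟ z)) (Vec.toList v)

  ⟦unique?⟧-∷ : ∀ {k} y (v : Vec Carrier k) → ⟦ unique? (y ∷ v) ⟧ ≡ ⟦ fresh? y v ⟧ * ⟦ unique? v ⟧
  ⟦unique?⟧-∷ y v = trans
    (⟦⟧-cong (unique? (y ∷ v)) (fresh? y v ×-dec unique? v) (λ { (f ∷ u) → f , u }) (λ (f , u) → f ∷ u))
    (⟦⟧-× (fresh? y v) (unique? v))

  ⟦fresh?⟧-∏ : ∀ {k} w y (v : Vec Carrier k) → ⟦ fresh? y v ⟧ * ∏ w v ≡ ∏ (w ∖ y) v
  ⟦fresh?⟧-∏ w y []      = refl
  ⟦fresh?⟧-∏ w y (z ∷ v) = begin
    ⟦ fresh? y (z ∷ v) ⟧ * (w z * ∏ w v)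
      ≡⟨ cong (_* (w z * ∏ w v)) (trans
           (⟦⟧-cong (fresh? y (z ∷ v)) (¬? (y ≟ z) ×-dec fresh? y v) (λ { (p ∷ f) → p , f }) (λ (p , f) → p ∷ f))
           (⟦⟧-× (¬? (y ≟ z)) (fresh? y v))) ⟩
    ⟦ ¬? (y ≟ z) ⟧ * ⟦ fresh? y v ⟧ * (w z * ∏ w v)
      ≡⟨ regroup ⟦ ¬? (y ≟ z) ⟧ ⟦ fresh? y v ⟧ (w z) (∏ w v) ⟩
    w z * ⟦ ¬? (y ≟ z) ⟧ * (⟦ fresh? y v ⟧ * ∏ w v)
      ≡⟨ cong₂ (λ a b → w z * a * b) complement (⟦fresh?⟧-∏ w y v) ⟩
    w z * (1ℤ - ⟦ z ≟ y ⟧) * ∏ (w ∖ y) v ∎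
    where
    regroup : ∀ a b c d → a * b * (c * d) ≡ c * a * (b * d)
    regroup = ℤSolver.solve-∀
    complement : ⟦ ¬? (y ≟ z) ⟧ ≡ 1ℤ - ⟦ z ≟ y ⟧
    complement with z ≟ y
    ... | yes z≡y = ⟦⟧-no (¬? (y ≟ z)) (λ y≢z → y≢z (sym z≡y))
    ... | no z≢y  = ⟦⟧-yes (¬? (y ≟ z)) (z≢y ∘ sym)

  ∑-nonzeros : ∀ (f : Carrier → ℤ) → ∑ nonzeros f ≡ ∑ elems (λ y → w₀ y * f y)
  ∑-nonzeros f = trans (∑-filter (λ x → ¬? (x ≟ 0#)) elems f) (∑-cong elems λ y → cong (_* f y) (complement y))
    where
    complement : ∀ y → ⟦ ¬? (y ≟ 0#) ⟧ ≡ w₀ y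
    complement y with y ≟ 0#
    ... | yes _ = refl
    ... | no  _ = refl

  -- The weight must be general for the induction: once y is chosen first, the demand that the other
  -- entries differ from y replaces w by `w ∖ y`.
  ∑-tuples : ∀ k w c →
    ∑ (tuples k) (λ v → ⟦ sumSq v ≟ c ⟧ * (⟦ unique? v ⟧ * ∏ w v)) ≡ E k (λ z → w₀ z * w z) c
  ∑-tuples zero    w c = trans (ℤ.+-identityʳ _) (trans (ℤ.*-identityʳ _) (⟦⟧-cong (0# ≟ c) (c ≟ 0#) sym sym))
  ∑-tuples (suc k) w c = begin
    ∑ (tuples (suc k)) f
      ≡⟨ ∑-concatMap (λ x → map (x ∷_) (tuples k)) nonzeros f ⟩
    ∑ nonzeros (λ y → ∑ (map (y ∷_) (tuples k)) f)
      ≡⟨ ∑-cong nonzeros (λ y → trans (∑-map (y ∷_) (tuples k) f)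
           (trans (∑-cong (tuples k) (step y)) (∑-*ˡ (tuples k) (w y) _))) ⟩
    ∑ nonzeros (λ y → w y * ∑ (tuples k) (λ v → ⟦ sumSq v ≟ c -ᶠ y *ᶠ y ⟧ * (⟦ unique? v ⟧ * ∏ (w ∖ y) v)))
      ≡⟨ ∑-nonzeros _ ⟩
    ∑ elems (λ y → w₀ y * (w y * ∑ (tuples k) (λ v → ⟦ sumSq v ≟ c -ᶠ y *ᶠ y ⟧ * (⟦ unique? v ⟧ * ∏ (w ∖ y) v))))
      ≡⟨ ∑-cong elems (λ y → trans (cong (λ a → w₀ y * (w y * a)) (trans (∑-tuples k (w ∖ y) _)
           (E-cong k (λ z → sym (ℤ.*-assoc (w₀ z) (w z) _)) _))) (sym (ℤ.*-assoc (w₀ y) (w y) _))) ⟩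
    E (suc k) (λ z → w₀ z * w z) c ∎
    where
    f : Vec Carrier (suc k) → ℤ
    f v = ⟦ sumSq v ≟ c ⟧ * (⟦ unique? v ⟧ * ∏ w v)
    regroup : ∀ s a u b p → s * (a * u * (b * p)) ≡ b * (s * (u * (a * p)))
    regroup = ℤSolver.solve-∀
    step : ∀ y v → f (y ∷ v) ≡ w y * (⟦ sumSq v ≟ c -ᶠ y *ᶠ y ⟧ * (⟦ unique? v ⟧ * ∏ (w ∖ y) v))
    step y v = begin
      ⟦ y *ᶠ y +ᶠ sumSq v ≟ c ⟧ * (⟦ unique? (y ∷ v) ⟧ * (w y * ∏ w v))
        ≡⟨ cong₂ (λ a b → a * (b * (w y * ∏ w v)))
             (⟦⟧-cong (y *ᶠ y +ᶠ sumSq v ≟ c) (sumSq v ≟ c -ᶠ y *ᶠ y)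
               (λ eq → trans (sym ([x+y]-y (sumSq v) (y *ᶠ y))) (cong (_-ᶠ y *ᶠ y) (trans (𝔽.+-comm _ _) eq)))
               (λ eq → trans (𝔽.+-comm _ _) (trans (cong (_+ᶠ y *ᶠ y) eq) ([x-y]+y c (y *ᶠ y)))))
             (⟦unique?⟧-∷ y v) ⟩
      ⟦ sumSq v ≟ c -ᶠ y *ᶠ y ⟧ * (⟦ fresh? y v ⟧ * ⟦ unique? v ⟧ * (w y * ∏ w v))
        ≡⟨ regroup ⟦ sumSq v ≟ c -ᶠ y *ᶠ y ⟧ ⟦ fresh? y v ⟧ ⟦ unique? v ⟧ (w y) (∏ w v) ⟩
      w y * (⟦ sumSq v ≟ c -ᶠ y *ᶠ y ⟧ * (⟦ unique? v ⟧ * (⟦ fresh? y v ⟧ * ∏ w v)))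
        ≡⟨ cong (λ a → w y * (⟦ sumSq v ≟ c -ᶠ y *ᶠ y ⟧ * (⟦ unique? v ⟧ * a))) (⟦fresh?⟧-∏ w y v) ⟩
      w y * (⟦ sumSq v ≟ c -ᶠ y *ᶠ y ⟧ * (⟦ unique? v ⟧ * ∏ (w ∖ y) v)) ∎

  length-filter : ∀ {X : Set} {P : Pred X 0ℓ} (P? : Decidable P) xs →
                  + length (filter P? xs) ≡ ∑ xs (λ x → ⟦ P? x ⟧)
  length-filter P? []       = refl
  length-filter P? (x ∷ xs) with P? x
  ... | yes _ = cong (λ n → 1ℤ + n) (length-filter P? xs)
  ... | no  _ = trans (length-filter P? xs) (sym (ℤ.+-identityˡ _))

  Nstar0≡E : ∀ k → + Nstar0 k ≡ E k w₀ 0#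
  Nstar0≡E k = begin
    + Nstar0 k
      ≡⟨ length-filter (λ v → (sumSq v ≟ 0#) ×-dec unique? v) (tuples k) ⟩
    ∑ (tuples k) (λ v → ⟦ (sumSq v ≟ 0#) ×-dec unique? v ⟧)
      ≡⟨ ∑-cong (tuples k) (λ v → trans (⟦⟧-× (sumSq v ≟ 0#) (unique? v))
           (cong (⟦ sumSq v ≟ 0# ⟧ *_) (sym (trans (cong (⟦ unique? v ⟧ *_) (∏-1 v)) (ℤ.*-identityʳ _))))) ⟩
    ∑ (tuples k) (λ v → ⟦ sumSq v ≟ 0# ⟧ * (⟦ unique? v ⟧ * ∏ (λ _ → 1ℤ) v))
      ≡⟨ ∑-tuples k (λ _ → 1ℤ) 0# ⟩
    E k (λ z → w₀ z * 1ℤ) 0#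
      ≡⟨ E-cong k (λ z → ℤ.*-identityʳ (w₀ z)) 0# ⟩
    E k w₀ 0# ∎

  w₀-idem : ∀ y → w₀ y * w₀ y ≡ w₀ y
  w₀-idem y with y ≟ 0#
  ... | yes _ = refl
  ... | no  _ = refl

  -- The same count with the first square multiplied by j.
  T : ℕ → ℕ → Carrier → ℤ
  T zero    j c = δ₀ c
  T (suc k) j c = ∑ elems (λ y → w₀ y * E k (w₀ ∖ y) (c -ᶠ fromℕ j *ᶠ (y *ᶠ y)))

  E≡T : ∀ k c → E k w₀ c ≡ T k 1 c
  E≡T zero    c = refl
  E≡T (suc k) c = ∑-cong elems λ y → cong (λ z → w₀ y * E k (w₀ ∖ y) (c -ᶠ z))
    (sym (trans (cong (_*ᶠ (y *ᶠ y)) (𝔽.+-identityʳ 1#)) (𝔽.*-identityˡ _)))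

  -- By `E-remove`, letting the other k entries range freely adds k equal contributions, one for
  -- each entry that may coincide with y. Such an entry brings another y², so the multiplier j grows
  -- to j + 1 and one entry is saved.
  T-suc : ∀ k j c →
    T (suc k) j c ≡ ∑ elems (λ y → w₀ y * E k w₀ (c -ᶠ fromℕ j *ᶠ (y *ᶠ y))) - + k * T k (suc j) c
  T-suc zero    j c = sym (ℤ.+-identityʳ _)
  T-suc (suc k) j c = begin
    ∑ elems (λ y → w₀ y * E (suc k) (w₀ ∖ y) (x y))
      ≡⟨ ∑-cong elems step ⟩
    ∑ elems (λ y → w₀ y * E (suc k) w₀ (x y) + (- (+ suc k)) * (w₀ y * E k (w₀ ∖ y) (c -ᶠ fromℕ (suc j) *ᶠ (y *ᶠ y))))
      ≡⟨ trans (∑-+ elems _ _) (cong (λ a → ∑ elems (λ y → w₀ y * E (suc k) w₀ (x y)) + a) (∑-*ˡ elems (- (+ suc k)) _)) ⟩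
    ∑ elems (λ y → w₀ y * E (suc k) w₀ (x y)) + (- (+ suc k)) * T (suc k) (suc j) c
      ≡⟨ cong (λ a → ∑ elems (λ y → w₀ y * E (suc k) w₀ (x y)) + a) (sym (ℤ.neg-distribˡ-* (+ suc k) _)) ⟩
    ∑ elems (λ y → w₀ y * E (suc k) w₀ (x y)) - + suc k * T (suc k) (suc j) c ∎
    where
    x : Carrier → Carrier
    x y = c -ᶠ fromℕ j *ᶠ (y *ᶠ y)
    solveFor : ∀ a e n u → a * e ≡ a * (e + n * (a * u)) + (- n) * (a * a * u)
    solveFor = ℤSolver.solve-∀
    x-y² : ∀ y → x y -ᶠ y *ᶠ y ≡ c -ᶠ fromℕ (suc j) *ᶠ (y *ᶠ y)
    x-y² y = trans (x-y-z c _ _) (cong (λ z → c -ᶠ z) (trans (𝔽.+-comm _ _)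
      (sym (trans (𝔽.distribʳ (y *ᶠ y) 1# (fromℕ j)) (cong (_+ᶠ fromℕ j *ᶠ (y *ᶠ y)) (𝔽.*-identityˡ _))))))
    step : ∀ y → w₀ y * E (suc k) (w₀ ∖ y) (x y)
      ≡ w₀ y * E (suc k) w₀ (x y) + (- (+ suc k)) * (w₀ y * E k (w₀ ∖ y) (c -ᶠ fromℕ (suc j) *ᶠ (y *ᶠ y)))
    step y = begin
      w₀ y * E (suc k) (w₀ ∖ y) (x y)
        ≡⟨ solveFor (w₀ y) (E (suc k) (w₀ ∖ y) (x y)) (+ suc k) U ⟩
      w₀ y * (E (suc k) (w₀ ∖ y) (x y) + + suc k * (w₀ y * U)) + (- (+ suc k)) * (w₀ y * w₀ y * U)
        ≡⟨ cong₂ (λ a b → w₀ y * a + (- (+ suc k)) * b) (sym (E-remove k w₀ y (x y)))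
             (cong₂ _*_ (w₀-idem y) (cong (E k (w₀ ∖ y)) (x-y² y))) ⟩
      w₀ y * E (suc k) w₀ (x y) + (- (+ suc k)) * (w₀ y * E k (w₀ ∖ y) (c -ᶠ fromℕ (suc j) *ᶠ (y *ᶠ y))) ∎
      where
      U = E k (w₀ ∖ y) (x y -ᶠ y *ᶠ y)

  -- Computation in the subring of the group ring spanned by 1, J and G.

  -- The element α + β J + γ G of the group ring of (F , +), where J is the sum of all
  -- group elements and G the sum of the χ(x) [x]: these satisfy J² = qJ, JG = 0 and
  -- G² = ε(q - J).
  record Coef : Set where
    constructor ⟨_,_,_⟩
    field cα cβ cγ : ℤ
  open Coef public

  -- The coefficient of [c] in the group ring element.
  at : Coef → Carrier → ℤ
  at ⟨ α , β , γ ⟩ c = α * δ₀ c + β + γ * χ c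

  infixl 7 _∙_
  _∙_ : Coef → Coef → Coef
  ⟨ α , β , γ ⟩ ∙ ⟨ α′ , β′ , γ′ ⟩ =
    ⟨ α * α′ + ε * q * (γ * γ′) , α * β′ + β * α′ + q * (β * β′) - ε * (γ * γ′) , α * γ′ + γ * α′ ⟩

  -- The sum of the [a y²] over all y ≠ 0.
  squareSum : Carrier → Coef
  squareSum a with a ≟ 0#
  ... | yes _ = ⟨ q - 1ℤ , 0ℤ , 0ℤ ⟩
  ... | no  _ = ⟨ -1ℤ , 1ℤ , χ a ⟩

  -- The recursion of `T-suc` transcribed to coefficient triples: the sum over y has become
  -- multiplication by `squareSum`.
  τ : ℕ → ℕ → Coef
  τ zero    j = ⟨ 1ℤ , 0ℤ , 0ℤ ⟩
  τ (suc k) j = ⟨ cα σ - + k * cα ρ , cβ σ - + k * cβ ρ , cγ σ - + k * cγ ρ ⟩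
    where
    σ = squareSum (fromℕ j) ∙ τ k 1
    ρ = τ k (suc j)

  ∑-w₀ : ∀ (f : Carrier → ℤ) → ∑ elems (λ y → w₀ y * f y) ≡ ∑ elems f - f 0#
  ∑-w₀ f = ∑-minus-at-0 _ f (λ y y≢0 → trans (cong (λ d → (1ℤ - d) * f y) (⟦⟧-no (y ≟ 0#) y≢0)) (ℤ.*-identityˡ _))
    (cong (λ d → (1ℤ - d) * f 0#) (⟦⟧-yes (0# ≟ 0#) refl))

  ∑-combination : ∀ a b c (h d x : Carrier → ℤ) →
    ∑ elems (λ v → h v * (a * d v + b + c * x v))
      ≡ a * ∑ elems (λ v → h v * d v) + b * ∑ elems h + c * ∑ elems (λ v → h v * x v)
  ∑-combination a b c h d x = begin
    ∑ elems (λ v → h v * (a * d v + b + c * x v))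
      ≡⟨ ∑-cong elems (λ v → expand a b c (h v) (d v) (x v)) ⟩
    ∑ elems (λ v → a * (h v * d v) + b * h v + c * (h v * x v))
      ≡⟨ trans (∑-+ elems _ _) (cong₂ _+_ (∑-+ elems _ _) (∑-*ˡ elems c _)) ⟩
    ∑ elems (λ v → a * (h v * d v)) + ∑ elems (λ v → b * h v) + c * ∑ elems (λ v → h v * x v)
      ≡⟨ cong (_+ c * ∑ elems (λ v → h v * x v)) (cong₂ _+_ (∑-*ˡ elems a _) (∑-*ˡ elems b h)) ⟩
    a * ∑ elems (λ v → h v * d v) + b * ∑ elems h + c * ∑ elems (λ v → h v * x v) ∎
    where
    expand : ∀ a b c h d x → h * (a * d + b + c * x) ≡ a * (h * d) + b * h + c * (h * x)
    expand = ℤSolver.solve-∀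

  -- The left side is the convolution of Σ_{y ≠ 0} [a y²] with g. For a ≠ 0, `∑-squares` reduces it
  -- to the plain sum of g and the sum of g twisted by χ; the relation for G² enters the latter
  -- through `∑-χχ`.
  squareSum-∙ : ∀ a g c →
    ∑ elems (λ y → w₀ y * at g (c -ᶠ a *ᶠ (y *ᶠ y))) ≡ at (squareSum a ∙ g) c
  squareSum-∙ a g@(⟨ α , β , γ ⟩) c with a ≟ 0#
  ... | yes refl = begin
    ∑ elems (λ y → w₀ y * at g (c -ᶠ 0# *ᶠ (y *ᶠ y)))
      ≡⟨ ∑-cong elems (λ y → cong (λ z → w₀ y * at g z)
           (trans (cong (λ z → c -ᶠ z) (𝔽.zeroˡ _)) (trans (cong (c +ᶠ_) -0#≈0#) (𝔽.+-identityʳ c)))) ⟩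
    ∑ elems (λ y → w₀ y * at g c)
      ≡⟨ trans (∑-*ʳ elems (at g c) w₀) (cong (_* at g c) ∑-1-δ₀) ⟩
    (q - 1ℤ) * at g c
      ≡⟨ expand q ε α β γ (δ₀ c) (χ c) ⟩
    at (⟨ q - 1ℤ , 0ℤ , 0ℤ ⟩ ∙ g) c ∎
    where
    expand : ∀ q ε α β γ d x → (q - 1ℤ) * (α * d + β + γ * x)
      ≡ ((q - 1ℤ) * α + ε * q * (0ℤ * γ)) * d
        + ((q - 1ℤ) * β + 0ℤ * α + q * (0ℤ * β) - ε * (0ℤ * γ)) + ((q - 1ℤ) * γ + 0ℤ * α) * x
    expand = ℤSolver.solve-∀
  ... | no a≢0 = begin
    ∑ elems (λ y → w₀ y * at g (c -ᶠ a *ᶠ (y *ᶠ y)))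
      ≡⟨ ∑-w₀ _ ⟩
    ∑ elems (λ y → at g (c -ᶠ a *ᶠ (y *ᶠ y))) - at g (c -ᶠ a *ᶠ (0# *ᶠ 0#))
      ≡⟨ cong₂ _-_ (∑-squares a≢0 (λ v → at g (c -ᶠ v))) (cong (at g) c-a0²) ⟩
    ∑ elems (λ v → at g (c -ᶠ v)) + χ a * ∑ elems (λ v → χ v * at g (c -ᶠ v)) - at g c
      ≡⟨ cong₂ (λ x y → x + χ a * y - at g c) total twisted ⟩
    α * 1ℤ + β * q + γ * 0ℤ + χ a * (α * χ c + β * 0ℤ + γ * (ε * (q * δ₀ c - 1ℤ))) - at g c
      ≡⟨ expand q ε (χ a) α β γ (δ₀ c) (χ c) ⟩
    at (⟨ -1ℤ , 1ℤ , χ a ⟩ ∙ g) c ∎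
    where
    c-a0² : c -ᶠ a *ᶠ (0# *ᶠ 0#) ≡ c
    c-a0² = trans (cong (λ z → c -ᶠ z) (trans (cong (a *ᶠ_) (𝔽.zeroˡ 0#)) (𝔽.zeroʳ a)))
      (trans (cong (c +ᶠ_) -0#≈0#) (𝔽.+-identityʳ c))
    total : ∑ elems (λ v → at g (c -ᶠ v)) ≡ α * 1ℤ + β * q + γ * 0ℤ
    total = begin
      ∑ elems (λ v → at g (c -ᶠ v))
        ≡⟨ trans (∑-reflect c (at g)) (∑-cong elems (λ v → sym (ℤ.*-identityˡ (at g v)))) ⟩
      ∑ elems (λ v → 1ℤ * at g v)
        ≡⟨ ∑-combination α β γ (λ _ → 1ℤ) δ₀ χ ⟩
      α * ∑ elems (λ v → 1ℤ * δ₀ v) + β * ∑ elems (λ _ → 1ℤ) + γ * ∑ elems (λ v → 1ℤ * χ v)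
        ≡⟨ cong₂ _+_ (cong₂ (λ x y → α * x + β * y)
             (trans (∑-cong elems (λ v → ℤ.*-identityˡ (δ₀ v))) ∑-δ₀) ∑-1)
             (cong (γ *_) (trans (∑-cong elems (λ v → ℤ.*-identityˡ (χ v))) ∑-χ)) ⟩
      α * 1ℤ + β * q + γ * 0ℤ ∎
    twisted : ∑ elems (λ v → χ v * at g (c -ᶠ v)) ≡ α * χ c + β * 0ℤ + γ * (ε * (q * δ₀ c - 1ℤ))
    twisted = begin
      ∑ elems (λ v → χ v * at g (c -ᶠ v))
        ≡⟨ ∑-combination α β γ χ (λ v → δ₀ (c -ᶠ v)) (λ v → χ (c -ᶠ v)) ⟩
      α * ∑ elems (λ v → χ v * δ₀ (c -ᶠ v)) + β * ∑ elems χ + γ * ∑ elems (λ v → χ v * χ (c -ᶠ v))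
        ≡⟨ cong₂ _+_ (cong₂ (λ x y → α * x + β * y) (trans (∑-cong elems (λ v → trans (ℤ.*-comm (χ v) _)
             (cong (_* χ v) (⟦⟧-cong (c -ᶠ v ≟ 0#) (v ≟ c) (sym ∘ x-y≡0⇒x≡y) (x≡y⇒x-y≡0 ∘ sym))))) (∑-⟦≟⟧ c χ)) ∑-χ)
             (cong (γ *_) (∑-χχ c)) ⟩
      α * χ c + β * 0ℤ + γ * (ε * (q * δ₀ c - 1ℤ)) ∎
    expand : ∀ q ε s α β γ d x →
      α * 1ℤ + β * q + γ * 0ℤ + s * (α * x + β * 0ℤ + γ * (ε * (q * d - 1ℤ))) - (α * d + β + γ * x)
      ≡ (-1ℤ * α + ε * q * (s * γ)) * d
        + (-1ℤ * β + 1ℤ * α + q * (1ℤ * β) - ε * (s * γ)) + (-1ℤ * γ + s * α) * x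
    expand = ℤSolver.solve-∀

  T≡τ : ∀ k j c → T k j c ≡ at (τ k j) c
  T≡τ zero    j c = unit (δ₀ c) (χ c)
    where
    unit : ∀ d x → d ≡ 1ℤ * d + 0ℤ + 0ℤ * x
    unit = ℤSolver.solve-∀
  T≡τ (suc k) j c = begin
    T (suc k) j c
      ≡⟨ T-suc k j c ⟩
    ∑ elems (λ y → w₀ y * E k w₀ (c -ᶠ fromℕ j *ᶠ (y *ᶠ y))) - + k * T k (suc j) c
      ≡⟨ cong₂ (λ x y → x - + k * y)
           (trans (∑-cong elems (λ y → cong (w₀ y *_) (trans (E≡T k _) (T≡τ k 1 _)))) (squareSum-∙ (fromℕ j) (τ k 1) c))
           (T≡τ k (suc j) c) ⟩
    at σ c - + k * at ρ c
      ≡⟨ expand (+ k) (cα σ) (cβ σ) (cγ σ) (cα ρ) (cβ ρ) (cγ ρ) (δ₀ c) (χ c) ⟩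
    at (τ (suc k) j) c ∎
    where
    σ = squareSum (fromℕ j) ∙ τ k 1
    ρ = τ k (suc j)
    expand : ∀ k a b c a′ b′ c′ d x → (a * d + b + c * x) - k * (a′ * d + b′ + c′ * x)
      ≡ (a - k * a′) * d + (b - k * b′) + (c - k * c′) * x
    expand = ℤSolver.solve-∀

  Nstar0≡τ : ∀ k → + Nstar0 k ≡ cα (τ k 1) + cβ (τ k 1)
  Nstar0≡τ k = begin
    + Nstar0 k                                          ≡⟨ trans (Nstar0≡E k) (trans (E≡T k 0#) (T≡τ k 1 0#)) ⟩
    a * δ₀ 0# + b + c * χ 0#                            ≡⟨ cong₂ (λ d x → a * d + b + c * x) (⟦⟧-yes (0# ≟ 0#) refl) χ-0 ⟩
    a * 1ℤ + b + c * 0ℤ                                 ≡⟨ simplify a b c ⟩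
    a + b                                               ∎
    where
    a = cα (τ k 1)
    b = cβ (τ k 1)
    c = cγ (τ k 1)
    simplify : ∀ a b c → a * 1ℤ + b + c * 0ℤ ≡ a + b
    simplify = ℤSolver.solve-∀

  -- The homomorphism [x] ↦ 1, the sum of all coefficients: J contributes q and G contributes Σ χ =
  -- 0.
  augmentation : Coef → ℤ
  augmentation g = cα g + q * cβ g

  augmentation-squareSum : ∀ a g → augmentation (squareSum a ∙ g) ≡ (q - 1ℤ) * augmentation g
  augmentation-squareSum a ⟨ α , β , γ ⟩ with a ≟ 0#
  ... | yes _ = expand q ε α β γ
    where
    expand : ∀ q ε α β γ → ((q - 1ℤ) * α + ε * q * (0ℤ * γ)) + q * ((q - 1ℤ) * β + 0ℤ * α + q * (0ℤ * β) - ε * (0ℤ * γ))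
      ≡ (q - 1ℤ) * (α + q * β)
    expand = ℤSolver.solve-∀
  ... | no  _ = expand q ε (χ a) α β γ
    where
    expand : ∀ q ε s α β γ → (-1ℤ * α + ε * q * (s * γ)) + q * (-1ℤ * β + 1ℤ * α + q * (1ℤ * β) - ε * (s * γ))
      ≡ (q - 1ℤ) * (α + q * β)
    expand = ℤSolver.solve-∀

  -- Summing over all c forgets the equation, so this counts all k-tuples of distinct nonzero
  -- elements, whatever the multiplier j is.
  augmentation-τ : ∀ k j → augmentation (τ k j) ≡ fall (q - 1ℤ) k
  augmentation-τ zero    j = cong (λ z → 1ℤ + z) (ℤ.*-zeroʳ q)
  augmentation-τ (suc k) j = begin
    augmentation (τ (suc k) j)
      ≡⟨ linear q (+ k) (cα σ) (cβ σ) (cα ρ) (cβ ρ) ⟩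
    augmentation σ - + k * augmentation ρ
      ≡⟨ cong₂ (λ x y → x - + k * y) (trans (augmentation-squareSum (fromℕ j) (τ k 1))
           (cong ((q - 1ℤ) *_) (augmentation-τ k 1)))
           (augmentation-τ k (suc j)) ⟩
    (q - 1ℤ) * fall (q - 1ℤ) k - + k * fall (q - 1ℤ) k
      ≡⟨ factor (q - 1ℤ) (+ k) (fall (q - 1ℤ) k) ⟩
    fall (q - 1ℤ) k * (q - 1ℤ - + k) ∎
    where
    σ = squareSum (fromℕ j) ∙ τ k 1
    ρ = τ k (suc j)
    linear : ∀ q k a b a′ b′ → (a - k * a′) + q * (b - k * b′) ≡ (a + q * b) - k * (a′ + q * b′)
    linear = ℤSolver.solve-∀
    factor : ∀ x k f → x * f - k * f ≡ f * (x - k)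
    factor = ℤSolver.solve-∀

  -- The coefficient of [0] is α + β, since χ(0) = 0, and q(α + β) = (α + qβ) + (q - 1)α. The
  -- augmentation knows the first bracket; β is thus eliminated, and α survives in the factor that
  -- kills J.
  q*Nstar0 : ∀ k → q * + Nstar0 k ≡ fall (q - 1ℤ) k + (q - 1ℤ) * cα (τ k 1)
  q*Nstar0 k = begin
    q * + Nstar0 k                                          ≡⟨ cong (q *_) (Nstar0≡τ k) ⟩
    q * (cα (τ k 1) + cβ (τ k 1))                           ≡⟨ regroup q (cα (τ k 1)) (cβ (τ k 1)) ⟩
    augmentation (τ k 1) + (q - 1ℤ) * cα (τ k 1)            ≡⟨ cong (_+ (q - 1ℤ) * cα (τ k 1)) (augmentation-τ k 1) ⟩
    fall (q - 1ℤ) k + (q - 1ℤ) * cα (τ k 1)                 ∎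
    where
    regroup : ∀ q a b → q * (a + b) ≡ (a + q * b) + (q - 1ℤ) * a
    regroup = ℤSolver.solve-∀

-- The characteristic of a field with p^s elements.

module Characteristic (F : FiniteField) (p s : ℕ) (p-prime : Prime p)
                      (size≡p^s : FiniteField.size F ≡ p ℕ.^ s) where
  open FiniteField F renaming (_+_ to _+ᶠ_; _*_ to _*ᶠ_; -_ to infix 8 -ᶠ_; _≟_ to infix 4 _≟_)
  open FieldArithmetic F
  open Sums isCommutativeRing
  open Enumeration _≟_ elems elems-complete elems-unique isCommutativeRing
  open import Algebra.Properties.Group 𝔽.+-group using (identityʳ-unique)
  open ≡-Reasoning

  fromℕ≡nat : ∀ n → fromℕ n ≡ nat n
  fromℕ≡nat zero    = refl
  fromℕ≡nat (suc n) = cong (1# +ᶠ_) (fromℕ≡nat n)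

  fromℕ-* : ∀ m n → fromℕ (m ℕ.* n) ≡ fromℕ m *ᶠ fromℕ n
  fromℕ-* m n = trans (fromℕ≡nat (m ℕ.* n)) (trans (nat-* m n) (sym (cong₂ _*ᶠ_ (fromℕ≡nat m) (fromℕ≡nat n))))

  -- Translating by 1 permutes the elements, so it does not change their sum.
  fromℕ-size : fromℕ size ≡ 0#
  fromℕ-size = trans (trans (fromℕ≡nat size) (sym (∑-one elems)))
    (identityʳ-unique (∑ elems id) _ (begin
      ∑ elems id +ᶠ ∑ elems (λ _ → 1#)  ≡⟨ ∑-+ elems id (λ _ → 1#) ⟨
      ∑ elems (_+ᶠ 1#)                  ≡⟨ ∑-reindex (_+ᶠ 1#) (_-ᶠ 1#) (λ x → [x+y]-y x 1#) (λ x → [x-y]+y x 1#) id ⟩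
      ∑ elems id                        ∎))

  -- The factors of p^s can be cancelled one at a time for lack of zero divisors; if none vanished,
  -- 1 = 0 would remain.
  fromℕ-p : fromℕ p ≡ 0#
  fromℕ-p = go s (trans (cong fromℕ (sym size≡p^s)) fromℕ-size)
    where
    go : ∀ s → fromℕ (p ℕ.^ s) ≡ 0# → fromℕ p ≡ 0#
    go zero    eq = contradiction (trans (sym eq) (𝔽.+-identityʳ 1#)) 0≢1
    go (suc s) eq with fromℕ p ≟ 0#
    ... | yes p≡0 = p≡0
    ... | no p≢0  = go s (xy≡0⇒y≡0 p≢0 (trans (sym (fromℕ-* p _)) eq))

  fromℕ-multiple : ∀ x {j} → fromℕ j ≡ 0# → fromℕ (x ℕ.* j) ≡ 0#
  fromℕ-multiple x {j} eq = trans (fromℕ-* x j) (trans (cong (fromℕ x *ᶠ_) eq) (𝔽.zeroʳ _))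

  p∣⇒fromℕ≡0 : ∀ {j} → p ∣ j → fromℕ j ≡ 0#
  p∣⇒fromℕ≡0 (divides x refl) = fromℕ-multiple x fromℕ-p

  -- If p did not divide j, Bézout would express 1 through p and j, both of which are zero in the
  -- field.
  fromℕ≡0⇒p∣ : ∀ {j} → fromℕ j ≡ 0# → p ∣ j
  fromℕ≡0⇒p∣ {j} j≡0 with p ∣? j
  ... | yes p∣j = p∣j
  ... | no p∤j  = contradiction (helper (coprime-Bézout coprime)) (0≢1 ∘ sym)
    where
    coprime : ∀ {i} → i ∣ j × i ∣ p → i ≡ 1
    coprime {i} (i∣j , i∣p) with prime⇒irreducible p-prime i∣p
    ... | inj₁ i≡1  = i≡1
    ... | inj₂ refl = contradiction i∣j p∤j
    one : ∀ {x y a b} → 1 ℕ.+ x ℕ.* a ≡ y ℕ.* b → fromℕ a ≡ 0# → fromℕ b ≡ 0# → 1# ≡ 0#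
    one {x} {y} {a} {b} eq a≡0 b≡0 = begin
      1#                       ≡⟨ 𝔽.+-identityʳ 1# ⟨
      1# +ᶠ 0#                 ≡⟨ cong (1# +ᶠ_) (fromℕ-multiple x a≡0) ⟨
      fromℕ (1 ℕ.+ x ℕ.* a)    ≡⟨ cong fromℕ eq ⟩
      fromℕ (y ℕ.* b)          ≡⟨ fromℕ-multiple y b≡0 ⟩
      0#                       ∎
    helper : Bézout.Identity 1 j p → 1# ≡ 0#
    helper (Bézout.+- x y eq) = one {y} {x} eq fromℕ-p j≡0
    helper (Bézout.-+ x y eq) = one {x} {y} eq j≡0 fromℕ-p

  fromℕ2≢0 : p ≢ 2 → fromℕ 2 ≢ 0#
  fromℕ2≢0 p≢2 eq with irreducible[2] (fromℕ≡0⇒p∣ {2} eq)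
  ... | inj₁ refl = contradiction p-prime ¬prime[1]
  ... | inj₂ p≡2  = contradiction p≡2 p≢2

-- Prime powers modulo 4.

module Mod4 where
  open import Data.Integer.Base using (_+_; _*_; _-_; -_)

  infix 4 _≡4_
  data _≡4_ (x r : ℤ) : Set where
    mod4 : ∀ e → x ≡ r + + 4 * e → x ≡4 r

  -- Otherwise 4(e - f) = 2; halving and taking absolute values makes 1 even.
  1≢3 : ∀ {x} → x ≡4 + 1 → ¬ (x ≡4 + 3)
  1≢3 {x} (mod4 e eq) (mod4 f eq′) = ℕ.even≢odd (ℤ.∣ e - f ∣) 0
    (trans (sym (ℤ.abs-* (+ 2) (e - f))) (cong ℤ.∣_∣ (ℤ.*-cancelˡ-≡ (+ 2) (+ 2 * (e - f)) (+ 1) 2*2*[e-f]≡2)))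
    where
    difference : ∀ e f → + 2 * (+ 2 * (e - f)) ≡ (+ 1 + + 4 * e) - (+ 3 + + 4 * f) + + 2
    difference = ℤSolver.solve-∀
    cancel : ∀ x → x - x + + 2 ≡ + 2
    cancel = ℤSolver.solve-∀
    2*2*[e-f]≡2 : + 2 * (+ 2 * (e - f)) ≡ + 2 * + 1
    2*2*[e-f]≡2 = trans (difference e f) (trans (cong₂ (λ a b → a - b + + 2) (sym eq) (sym eq′)) (cancel x))

  private
    11≡1 : ∀ {x y} → x ≡4 + 1 → y ≡4 + 1 → (x * y) ≡4 + 1
    11≡1 (mod4 e refl) (mod4 f refl) = mod4 (e + f + + 4 * e * f) (lemma e f)
      where
      lemma : ∀ e f → (+ 1 + + 4 * e) * (+ 1 + + 4 * f) ≡ + 1 + + 4 * (e + f + + 4 * e * f)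
      lemma = ℤSolver.solve-∀

    31≡3 : ∀ {x y} → x ≡4 + 3 → y ≡4 + 1 → (x * y) ≡4 + 3
    31≡3 (mod4 e refl) (mod4 f refl) = mod4 (e + + 3 * f + + 4 * e * f) (lemma e f)
      where
      lemma : ∀ e f → (+ 3 + + 4 * e) * (+ 1 + + 4 * f) ≡ + 3 + + 4 * (e + + 3 * f + + 4 * e * f)
      lemma = ℤSolver.solve-∀

    33≡1 : ∀ {x y} → x ≡4 + 3 → y ≡4 + 3 → (x * y) ≡4 + 1
    33≡1 (mod4 e refl) (mod4 f refl) = mod4 (+ 2 + + 3 * e + + 3 * f + + 4 * e * f) (lemma e f)
      where
      lemma : ∀ e f → (+ 3 + + 4 * e) * (+ 3 + + 4 * f) ≡ + 1 + + 4 * (+ 2 + + 3 * e + + 3 * f + + 4 * e * f)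
      lemma = ℤSolver.solve-∀

  %4⇒≡4 : ∀ {r} p → p ℕ.% 4 ≡ r → (+ p) ≡4 (+ r)
  %4⇒≡4 {r} p eq = mod4 (+ (p ℕ./ 4)) (trans (cong +_ (m≡m%n+[m/n]*n p 4))
    (cong₂ (λ a b → + a + b) eq (trans (ℤ.pos-* (p ℕ./ 4) 4) (ℤ.*-comm (+ (p ℕ./ 4)) (+ 4)))))

  module _ {p : ℕ} where

    ^-suc : ∀ {r} s → (+ p * + (p ℕ.^ s)) ≡4 r → (+ (p ℕ.^ suc s)) ≡4 r
    ^-suc s (mod4 e eq) = mod4 e (trans (ℤ.pos-* p (p ℕ.^ s)) eq)

    1^s : p ℕ.% 4 ≡ 1 → ∀ s → (+ (p ℕ.^ s)) ≡4 + 1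
    1^s p≡1 zero    = mod4 (+ 0) refl
    1^s p≡1 (suc s) = ^-suc s (11≡1 (%4⇒≡4 p p≡1) (1^s p≡1 s))

    3^even : p ℕ.% 4 ≡ 3 → ∀ s → s ℕ.% 2 ≡ 0 → (+ (p ℕ.^ s)) ≡4 + 1
    3^odd  : p ℕ.% 4 ≡ 3 → ∀ s → s ℕ.% 2 ≡ 1 → (+ (p ℕ.^ s)) ≡4 + 3
    3^even p≡3 zero          eq = mod4 (+ 0) refl
    3^even p≡3 (suc (suc s)) eq = ^-suc (suc s) (33≡1 (%4⇒≡4 p p≡3) (^-suc s (31≡3 (%4⇒≡4 p p≡3) (3^even p≡3 s eq))))
    3^odd  p≡3 (suc zero)    eq = ^-suc 0 (31≡3 (%4⇒≡4 p p≡3) (mod4 (+ 0) refl))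
    3^odd  p≡3 (suc (suc s)) eq = ^-suc (suc s) (31≡3 (%4⇒≡4 p p≡3) (^-suc s (33≡1 (%4⇒≡4 p p≡3) (3^odd p≡3 s eq))))

-- Fractions in ℚ.

module Fractions where

  -- Fractions in ℚ are stored in lowest terms, so identities between them are proved by cross
  -- multiplication in `ℚᵘ` and transported along `fromℚᵘ`.
  fromℚᵘ-+ : ∀ x y → ℚ.fromℚᵘ (x ℚᵘ.+ y) ≡ ℚ.fromℚᵘ x ℚ.+ ℚ.fromℚᵘ y
  fromℚᵘ-+ x y = ℚ.toℚᵘ-injective (ℚᵘ.≃-trans (ℚ.toℚᵘ-fromℚᵘ (x ℚᵘ.+ y)) (ℚᵘ.≃-sym (ℚᵘ.≃-trans
    (ℚ.toℚᵘ-homo-+ (ℚ.fromℚᵘ x) (ℚ.fromℚᵘ y)) (ℚᵘ.+-cong (ℚ.toℚᵘ-fromℚᵘ x) (ℚ.toℚᵘ-fromℚᵘ y)))))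

  fromℚᵘ-* : ∀ x y → ℚ.fromℚᵘ (x ℚᵘ.* y) ≡ ℚ.fromℚᵘ x ℚ.* ℚ.fromℚᵘ y
  fromℚᵘ-* x y = ℚ.toℚᵘ-injective (ℚᵘ.≃-trans (ℚ.toℚᵘ-fromℚᵘ (x ℚᵘ.* y)) (ℚᵘ.≃-sym (ℚᵘ.≃-trans
    (ℚ.toℚᵘ-homo-* (ℚ.fromℚᵘ x) (ℚ.fromℚᵘ y)) (ℚᵘ.*-cong (ℚ.toℚᵘ-fromℚᵘ x) (ℚ.toℚᵘ-fromℚᵘ y)))))

  fromℚᵘ-neg : ∀ x → ℚ.fromℚᵘ (ℚᵘ.- x) ≡ ℚ.- ℚ.fromℚᵘ x
  fromℚᵘ-neg x = ℚ.toℚᵘ-injective (ℚᵘ.≃-trans (ℚ.toℚᵘ-fromℚᵘ (ℚᵘ.- x)) (ℚᵘ.≃-sym (ℚᵘ.≃-trans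
    (ℚ.toℚᵘ-homo‿- (ℚ.fromℚᵘ x)) (ℚᵘ.-‿cong (ℚ.toℚᵘ-fromℚᵘ x)))))

  fromℤ : ℤ → ℚ
  fromℤ z = z ℚ./ 1

  fromℤ-+ : ∀ a b → fromℤ (a ℤ.+ b) ≡ fromℤ a ℚ.+ fromℤ b
  fromℤ-+ a b = trans (ℚ.fromℚᵘ-cong {mkℚᵘ (a ℤ.+ b) 0} {mkℚᵘ a 0 ℚᵘ.+ mkℚᵘ b 0} (*≡* (lemma a b)))
    (fromℚᵘ-+ (mkℚᵘ a 0) (mkℚᵘ b 0))
    where
    lemma : ∀ a b → (a ℤ.+ b) ℤ.* + 1 ≡ (a ℤ.* + 1 ℤ.+ b ℤ.* + 1) ℤ.* + 1
    lemma = ℤSolver.solve-∀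

  fromℤ-* : ∀ a b → fromℤ (a ℤ.* b) ≡ fromℤ a ℚ.* fromℤ b
  fromℤ-* a b = fromℚᵘ-* (mkℚᵘ a 0) (mkℚᵘ b 0)

  fromℤ-neg : ∀ a → fromℤ (ℤ.- a) ≡ ℚ.- fromℤ a
  fromℤ-neg a = fromℚᵘ-neg (mkℚᵘ a 0)

  recip : (n : ℕ) .{{_ : ℕ.NonZero n}} → ℚ
  recip n = + 1 ℚ./ n

  /-recip : ∀ z n .{{_ : ℕ.NonZero n}} → z ℚ./ n ≡ fromℤ z ℚ.* recip n
  /-recip z (suc n) = trans
    (ℚ.fromℚᵘ-cong {mkℚᵘ z n} {mkℚᵘ z 0 ℚᵘ.* mkℚᵘ (+ 1) n} (*≡* (cong₂ ℤ._*_ (sym (ℤ.*-identityʳ z)) (cong (λ m →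
         + suc m) (ℕ.+-identityʳ n)))))
    (fromℚᵘ-* (mkℚᵘ z 0) (mkℚᵘ (+ 1) n))

  recip-* : ∀ m n .{{_ : ℕ.NonZero m}} .{{_ : ℕ.NonZero n}} .{{_ : ℕ.NonZero (m ℕ.* n)}} →
            recip (m ℕ.* n) ≡ recip m ℚ.* recip n
  recip-* (suc m) (suc n) = fromℚᵘ-* (mkℚᵘ (+ 1) m) (mkℚᵘ (+ 1) n)

  recip-cong : ∀ {m n} .{{_ : ℕ.NonZero m}} .{{_ : ℕ.NonZero n}} → m ≡ n → recip m ≡ recip n
  recip-cong refl = refl

  recip-inverse : ∀ n .{{_ : ℕ.NonZero n}} → fromℤ (+ n) ℚ.* recip n ≡ ℚ.1ℚ
  recip-inverse (suc n) = trans (sym (/-recip (+ suc n) (suc n)))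
    (ℚ.fromℚᵘ-cong {mkℚᵘ (+ suc n) n} {mkℚᵘ (+ 1) 0} (*≡* (ℤ.*-comm (+ suc n) (+ 1))))

-- The cycle index with its rational coefficients.

module RationalCycleIndex {R : Set} {_+_ _*_ : Op₂ R} { -_ : Op₁ R} {0# 1# : R}
    (isCR : IsCommutativeRing _≡_ _+_ _*_ -_ 0# 1#) (ι : ℚ → R)
    (ι-* : ∀ a b → ι (a ℚ.* b) ≡ ι a * ι b)
    (nat≡ι : ∀ n → Sums.nat isCR n ≡ ι (Fractions.fromℤ (+ n))) (t : ℕ → R) where

  private
    infixl 7 _⊠_
    infix 8 ⊟_
    _⊠_ : R → R → R
    _⊠_ = _*_
    ⊟_ : R → R
    ⊟_ = -_

  open Fractions
  open Sums isCR
  open CycleIndex isCR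
  open IsCommutativeRing isCR using (+-identityʳ; *-assoc; *-identityˡ; *-identityʳ)
  private
    commutativeRing : CommutativeRing 0ℓ 0ℓ
    commutativeRing = record { isCommutativeRing = isCR }

  open import Algebra.Properties.Ring (CommutativeRing.ring commutativeRing)
    using (-‿distribˡ-*; -‿distribʳ-*; -‿involutive)
  open ≡-Reasoning

  ι-1 : ι ℚ.1ℚ ≡ 1#
  ι-1 = trans (sym (nat≡ι 1)) (+-identityʳ 1#)

  pow : R → ℕ → R
  pow x zero    = 1#
  pow x (suc n) = x ⊠ pow x n

  powers : ∀ {n} → ℕ → Vec ℕ n → R
  powers i []       = 1#
  powers i (c ∷ cs) = pow (t i) c ⊠ powers (suc i) cs

  nonZero : ∀ j c → ℕ.NonZero (suc j ℕ.^ c ℕ.* c !)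
  nonZero j c = ℕ.m*n≢0 _ _ {{ℕ.m^n≢0 (suc j) c}} {{c ℕ.!≢0}}

  -- The value at cycle length 0 is a dummy: lengths are numbered from 1.
  γ : ℕ → ℕ → R
  γ zero    c = 0#
  γ (suc j) c = ι (recip (suc j ℕ.^ c ℕ.* c !) {{nonZero j c}}) ⊠ pow (t (suc j)) c

  γ-zero : ∀ j → γ (suc j) 0 ≡ 1#
  γ-zero j = trans (*-identityʳ _) ι-1

  -- The factor cancels exactly what the denominator gains when the number of cycles grows by one.
  γ-suc : ∀ j c → nat (suc j ℕ.* suc c) ⊠ γ (suc j) (suc c) ≡ t (suc j) ⊠ γ (suc j) c
  γ-suc j c = begin
    nat jc ⊠ (ι (recip (suc j ℕ.^ suc c ℕ.* suc c !)) ⊠ (t (suc j) ⊠ tᶜ))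
      ≡⟨ *-assoc _ _ _ ⟨
    (nat jc ⊠ ι (recip (suc j ℕ.^ suc c ℕ.* suc c !))) ⊠ (t (suc j) ⊠ tᶜ)
      ≡⟨ cong (_⊠ (t (suc j) ⊠ tᶜ)) (begin
           nat jc ⊠ ι (recip (suc j ℕ.^ suc c ℕ.* suc c !))
             ≡⟨ cong₂ _⊠_ (nat≡ι jc) (cong ι (trans (recip-cong factor) (recip-* jc N))) ⟩
           ι (fromℤ (+ jc)) ⊠ ι (recip jc ℚ.* recip N)
             ≡⟨ ι-* (fromℤ (+ jc)) (recip jc ℚ.* recip N) ⟨
           ι (fromℤ (+ jc) ℚ.* (recip jc ℚ.* recip N))
             ≡⟨ cong ι (trans (sym (ℚ.*-assoc (fromℤ (+ jc)) (recip jc) (recip N)))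
                  (trans (cong (ℚ._* recip N) (recip-inverse jc)) (ℚ.*-identityˡ (recip N)))) ⟩
           ι (recip N) ∎) ⟩
    ι (recip N) ⊠ (t (suc j) ⊠ tᶜ)
      ≡⟨ *-exchange (ι (recip N)) (t (suc j)) tᶜ ⟩
    t (suc j) ⊠ (ι (recip N) ⊠ tᶜ) ∎
    where
    tᶜ = pow (t (suc j)) c
    jc = suc j ℕ.* suc c
    N = suc j ℕ.^ c ℕ.* c !
    instance
      N≢0 : ℕ.NonZero N
      N≢0 = nonZero j c
      N′≢0 : ℕ.NonZero (suc j ℕ.^ suc c ℕ.* suc c !)
      N′≢0 = nonZero j (suc c)
      jcN≢0 : ℕ.NonZero (jc ℕ.* N)
      jcN≢0 = ℕ.m*n≢0 jc N
    factor : suc j ℕ.^ suc c ℕ.* suc c ! ≡ jc ℕ.* N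
    factor = lemma (suc j) (suc j ℕ.^ c) (suc c) (c !)
      where
      lemma : ∀ a b c e → a ℕ.* b ℕ.* (c ℕ.* e) ≡ a ℕ.* c ℕ.* (b ℕ.* e)
      lemma = ℕSolver.solve-∀

  -- `denom` numbers positions from 0 and adds one itself, whereas `powers` and `term` carry the
  -- cycle length, hence `i` against `suc i`.
  powers≡term : ∀ {n} i (cs : Vec ℕ n) →
    ι (recip (proj₁ (denom i cs)) {{proj₂ (denom i cs)}}) ⊠ powers (suc i) cs
      ≡ term t γ γ-zero γ-suc (suc i) cs
  powers≡term i []       = trans (*-identityʳ _) ι-1
  powers≡term i (c ∷ cs) = begin
    ι (recip (N ℕ.* m)) ⊠ (tᶜ ⊠ M)          ≡⟨ cong (λ x → ι x ⊠ (tᶜ ⊠ M)) (recip-* N m) ⟩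
    ι (recip N ℚ.* recip m) ⊠ (tᶜ ⊠ M)      ≡⟨ cong (_⊠ (tᶜ ⊠ M)) (ι-* (recip N) (recip m)) ⟩
    (ι (recip N) ⊠ ι (recip m)) ⊠ (tᶜ ⊠ M)  ≡⟨ *-assoc _ _ _ ⟩
    ι (recip N) ⊠ (ι (recip m) ⊠ (tᶜ ⊠ M))  ≡⟨ cong (ι (recip N) ⊠_) (*-exchange (ι (recip m)) tᶜ M) ⟩
    ι (recip N) ⊠ (tᶜ ⊠ (ι (recip m) ⊠ M))  ≡⟨ *-assoc _ _ _ ⟨
    (ι (recip N) ⊠ tᶜ) ⊠ (ι (recip m) ⊠ M)  ≡⟨ cong ((ι (recip N) ⊠ tᶜ) ⊠_) (powers≡term (suc i) cs) ⟩
    γ (suc i) c ⊠ term t γ γ-zero γ-suc (suc (suc i)) cs ∎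
    where
    N = suc i ℕ.^ c ℕ.* c !
    m = proj₁ (denom (suc i) cs)
    tᶜ = pow (t (suc i)) c
    M = powers (suc (suc i)) cs
    instance
      N≢0 : ℕ.NonZero N
      N≢0 = nonZero i c
      m≢0 : ℕ.NonZero m
      m≢0 = proj₂ (denom (suc i) cs)
      Nm≢0 : ℕ.NonZero (N ℕ.* m)
      Nm≢0 = ℕ.m*n≢0 N m

  Ncoef≡recip : ∀ k (cs : Vec ℕ k) →
    Ncoef k cs ≡ fromℤ (+ (k !)) ℚ.* recip (proj₁ (denom 0 cs)) {{proj₂ (denom 0 cs)}}
  Ncoef≡recip k cs = /-recip (+ (k !)) (proj₁ (denom 0 cs)) {{proj₂ (denom 0 cs)}}

  cycleSum : ℕ → R
  cycleSum k = ∑ (cycleTypes k) (λ c → ι (Ncoef k c) ⊠ powers 1 c)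

  cycleSum≡coeff : ∀ k → cycleSum k ≡ nat (k !) ⊠ α t γ γ-zero γ-suc k k
  cycleSum≡coeff k = begin
    ∑ (cycleTypes k) f
      ≡⟨ ∑-filter (λ c → weight 1 c ℕ.≟ k) (vecsUpTo k k) f ⟩
    ∑ (vecsUpTo k k) (λ c → ⟦ weight 1 c ℕ.≟ k ⟧ ⊠ f c)
      ≡⟨ ∑-cong (vecsUpTo k k) (λ c → trans (cong (⟦ weight 1 c ℕ.≟ k ⟧ ⊠_) (f≡term c)) (*-exchange _ _ _)) ⟩
    ∑ (vecsUpTo k k) (λ c → nat (k !) ⊠ (⟦ weight 1 c ℕ.≟ k ⟧ ⊠ term t γ γ-zero γ-suc 1 c))
      ≡⟨ ∑-*ˡ (vecsUpTo k k) (nat (k !)) _ ⟩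
    nat (k !) ⊠ α t γ γ-zero γ-suc k k ∎
    where
    f : Vec ℕ k → R
    f c = ι (Ncoef k c) ⊠ powers 1 c
    f≡term : ∀ c → f c ≡ nat (k !) ⊠ term t γ γ-zero γ-suc 1 c
    f≡term c = begin
      ι (Ncoef k c) ⊠ M                          ≡⟨ cong (λ x → ι x ⊠ M) (Ncoef≡recip k c) ⟩
      ι (fromℤ (+ (k !)) ℚ.* r) ⊠ M              ≡⟨ cong (_⊠ M) (trans (ι-* (fromℤ (+ (k !))) r) (cong (_⊠ ι r)
           (sym (nat≡ι (k !))))) ⟩
      (nat (k !) ⊠ ι r) ⊠ M                      ≡⟨ *-assoc _ _ _ ⟩
      nat (k !) ⊠ (ι r ⊠ M)                      ≡⟨ cong (nat (k !) ⊠_) (powers≡term 0 c) ⟩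
      nat (k !) ⊠ term t γ γ-zero γ-suc 1 c      ∎
      where
      M = powers 1 c
      r = recip (proj₁ (denom 0 c)) {{proj₂ (denom 0 c)}}

  sgn² : ∀ k → sgn k ⊠ sgn k ≡ 1#
  sgn² zero    = *-identityˡ 1#
  sgn² (suc k) = begin
    ⊟ sgn k ⊠ ⊟ sgn k      ≡⟨ -‿distribˡ-* (sgn k) _ ⟨
    ⊟ (sgn k ⊠ ⊟ sgn k)    ≡⟨ cong ⊟_ (-‿distribʳ-* (sgn k) (sgn k)) ⟨
    ⊟ ⊟ (sgn k ⊠ sgn k)    ≡⟨ -‿involutive _ ⟩
    sgn k ⊠ sgn k          ≡⟨ sgn² k ⟩
    1#                     ∎

  module _ (s : ℕ → R) (t≡-s : ∀ j → t j ≡ ⊟ s j) (τ : ℕ → ℕ → R) (τ-zero : ∀ j → τ 0 j ≡ 1#)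
           (τ-suc : ∀ k j → τ (suc k) j ≡ (s j ⊠ τ k 1) + (⊟ (nat k ⊠ τ k (suc j)))) where

    -- Passing to t = -s gives both terms of the recursion the same sign, the form that `τ≡α`
    -- treats. The sign (-1)^k changes sides because it squares to 1.
    cycleSum≡τ : ∀ k → cycleSum k ≡ sgn k ⊠ τ k 1
    cycleSum≡τ k = begin
      cycleSum k                              ≡⟨ *-identityˡ _ ⟨
      1# ⊠ cycleSum k                         ≡⟨ cong (_⊠ cycleSum k) (sgn² k) ⟨
      (sgn k ⊠ sgn k) ⊠ cycleSum k            ≡⟨ *-assoc _ _ _ ⟩
      sgn k ⊠ (sgn k ⊠ cycleSum k)            ≡⟨ cong (λ z → sgn k ⊠ (sgn k ⊠ z)) (cycleSum≡coeff k) ⟩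
      sgn k ⊠ (sgn k ⊠ (nat (k !) ⊠ α t γ γ-zero γ-suc k k))
        ≡⟨ cong (sgn k ⊠_) (τ≡α t γ γ-zero γ-suc k τ τ-zero step k ℕ.≤-refl) ⟨
      sgn k ⊠ τ k 1                           ∎
      where
      step : ∀ k j → τ (suc k) j ≡ (⊟ (t j ⊠ τ k 1)) + (⊟ (nat k ⊠ τ k (suc j)))
      step k j = trans (τ-suc k j) (cong (_+ (⊟ (nat k ⊠ τ k (suc j)))) (begin
        s j ⊠ τ k 1            ≡⟨ -‿involutive _ ⟨
        ⊟ ⊟ (s j ⊠ τ k 1)      ≡⟨ cong ⊟_ (-‿distribˡ-* (s j) _) ⟩
        ⊟ (⊟ s j ⊠ τ k 1)      ≡⟨ cong (λ z → ⊟ (z ⊠ τ k 1)) (t≡-s j) ⟨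
        ⊟ (t j ⊠ τ k 1)        ∎))

-- The ring ℚ[X]/(X² - d).

module QuadraticRing (d : ℚ) where
  open QrtOps d
  open +-*-Solver

  infix 8 ⊖_
  ⊖_ : Qrt d → Qrt d
  ⊖ (a +√ b) = (ℚ.- a) +√ (ℚ.- b)

  ⊗-assoc : ∀ x y z → (x ⊗ y) ⊗ z ≡ x ⊗ (y ⊗ z)
  ⊗-assoc (a +√ b) (a′ +√ b′) (a″ +√ b″) = cong₂ _+√_
    (solve 7 (λ d a b a′ b′ a″ b″ →
      (a :* a′ :+ d :* (b :* b′)) :* a″ :+ d :* ((a :* b′ :+ b :* a′) :* b″)
      := a :* (a′ :* a″ :+ d :* (b′ :* b″)) :+ d :* (b :* (a′ :* b″ :+ b′ :* a″))) refl d a b a′ b′ a″ b″)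
    (solve 7 (λ d a b a′ b′ a″ b″ →
      (a :* a′ :+ d :* (b :* b′)) :* b″ :+ (a :* b′ :+ b :* a′) :* a″
      := a :* (a′ :* b″ :+ b′ :* a″) :+ b :* (a′ :* a″ :+ d :* (b′ :* b″))) refl d a b a′ b′ a″ b″)

  ⊗-comm : ∀ x y → x ⊗ y ≡ y ⊗ x
  ⊗-comm (a +√ b) (a′ +√ b′) = cong₂ _+√_
    (cong₂ ℚ._+_ (ℚ.*-comm a a′) (cong (d ℚ.*_) (ℚ.*-comm b b′)))
    (trans (ℚ.+-comm (a ℚ.* b′) (b ℚ.* a′)) (cong₂ ℚ._+_ (ℚ.*-comm b a′) (ℚ.*-comm a b′)))

  ⊗-identityˡ : ∀ x → 𝟙 ⊗ x ≡ x
  ⊗-identityˡ (a +√ b) = cong₂ _+√_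
    (solve 3 (λ d a b → con ℚ.1ℚ :* a :+ d :* (con ℚ.0ℚ :* b) := a) refl d a b)
    (solve 2 (λ a b → con ℚ.1ℚ :* b :+ con ℚ.0ℚ :* a := b) refl a b)

  ⊗-distribˡ-⊕ : ∀ x y z → x ⊗ (y ⊕ z) ≡ (x ⊗ y) ⊕ (x ⊗ z)
  ⊗-distribˡ-⊕ (a +√ b) (a′ +√ b′) (a″ +√ b″) = cong₂ _+√_
    (solve 7 (λ d a b a′ b′ a″ b″ → a :* (a′ :+ a″) :+ d :* (b :* (b′ :+ b″))
      := (a :* a′ :+ d :* (b :* b′)) :+ (a :* a″ :+ d :* (b :* b″))) refl d a b a′ b′ a″ b″)
    (solve 6 (λ a b a′ b′ a″ b″ → a :* (b′ :+ b″) :+ b :* (a′ :+ a″)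
      := (a :* b′ :+ b :* a′) :+ (a :* b″ :+ b :* a″)) refl a b a′ b′ a″ b″)

  -- Here d may be a rational square, as happens for d = q with s even; the ring then has zero
  -- divisors, so nothing beyond the laws of a commutative ring is available.
  ⊕-⊗-isCommutativeRing : IsCommutativeRing _≡_ _⊕_ _⊗_ ⊖_ 𝟘 𝟙
  ⊕-⊗-isCommutativeRing = record
    { isRing = record
      { +-isAbelianGroup = record
        { isGroup = record
          { isMonoid = record
            { isSemigroup = record
              { isMagma = record { isEquivalence = isEquivalence ; ∙-cong = cong₂ _⊕_ }
              ; assoc   = λ (a +√ b) (a′ +√ b′) (a″ +√ b″) → cong₂ _+√_ (ℚ.+-assoc a a′ a″) (ℚ.+-assoc b b′ b″)
              }
            ; identity = (λ (a +√ b) → cong₂ _+√_ (ℚ.+-identityˡ a) (ℚ.+-identityˡ b))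
                       , (λ (a +√ b) → cong₂ _+√_ (ℚ.+-identityʳ a) (ℚ.+-identityʳ b))
            }
          ; inverse = (λ (a +√ b) → cong₂ _+√_ (ℚ.+-inverseˡ a) (ℚ.+-inverseˡ b))
                    , (λ (a +√ b) → cong₂ _+√_ (ℚ.+-inverseʳ a) (ℚ.+-inverseʳ b))
          ; ⁻¹-cong = cong ⊖_
          }
        ; comm = λ (a +√ b) (a′ +√ b′) → cong₂ _+√_ (ℚ.+-comm a a′) (ℚ.+-comm b b′)
        }
      ; *-cong     = cong₂ _⊗_
      ; *-assoc    = ⊗-assoc
      ; *-identity = ⊗-identityˡ , λ x → trans (⊗-comm x 𝟙) (⊗-identityˡ x)
      ; distrib    = ⊗-distribˡ-⊕
                   , λ x y z → trans (⊗-comm (y ⊕ z) x) (trans (⊗-distribˡ-⊕ x y z) (cong₂ _⊕_ (⊗-comm x y) (⊗-comm x z)))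
      }
    ; *-comm = ⊗-comm
    }

  ι-⊗ : ∀ a b → ι (a ℚ.* b) ≡ ι a ⊗ ι b
  ι-⊗ a b = cong₂ _+√_
    (solve 3 (λ d a b → a :* b := a :* b :+ d :* (con ℚ.0ℚ :* con ℚ.0ℚ)) refl d a b)
    (solve 2 (λ a b → con ℚ.0ℚ := a :* con ℚ.0ℚ :+ con ℚ.0ℚ :* b) refl a b)

-- Projection to ℚ[X]/(X² - d) and evaluation of the count.

module Evaluation (F : FiniteField) (p s : ℕ) (p-prime : Prime p) (p≢2 : p ≢ 2)
                  (size≡p^s : FiniteField.size F ≡ p ℕ.^ s) where
  open FiniteField F renaming (_+_ to _+ᶠ_; _*_ to _*ᶠ_; -_ to infix 8 -ᶠ_; _≟_ to infix 4 _≟_)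
  open Characteristic F p s p-prime size≡p^s
  open QuadraticCharacter F (fromℕ2≢0 p≢2) public
  open Fractions
  open ≡-Reasoning

  isSquare-true : ∀ {x} → IsSq x → isSquare x ≡ true
  isSquare-true {x} (y , eq) with any? (λ y → (y *ᶠ y) ≟ x) elems
  ... | yes _ = refl
  ... | no ¬a = contradiction (Any.map (λ { refl → eq }) (elems-complete y)) ¬a

  isSquare-false : ∀ {x} → ¬ IsSq x → isSquare x ≡ false
  isSquare-false {x} ¬sq with any? (λ y → (y *ᶠ y) ≟ x) elems
  ... | yes a = contradiction (Any.satisfied a) ¬sq
  ... | no  _ = refl

  module _ (d : ℚ) (d≡εq : d ≡ fromℤ (ε ℤ.* q)) where
    open QrtOps d
    open QuadraticRing d
    open Sums ⊕-⊗-isCommutativeRing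
    open CycleIndex ⊕-⊗-isCommutativeRing
    open import Data.Integer.Base using (_+_; _*_; -_; _-_; 0ℤ; 1ℤ; -1ℤ)

    nat≡ι : ∀ n → nat n ≡ ι (fromℤ (+ n))
    nat≡ι zero    = refl
    nat≡ι (suc n) = trans (cong (𝟙 ⊕_) (nat≡ι n)) (cong ι (sym (fromℤ-+ (+ 1) (+ n))))

    ι-scale : ∀ x a b → ι x ⊗ (a +√ b) ≡ (x ℚ.* a) +√ (x ℚ.* b)
    ι-scale x a b = cong₂ _+√_
      (solve 4 (λ d x a b → x :* a :+ d :* (con ℚ.0ℚ :* b) := x :* a) refl d x a b)
      (solve 3 (λ x a b → x :* b :+ con ℚ.0ℚ :* a := x :* b) refl x a b)
      where open +-*-Solver

    -- The projection of the group ring that kills J and sends G to σ √d.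
    φ : ℤ → Coef → Qrt d
    φ σ g = fromℤ (cα g) +√ fromℤ (σ * cγ g)

    -- Once J is sent to 0, the relation for G² reads G² = εq = d, which σ√d satisfies because σ² =
    -- 1.
    φ-∙ : ∀ σ → σ * σ ≡ 1ℤ → ∀ g h → φ σ (g ∙ h) ≡ φ σ g ⊗ φ σ h
    φ-∙ σ σ²≡1 ⟨ α , β , γ ⟩ ⟨ α′ , β′ , γ′ ⟩ = cong₂ _+√_
      (begin
        fromℤ (α * α′ + ε * q * (γ * γ′))
          ≡⟨ cong (λ z → fromℤ (α * α′ + ε * q * z)) (trans (sym (ℤ.*-identityˡ _)) (trans (cong (_* (γ * γ′))
               (sym σ²≡1)) (regroup σ γ γ′))) ⟩
        fromℤ (α * α′ + ε * q * ((σ * γ) * (σ * γ′)))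
          ≡⟨ trans (fromℤ-+ (α * α′) _) (cong₂ ℚ._+_ (fromℤ-* α α′)
               (trans (fromℤ-* (ε * q) _) (cong₂ ℚ._*_ (sym d≡εq) (fromℤ-* (σ * γ) (σ * γ′))))) ⟩
        fromℤ α ℚ.* fromℤ α′ ℚ.+ d ℚ.* (fromℤ (σ * γ) ℚ.* fromℤ (σ * γ′)) ∎)
      (begin
        fromℤ (σ * (α * γ′ + γ * α′))
          ≡⟨ cong fromℤ (expand σ α γ α′ γ′) ⟩
        fromℤ (α * (σ * γ′) + (σ * γ) * α′)
          ≡⟨ trans (fromℤ-+ (α * (σ * γ′)) _) (cong₂ ℚ._+_ (fromℤ-* α (σ * γ′)) (fromℤ-* (σ * γ) α′)) ⟩
        fromℤ α ℚ.* fromℤ (σ * γ′) ℚ.+ fromℤ (σ * γ) ℚ.* fromℤ α′ ∎)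
      where
      regroup : ∀ s a b → s * s * (a * b) ≡ (s * a) * (s * b)
      regroup = ℤSolver.solve-∀
      expand : ∀ s a c a′ c′ → s * (a * c′ + c * a′) ≡ a * (s * c′) + (s * c) * a′
      expand = ℤSolver.solve-∀

    φ-τ-suc : ∀ σ k j → φ σ (τ (suc k) j) ≡ φ σ (squareSum (fromℕ j) ∙ τ k 1) ⊕ ⊖ (nat k ⊗ φ σ (τ k (suc j)))
    φ-τ-suc σ k j = begin
      fromℤ (a - + k * a′) +√ fromℤ (σ * (c - + k * c′))
        ≡⟨ cong₂ _+√_ (linear a a′) (trans (cong fromℤ (expand σ (+ k) c c′)) (linear (σ * c) (σ * c′))) ⟩
      (fromℤ a +√ fromℤ (σ * c)) ⊕ ⊖ ((fromℤ (+ k) ℚ.* fromℤ a′) +√ (fromℤ (+ k) ℚ.* fromℤ (σ * c′)))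
        ≡⟨ cong (λ z → (fromℤ a +√ fromℤ (σ * c)) ⊕ ⊖ z)
             (trans (cong (_⊗ φ σ ρ) (nat≡ι k)) (ι-scale (fromℤ (+ k)) (fromℤ a′) (fromℤ (σ * c′)))) ⟨
      φ σ (squareSum (fromℕ j) ∙ τ k 1) ⊕ ⊖ (nat k ⊗ φ σ ρ) ∎
      where
      ρ = τ k (suc j)
      a = cα (squareSum (fromℕ j) ∙ τ k 1)
      c = cγ (squareSum (fromℕ j) ∙ τ k 1)
      a′ = cα ρ
      c′ = cγ ρ
      expand : ∀ s k c c′ → s * (c - k * c′) ≡ s * c - k * (s * c′)
      expand = ℤSolver.solve-∀
      linear : ∀ x y → fromℤ (x - + k * y) ≡ fromℤ x ℚ.+ ℚ.- (fromℤ (+ k) ℚ.* fromℤ y)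
      linear x y = trans (fromℤ-+ x (- (+ k * y)))
        (cong (fromℤ x ℚ.+_) (trans (fromℤ-neg (+ k * y)) (cong ℚ.-_ (fromℤ-* (+ k) y))))

    sign : ℕ → ℤ
    sign k = -1ℤ ℤ.^ k

    sign² : ∀ k → sign k * sign k ≡ 1ℤ
    sign² zero    = refl
    sign² (suc k) = trans (regroup (sign k)) (sign² k)
      where
      regroup : ∀ s → -1ℤ * s * (-1ℤ * s) ≡ s * s
      regroup = ℤSolver.solve-∀

    sgn≡sign : ∀ k → sgn k ≡ ι (fromℤ (sign k))
    sgn≡sign zero    = refl
    sgn≡sign (suc k) = trans (cong ⊖_ (sgn≡sign k))
      (cong ι (trans (sym (fromℤ-neg (sign k))) (cong fromℤ (sym (ℤ.-1*i≡-i (sign k))))))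

    module _ (σ : ℤ) (σ²≡1 : σ * σ ≡ 1ℤ) {u v w : Qrt d}
             (u≡ : u ≡ ⊖ φ σ ⟨ -1ℤ , 1ℤ , 1ℤ ⟩) (v≡ : v ≡ ⊖ φ σ ⟨ -1ℤ , 1ℤ , -1ℤ ⟩)
             (w≡ : w ≡ ⊖ φ σ ⟨ q - 1ℤ , 0ℤ , 0ℤ ⟩) where

      t : ℕ → Qrt d
      t = tval F p d 1# u v w

      -- p divides j exactly when j vanishes in the field. Otherwise χ(1) = 1 makes u belong to χ(j)
      -- = 1, with value -(-1 + σ√d) = 1 - σ√d, and v to χ(j) = -1, with value 1 + σ√d.
      t≡φ : ∀ j → t j ≡ ⊖ φ σ (squareSum (fromℕ j))
      t≡φ j with p ∣? j | fromℕ j ≟ 0#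
      ... | yes _   | yes _   = w≡
      ... | yes p∣j | no j≢0  = contradiction (p∣⇒fromℕ≡0 p∣j) j≢0
      ... | no p∤j  | yes j≡0 = contradiction (fromℕ≡0⇒p∣ j≡0) p∤j
      ... | no _    | no j≢0 with isSq? (fromℕ j)
      ...   | yes sq rewrite isSquare-true sq | isSquare-true IsSq-1 | χ-square j≢0 sq = u≡
      ...   | no ¬sq rewrite isSquare-false ¬sq | isSquare-true IsSq-1 | χ-nonsquare ¬sq = v≡

      A≡φτ : ∀ k → A F p d k 1# u v w ≡ ι (fromℤ (sign k)) ⊗ φ σ (τ k 1)
      A≡φτ k = trans A≡cycleSum (trans
        (cycleSum≡τ (λ j → φ σ (squareSum (fromℕ j))) t≡φ (λ k j → φ σ (τ k j))
          (λ j → cong (λ z → ℚ.1ℚ +√ fromℤ z) (ℤ.*-zeroʳ σ))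
          (λ k j → trans (φ-τ-suc σ k j) (cong (_⊕ ⊖ (nat k ⊗ φ σ (τ k (suc j)))) (φ-∙ σ σ²≡1 (squareSum (fromℕ j)) (τ k 1)))) k)
        (cong (_⊗ φ σ (τ k 1)) (sgn≡sign k)))
        where
        open RationalCycleIndex ⊕-⊗-isCommutativeRing ι ι-⊗ nat≡ι t
        ^≡pow : ∀ x n → x ^ n ≡ pow x n
        ^≡pow x zero    = refl
        ^≡pow x (suc n) = cong (x ⊗_) (^≡pow x n)
        monomial≡powers : ∀ {n} i (cs : Vec ℕ n) → monomial F p d 1# u v w i cs ≡ powers i cs
        monomial≡powers i []       = refl
        monomial≡powers i (c ∷ cs) = cong₂ _⊗_ (^≡pow (t i) c) (monomial≡powers (suc i) cs)
        Σ-list≡∑ : ∀ {X : Set} (f g : X → Qrt d) → (∀ x → f x ≡ g x) → ∀ xs → Σ-list (map f xs) ≡ ∑ xs g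
        Σ-list≡∑ f g eq []       = refl
        Σ-list≡∑ f g eq (x ∷ xs) = cong₂ _⊕_ (eq x) (Σ-list≡∑ f g eq xs)
        A≡cycleSum : A F p d k 1# u v w ≡ cycleSum k
        A≡cycleSum = Σ-list≡∑ (λ c → ι (Ncoef k c) ⊗ monomial F p d 1# u v w 1 c) (λ c → ι (Ncoef k c) ⊗ powers 1 c)
          (λ c → cong (ι (Ncoef k c) ⊗_) (monomial≡powers 1 c)) (cycleTypes k)

    instance
      size≢0 : ℕ.NonZero size
      size≢0 = nonempty (elems-complete 0#)
        where
        nonempty : ∀ {x : Carrier} {xs} → x ∈ xs → ℕ.NonZero (length xs)
        nonempty (here _)  = _
        nonempty (there _) = _
      2*size≢0 : ℕ.NonZero (2 ℕ.* size)
      2*size≢0 = ℕ.m*n≢0 2 size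

    -- This is `q*Nstar0` divided by q. To meet the shape of `rhs`, α is written as half of α + α,
    -- and 1 as the square of (-1)^k: one sign stands in the formula, the other comes from the cycle
    -- index.
    Nstar0/1 : ∀ k → fromℤ (+ Nstar0 k) ≡ (fall (q - 1ℤ) k ℚ./ size)
      ℚ.+ (fromℤ (sign k) ℚ.* ((q - 1ℤ) ℚ./ (2 ℕ.* size))) ℚ.* (fromℤ (sign k) ℚ.*
           (fromℤ (cα (τ k 1)) ℚ.+ fromℤ (cα (τ k 1))))
    Nstar0/1 k = begin
      n
        ≡⟨ trans (sym (ℚ.*-identityˡ n)) (cong (ℚ._* n) (sym (recip-inverse size))) ⟩
      fromℤ q ℚ.* r ℚ.* n
        ≡⟨ solve 3 (λ q r n → q :* r :* n := (q :* n) :* r) refl (fromℤ q) r n ⟩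
      (fromℤ q ℚ.* n) ℚ.* r
        ≡⟨ cong (ℚ._* r) (trans (sym (fromℤ-* q (+ Nstar0 k))) (trans (cong fromℤ (q*Nstar0 k))
             (trans (fromℤ-+ (fall (q - 1ℤ) k) _) (cong (f ℚ.+_) (fromℤ-* (q - 1ℤ) (cα (τ k 1))))))) ⟩
      (f ℚ.+ g ℚ.* a) ℚ.* r
        ≡⟨ solve 4 (λ f g a r → (f :+ g :* a) :* r := f :* r :+ con ℚ.1ℚ :* (g :* (con ℚ.½ :* r)) :* (a :+ a)) refl f g a r ⟩
      f ℚ.* r ℚ.+ ℚ.1ℚ ℚ.* (g ℚ.* (ℚ.½ ℚ.* r)) ℚ.* (a ℚ.+ a)
        ≡⟨ cong (λ z → f ℚ.* r ℚ.+ z ℚ.* (g ℚ.* (ℚ.½ ℚ.* r)) ℚ.* (a ℚ.+ a)) (trans (cong fromℤ (sym (sign² k)))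
             (fromℤ-* (sign k) (sign k))) ⟩
      f ℚ.* r ℚ.+ (S ℚ.* S) ℚ.* (g ℚ.* (ℚ.½ ℚ.* r)) ℚ.* (a ℚ.+ a)
        ≡⟨ cong (f ℚ.* r ℚ.+_) (solve 3 (λ S X b → S :* S :* X :* b := S :* X :* (S :* b)) refl S (g ℚ.*
             (ℚ.½ ℚ.* r)) (a ℚ.+ a)) ⟩
      f ℚ.* r ℚ.+ (S ℚ.* (g ℚ.* (ℚ.½ ℚ.* r))) ℚ.* (S ℚ.* (a ℚ.+ a))
        ≡⟨ cong₂ (λ x y → x ℚ.+ (S ℚ.* y) ℚ.* (S ℚ.* (a ℚ.+ a))) (/-recip (fall (q - 1ℤ) k) size)
             (trans (/-recip (q - 1ℤ) (2 ℕ.* size)) (cong (g ℚ.*_) (recip-* 2 size))) ⟨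
      (fall (q - 1ℤ) k ℚ./ size) ℚ.+ (S ℚ.* ((q - 1ℤ) ℚ./ (2 ℕ.* size))) ℚ.* (S ℚ.* (a ℚ.+ a)) ∎
      where
      open +-*-Solver
      n = fromℤ (+ Nstar0 k)
      r = recip size
      f = fromℤ (fall (q - 1ℤ) k)
      g = fromℤ (q - 1ℤ)
      a = fromℤ (cα (τ k 1))
      S = fromℤ (sign k)

    Nstar0≡rhs : ∀ k → ι (fromℤ (+ Nstar0 k)) ≡ rhs F p d k
    Nstar0≡rhs k = sym (begin
      rhs F p d k
        ≡⟨ cong (λ z → ι (fall (q - 1ℤ) k ℚ./ size) ⊕ ι (S ℚ.* X) ⊗ z)
             -- The two summands are the projections with σ = 1 and σ = -1, which exchange the roles
             -- of u and v.
             (cong₂ _⊕_ (A≡φτ 1ℤ refl refl refl (w≡ 1ℤ) k) (A≡φτ -1ℤ refl refl refl (w≡ -1ℤ) k)) ⟩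
      ι (fall (q - 1ℤ) k ℚ./ size) ⊕ ι (S ℚ.* X) ⊗ (ι S ⊗ φ 1ℤ (τ k 1) ⊕ ι S ⊗ φ -1ℤ (τ k 1))
        ≡⟨ cong (λ z → ι (fall (q - 1ℤ) k ℚ./ size) ⊕ ι (S ℚ.* X) ⊗ z)
             (trans (sym (⊗-distribˡ-⊕ (ι S) (φ 1ℤ (τ k 1)) (φ -1ℤ (τ k 1)))) (trans (cong (ι S ⊗_) conjugates)
                  (sym (ι-⊗ S (a ℚ.+ a))))) ⟩
      ι (fall (q - 1ℤ) k ℚ./ size) ⊕ ι (S ℚ.* X) ⊗ ι (S ℚ.* (a ℚ.+ a))
        ≡⟨ cong (ι (fall (q - 1ℤ) k ℚ./ size) ⊕_) (ι-⊗ (S ℚ.* X) (S ℚ.* (a ℚ.+ a))) ⟨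
      ι ((fall (q - 1ℤ) k ℚ./ size) ℚ.+ (S ℚ.* X) ℚ.* (S ℚ.* (a ℚ.+ a)))
        ≡⟨ cong ι (Nstar0/1 k) ⟨
      ι (fromℤ (+ Nstar0 k)) ∎)
      where
      a = fromℤ (cα (τ k 1))
      S = fromℤ (sign k)
      X = (q - 1ℤ) ℚ./ (2 ℕ.* size)
      w≡ : ∀ σ → ι (fromℤ (1ℤ - q)) ≡ ⊖ φ σ ⟨ q - 1ℤ , 0ℤ , 0ℤ ⟩
      w≡ σ = cong₂ _+√_ (trans (cong fromℤ (negate q)) (fromℤ-neg (q - 1ℤ)))
        (cong (λ z → ℚ.- fromℤ z) (sym (ℤ.*-zeroʳ σ)))
        where
        negate : ∀ q → 1ℤ - q ≡ - (q - 1ℤ)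
        negate = ℤSolver.solve-∀
      -- The √d parts are opposite and cancel, leaving twice the rational part α.
      conjugates : φ 1ℤ (τ k 1) ⊕ φ -1ℤ (τ k 1) ≡ ι (a ℚ.+ a)
      conjugates = cong ((a ℚ.+ a) +√_) (trans (sym (fromℤ-+ (1ℤ * c) (-1ℤ * c))) (cong fromℤ (cancel c)))
        where
        c = cγ (τ k 1)
        cancel : ∀ c → 1ℤ * c + -1ℤ * c ≡ 0ℤ
        cancel = ℤSolver.solve-∀

-- The choice of d according to q modulo 4.

open import Data.Nat using (_≤_; _^_; _%_)
open import Data.Rational using (_/_; -_)

theorem4p6 : (p s : ℕ) → Prime p → p ≢ 2 → 1 ≤ s →
    (F : FiniteField) → FiniteField.size F ≡ p ^ s →
    (k : ℕ) → 1 ≤ k →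
    ((p % 4 ≡ 1 ⊎ (p % 4 ≡ 3 × s % 2 ≡ 0)) →
    QrtOps.ι (+ (p ^ s) / 1) (+ FiniteField.Nstar0 F k / 1) ≡ rhs F p (+ (p ^ s) / 1) k)
    × ((p % 4 ≡ 3 × s % 2 ≡ 1) →
    QrtOps.ι (- (+ (p ^ s) / 1)) (+ FiniteField.Nstar0 F k / 1) ≡ rhs F p (- (+ (p ^ s) / 1)) k)
theorem4p6 p s p-prime p≢2 _ F size≡p^s k _ = part₁ , part₂
  where
  open Evaluation F p s p-prime p≢2 size≡p^s
  open Fractions
  open Mod4

  q≡p^s : q ≡ + (p ^ s)
  q≡p^s = cong +_ size≡p^s

  Goal : ℚ → Set
  Goal d = QrtOps.ι d (+ FiniteField.Nstar0 F k / 1) ≡ rhs F p d k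

  p^s≡1 : (p % 4 ≡ 1 ⊎ (p % 4 ≡ 3 × s % 2 ≡ 0)) → + (p ^ s) ≡4 + 1
  p^s≡1 (inj₁ p≡1)        = 1^s p≡1 s
  p^s≡1 (inj₂ (p≡3 , eq)) = 3^even p≡3 s eq

  part₁ : (p % 4 ≡ 1 ⊎ (p % 4 ≡ 3 × s % 2 ≡ 0)) → Goal (+ (p ^ s) / 1)
  -- Since q is 1 modulo 4, only the alternative `ε` = 1 survives, and then d = εq = q.
  part₁ h = [ (λ (ε≡1 , _) → Nstar0≡rhs (+ (p ^ s) / 1)
                (cong fromℤ (sym (trans (cong (ℤ._* q) ε≡1) (trans (ℤ.*-identityˡ q) q≡p^s)))) k)
            , (λ (_ , e , q≡3) → contradiction (mod4 e (trans (sym q≡p^s) q≡3)) (1≢3 (p^s≡1 h)))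
            ]′ ε-mod4

  part₂ : (p % 4 ≡ 3 × s % 2 ≡ 1) → Goal (- (+ (p ^ s) / 1))
  -- An odd power of p is 3 modulo 4, which leaves `ε` = -1 and d = -q.
  part₂ (p≡3 , eq) =
    [ (λ (_ , e , q≡1) → contradiction (3^odd p≡3 s eq) (1≢3 (mod4 e (trans (sym q≡p^s) q≡1))))
    , (λ (ε≡-1 , _) → Nstar0≡rhs (- (+ (p ^ s) / 1))
        (trans (sym (fromℤ-neg (+ (p ^ s))))
          (cong fromℤ (sym (trans (cong (ℤ._* q) ε≡-1) (trans (ℤ.-1*i≡-i q) (cong ℤ.-_ q≡p^s)))))) k)
    ]′ ε-mod4
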